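{- Suppose $f\in\mathfrak{E}^{\varepsilon_0}(n_0,d)$, where $0<\varepsilon_0<1$. Then for all $\varepsilon_0<\varepsilon<1$ and all $n\ge d$ (with $n\ge2$), $$A^\varepsilon(n,d)\le O\left(\frac{\mathbf{R}(f)\cdot n_0^d\cdot d\log n}{(n_0)_d\,(\delta-1)^2}\right),$$ where $\delta:=\min\left(\frac{1+\varepsilon}{1+\varepsilon_0},\frac{1-\varepsilon_0}{1-\varepsilon}\right)$ and the implied constant is absolute.
   Context: For a homogeneous $g\in\mathbb{C}[x_1,\ldots,x_n]_d$, the Waring rank $\mathbf{R}(g)$ is the minimum $r$ such that $g=\ell_1^d+\cdots+\ell_r^d$ for some complex linear forms $\ell_i$. For $0\le\varepsilon<1$ and $n\ge d$, $\mathfrak{E}^\varepsilon(n,d)$ is the set of $g\in\mathbb{R}[x_1,\ldots,x_n]_d$ whose set of monomials with nonzero coefficient is exactly the set of all multilinear monomials $x_{i_1}\cdots x_{i_d}$, $1\le i_1<\cdots<i_d\le n$, and whose nonzero coefficients lie in $[1-\varepsilon,1+\varepsilon]$; $A^\varepsilon(n,d):=\min\{\mathbf{R}(g):g\in\mathfrak{E}^\varepsilon(n,d)\}$. Here $n_0\ge d$ and $(m)_k=m(m-1)\cdots(m-k+1)$ is the falling factorial. -}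

module Defs where

open import Algebra.Bundles using (CommutativeRing)
import Algebra.Consequences.Setoid
import Algebra.Properties.CommutativeMonoid.Sum as Sum
open import Data.Bool.Base using (true)
open import Data.Fin.Base using (Fin; toℕ)
open import Data.Integer.Base using (+_)
import Data.Integer.Base as ℤ
import Data.Integer.Properties as ℤ
open import Data.Nat.Base as ℕ using (ℕ; zero; suc)
import Data.Nat.Properties as ℕ
open import Data.Nat.Combinatorics.Base using (_P_; _P′_)
open import Data.Product.Base using (Σ-syntax; ∃; ∃-syntax; _×_; _,_; proj₁; proj₂)
open import Data.Rational.Base as ℚ using (ℚ; 0ℚ; 1ℚ; ½)
import Data.Rational.Properties as ℚ
import Data.Rational.Unnormalised.Base as ℚᵘ
import Data.Rational.Unnormalised.Properties as ℚᵘ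
open import Data.Rational.Solver using (module +-*-Solver)
open import Data.Sum.Base using (_⊎_; inj₁; inj₂)
open import Data.Vec.Base as Vec using (Vec; []; _∷_)
open import Data.Vec.Relation.Unary.All using (All)
open import Function.Base using (_∘_)
open import Function.Bundles using (_⇔_)
open import Level using (0ℓ; _⊔_)
open import Relation.Binary.Bundles using (Setoid)
open import Relation.Binary.PropositionalEquality
  using (_≡_; _≢_; refl; sym; trans; cong; cong₂; subst; subst₂)
open import Relation.Nullary using (¬_)

open +-*-Solver using (solve; _:=_; _:+_; _:*_; _:-_; :-_; con)

Eventually : (ℕ → Set) → Set
Eventually Q = ∃[ N ] (∀ n → N ℕ.≤ n → Q n)

Close : ℚ → ℚ → ℚ → Set
Close e p q = ℚ.∣ p ℚ.- q ∣ ℚ.< e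

both : ∀ {Q R S : ℕ → Set} → (∀ n → Q n → R n → S n) →
       Eventually Q → Eventually R → Eventually S
both f (N , q) (M , r) = N ℕ.⊔ M , λ n le →
  f n (q n (ℕ.≤-trans (ℕ.m≤m⊔n N M) le)) (r n (ℕ.≤-trans (ℕ.m≤n⊔m N M) le))

map : ∀ {Q R : ℕ → Set} → (∀ n → Q n → R n) → Eventually Q → Eventually R
map f (N , q) = N , λ n le → f n (q n le)

module _ where
  open import Data.Rational.Base

  half>0 : ∀ {e} → 0ℚ < e → 0ℚ < ½ * e
  half>0 {e} e>0 = subst (_< ½ * e) (ℚ.*-zeroʳ ½) (ℚ.*-monoʳ-<-pos ½ e>0)

  half+half : ∀ e → ½ * e + ½ * e ≡ e
  half+half = solve 1 (λ e → con ½ :* e :+ con ½ :* e := e) refl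

  *>0 : ∀ {p q} → 0ℚ < p → 0ℚ < q → 0ℚ < p * q
  *>0 {p} {q} p>0 q>0 =
    subst (_< p * q) (ℚ.*-zeroʳ p) (ℚ.*-monoʳ-<-pos p {{positive p>0}} q>0)

  1/>0 : ∀ {p} (p>0 : 0ℚ < p) → 0ℚ < (1/ p) {{>-nonZero p>0}}
  1/>0 {p} p>0 = ℚ.positive⁻¹ _ {{ℚ.1/pos⇒pos p {{positive p>0}}}}

  *-mono-<₊ : ∀ {a b c d} → 0ℚ ≤ a → 0ℚ ≤ c → a < b → c < d → a * c < b * d
  *-mono-<₊ {a} {b} {c} {d} a≥0 c≥0 a<b c<d = ℚ.≤-<-trans
    (ℚ.*-monoˡ-≤-nonNeg a {{nonNegative a≥0}} (ℚ.<⇒≤ c<d))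
    (ℚ.*-monoˡ-<-pos d {{positive (ℚ.≤-<-trans c≥0 c<d)}} a<b)

  1/-anti-< : ∀ {p q} (p>0 : 0ℚ < p) (q>0 : 0ℚ < q) → p < q →
              (1/ q) {{>-nonZero q>0}} < (1/ p) {{>-nonZero p>0}}
  1/-anti-< {p} {q} p>0 q>0 p<q = subst₂ _<_ left right
    (ℚ.*-monoˡ-<-pos (i * j) {{positive (*>0 (1/>0 p>0) (1/>0 q>0))}} p<q)
    where
    i = (1/ p) {{>-nonZero p>0}}
    j = (1/ q) {{>-nonZero q>0}}
    left : p * (i * j) ≡ j
    left = trans (sym (ℚ.*-assoc p i j))
      (trans (cong (_* j) (ℚ.*-inverseʳ p {{>-nonZero p>0}})) (ℚ.*-identityˡ j))
    right : q * (i * j) ≡ i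
    right = trans (solve 3 (λ q i j → q :* (i :* j) := (q :* j) :* i) refl q i j)
      (trans (cong (_* i) (ℚ.*-inverseʳ q {{>-nonZero q>0}})) (ℚ.*-identityˡ i))

  close-refl : ∀ {e p q} → 0ℚ < e → p ≡ q → Close e p q
  close-refl {e} {p} e>0 refl = subst (λ t → ∣ t ∣ < e) (sym (ℚ.+-inverseʳ p)) e>0

  close-sym : ∀ {e p q} → Close e p q → Close e q p
  close-sym {e} {p} {q} c = subst (_< e)
    (trans (sym (ℚ.∣-p∣≡∣p∣ (p - q)))
      (cong ∣_∣ (solve 2 (λ p q → :- (p :- q) := q :- p) refl p q))) c

  close-+ : ∀ {e f p q r s} → Close e p q → Close f r s →
            Close (e + f) (p + r) (q + s)
  close-+ {e} {f} {p} {q} {r} {s} c d = subst (λ t → ∣ t ∣ < e + f)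
    (solve 4 (λ p q r s → (p :- q) :+ (r :- s) := (p :+ r) :- (q :+ s)) refl p q r s)
    (ℚ.≤-<-trans (ℚ.∣p+q∣≤∣p∣+∣q∣ (p - q) (r - s)) (ℚ.+-mono-< c d))

  close-trans : ∀ {e f p q r} → Close e p q → Close f q r → Close (e + f) p r
  close-trans {e} {f} {p} {q} {r} c d = subst (λ t → ∣ t ∣ < e + f)
    (solve 3 (λ p q r → (p :- q) :+ (q :- r) := p :- r) refl p q r)
    (ℚ.≤-<-trans (ℚ.∣p+q∣≤∣p∣+∣q∣ (p - q) (q - r)) (ℚ.+-mono-< c d))

  close-neg : ∀ {e p q} → Close e p q → Close e (- p) (- q)
  close-neg {e} {p} {q} c = subst (_< e) (cong ∣_∣
    (solve 2 (λ p q → q :- p := :- p :- :- q) refl p q)) (close-sym {e} {p} {q} c)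

  close-* : ∀ {a b e f p q r s} → ∣ p ∣ < a → ∣ s ∣ < b → Close e p q → Close f r s →
            Close (a * f + e * b) (p * r) (q * s)
  close-* {a} {b} {e} {f} {p} {q} {r} {s} pa sb c d = subst (λ t → ∣ t ∣ < a * f + e * b)
    (solve 4 (λ p q r s → p :* (r :- s) :+ (p :- q) :* s := p :* r :- q :* s) refl p q r s)
    (ℚ.≤-<-trans (ℚ.∣p+q∣≤∣p∣+∣q∣ (p * (r - s)) ((p - q) * s))
      (subst₂ (λ u v → u + v < a * f + e * b)
        (sym (ℚ.∣p*q∣≡∣p∣*∣q∣ p (r - s))) (sym (ℚ.∣p*q∣≡∣p∣*∣q∣ (p - q) s))
        (ℚ.+-mono-<
          (*-mono-<₊ (ℚ.0≤∣p∣ p) (ℚ.0≤∣p∣ (r - s)) pa d)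
          (*-mono-<₊ (ℚ.0≤∣p∣ (p - q)) (ℚ.0≤∣p∣ s) c sb))))

  ≤∣∣ : ∀ p → p ≤ ∣ p ∣
  ≤∣∣ p with ℚ.≤-total 0ℚ p
  ... | inj₁ 0≤p = ℚ.≤-reflexive (sym (ℚ.0≤p⇒∣p∣≡p 0≤p))
  ... | inj₂ p≤0 = ℚ.≤-trans p≤0 (ℚ.0≤∣p∣ p)

  close⇒< : ∀ {e p q} → Close e p q → p < q + e
  close⇒< {e} {p} {q} c = subst (_< q + e)
    (solve 2 (λ p q → q :+ (p :- q) := p) refl p q)
    (ℚ.+-monoʳ-< q (ℚ.≤-<-trans (≤∣∣ (p - q)) c))

  <⇒close : ∀ {e p q} → p < q + e → q < p + e → Close e p q
  <⇒close {e} {p} {q} p<q+e q<p+e with ℚ.∣p∣≡p∨∣p∣≡-p (p - q)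
  ... | inj₁ eq = subst₂ _<_ (sym eq) (solve 2 (λ q e → (q :+ e) :- q := e) refl q e)
                    (ℚ.+-monoˡ-< (- q) p<q+e)
  ... | inj₂ eq = subst₂ _<_
                    (trans (solve 2 (λ p q → q :- p := :- (p :- q)) refl p q) (sym eq))
                    (solve 2 (λ p e → (p :+ e) :- p := e) refl p e)
                    (ℚ.+-monoˡ-< (- p) q<p+e)

  close-⊓ : ∀ {e p q r s} → Close e p q → Close e r s → Close e (p ⊓ r) (q ⊓ s)
  close-⊓ {e} {p} {q} {r} {s} c d = <⇒close
    (half-⊓ {p} {q} {r} {s} (close⇒< {e} {p} {q} c) (close⇒< {e} {r} {s} d))
    (half-⊓ {q} {p} {s} {r} (close⇒< {e} {q} {p} (close-sym {e} {p} {q} c))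
                            (close⇒< {e} {s} {r} (close-sym {e} {r} {s} d)))
    where
    half-⊓ : ∀ {p q r s} → p < q + e → r < s + e → p ⊓ r < (q ⊓ s) + e
    half-⊓ {p} {q} {r} {s} c d with ℚ.≤-total q s
    ... | inj₁ q≤s = subst (λ t → p ⊓ r < t + e) (sym (ℚ.p≤q⇒p⊓q≡p q≤s))
                       (ℚ.≤-<-trans (ℚ.p⊓q≤p p r) c)
    ... | inj₂ s≤q = subst (λ t → p ⊓ r < t + e) (sym (ℚ.p≥q⇒p⊓q≡q s≤q))
                       (ℚ.≤-<-trans (ℚ.p⊓q≤q p r) d)

  tail-bound : ∀ {e p q} → Close e p q → ∣ p ∣ < ∣ q ∣ + e
  tail-bound {e} {p} {q} c = subst (λ t → ∣ t ∣ < ∣ q ∣ + e)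
    (solve 2 (λ p q → q :+ (p :- q) := p) refl p q)
    (ℚ.≤-<-trans (ℚ.∣p+q∣≤∣p∣+∣q∣ q (p - q)) (ℚ.+-monoʳ-< ∣ q ∣ c))

record ℝ : Set where
  no-eta-equality
  constructor real
  field
    seq    : ℕ → ℚ
    cauchy : ∀ e → 0ℚ ℚ.< e →
             ∃[ N ] (∀ m n → N ℕ.≤ m → N ℕ.≤ n → Close e (seq m) (seq n))

open ℝ public

infix 4 _≈_ _<_ _≤_

record _≈_ (x y : ℝ) : Set where
  constructor ≈-by
  field ≈-eventually : ∀ e → 0ℚ ℚ.< e → Eventually λ n → Close e (seq x n) (seq y n)

record _<_ (x y : ℝ) : Set where
  constructor <-by
  field
    gap          : ℚ
    gap>0        : 0ℚ ℚ.< gap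
    <-eventually : Eventually λ n → seq x n ℚ.+ gap ℚ.< seq y n

record _≤_ (x y : ℝ) : Set where
  constructor ≤-by
  field ≤-eventually : ∀ e → 0ℚ ℚ.< e → Eventually λ n → seq x n ℚ.< seq y n ℚ.+ e

open _≈_ public
open _<_ public
open _≤_ public

pointwise : ∀ {x y} → (∀ n → seq x n ≡ seq y n) → x ≈ y
pointwise eq = ≈-by λ e e>0 → 0 , λ n _ → close-refl e>0 (eq n)

≈-refl : ∀ {x} → x ≈ x
≈-refl = pointwise (λ _ → refl)

≈-sym : ∀ {x y} → x ≈ y → y ≈ x
≈-sym {x} {y} (≈-by x≈y) = ≈-by λ e e>0 →
  map (λ n → close-sym {e} {seq x n} {seq y n}) (x≈y e e>0)

≈-trans : ∀ {x y z} → x ≈ y → y ≈ z → x ≈ z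
≈-trans {x} {y} {z} (≈-by x≈y) (≈-by y≈z) = ≈-by λ e e>0 → both
  (λ n c d → subst (λ t → Close t (seq x n) (seq z n)) (half+half e)
    (close-trans {½ ℚ.* e} {½ ℚ.* e} {seq x n} {seq y n} {seq z n} c d))
  (x≈y (½ ℚ.* e) (half>0 e>0)) (y≈z (½ ℚ.* e) (half>0 e>0))

Bounded : ℝ → Set
Bounded x = ∃[ b ] 0ℚ ℚ.< b × Eventually λ n → ℚ.∣ seq x n ∣ ℚ.< b

bounded : ∀ x → Bounded x
bounded x with cauchy x 1ℚ (ℚ.positive⁻¹ 1ℚ)
... | N , c = ℚ.∣ seq x N ∣ ℚ.+ 1ℚ
            , ℚ.+-mono-≤-< (ℚ.0≤∣p∣ (seq x N)) (ℚ.positive⁻¹ 1ℚ)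
            , N , λ n le → tail-bound {p = seq x n} {seq x N} (c n N le ℕ.≤-refl)

fromℚ : ℚ → ℝ
fromℚ q = real (λ _ → q) λ e e>0 → 0 , λ _ _ _ _ → close-refl e>0 (refl {x = q})

fromℕ : ℕ → ℝ
fromℕ n = fromℚ (+ n ℚ./ 1)

0ℝ 1ℝ : ℝ
0ℝ = fromℚ 0ℚ
1ℝ = fromℚ 1ℚ

private
  both₂ : ∀ {Q R S : ℕ → ℕ → Set} → (∀ m n → Q m n → R m n → S m n) →
          ∃[ N ] (∀ m n → N ℕ.≤ m → N ℕ.≤ n → Q m n) →
          ∃[ N ] (∀ m n → N ℕ.≤ m → N ℕ.≤ n → R m n) →
          ∃[ N ] (∀ m n → N ℕ.≤ m → N ℕ.≤ n → S m n)
  both₂ f (N , q) (M , r) = N ℕ.⊔ M , λ m n lm ln →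
    f m n (q m n (ℕ.≤-trans (ℕ.m≤m⊔n N M) lm) (ℕ.≤-trans (ℕ.m≤m⊔n N M) ln))
          (r m n (ℕ.≤-trans (ℕ.m≤n⊔m N M) lm) (ℕ.≤-trans (ℕ.m≤n⊔m N M) ln))

  CloseProduct : ℚ → ℚ → ℚ → Set
  CloseProduct a b e = ∃[ f ] ∃[ g ] 0ℚ ℚ.< f × 0ℚ ℚ.< g ×
    (∀ p q r s → ℚ.∣ p ∣ ℚ.< a → ℚ.∣ s ∣ ℚ.< b → Close f p q → Close g r s →
      Close e (p ℚ.* r) (q ℚ.* s))

  close-product : ∀ {a b e} → 0ℚ ℚ.< a → 0ℚ ℚ.< b → 0ℚ ℚ.< e → CloseProduct a b e
  close-product {a} {b} {e} a>0 b>0 e>0 =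
    f , g , *>0 (half>0 e>0) (1/>0 b>0) , *>0 (half>0 e>0) (1/>0 a>0) ,
    λ p q r s pa sb c d → subst (λ t → Close t (p ℚ.* r) (q ℚ.* s)) total
      (close-* {a} {b} {f} {g} {p} {q} {r} {s} pa sb c d)
    where
    instance
      _ = ℚ.>-nonZero a>0
      _ = ℚ.>-nonZero b>0
    h = ½ ℚ.* e
    f = h ℚ.* ℚ.1/ b
    g = h ℚ.* ℚ.1/ a
    total : a ℚ.* g ℚ.+ f ℚ.* b ≡ e
    total = trans
      (solve 5 (λ a i b j h → a :* (h :* i) :+ h :* j :* b := h :* (a :* i) :+ h :* (b :* j))
        refl a (ℚ.1/ a) b (ℚ.1/ b) h)
      (trans (cong₂ (λ u v → h ℚ.* u ℚ.+ h ℚ.* v) (ℚ.*-inverseʳ a) (ℚ.*-inverseʳ b))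
        (trans (cong₂ ℚ._+_ (ℚ.*-identityʳ h) (ℚ.*-identityʳ h)) (half+half e)))

infixl 6 _+_ _-_
infixl 7 _*_
infix  8 -_

_+_ : ℝ → ℝ → ℝ
x + y = real (λ n → seq x n ℚ.+ seq y n) λ e e>0 → both₂
  (λ m n c d → subst (λ t → Close t (seq x m ℚ.+ seq y m) (seq x n ℚ.+ seq y n)) (half+half e)
    (close-+ {½ ℚ.* e} {½ ℚ.* e} {seq x m} {seq x n} {seq y m} {seq y n} c d))
  (cauchy x (½ ℚ.* e) (half>0 e>0)) (cauchy y (½ ℚ.* e) (half>0 e>0))

-_ : ℝ → ℝ
- x = real (λ n → ℚ.- seq x n) λ e e>0 → let N , c = cauchy x e e>0 in
  N , λ m n lm ln → close-neg {e} {seq x m} {seq x n} (c m n lm ln)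

_-_ : ℝ → ℝ → ℝ
x - y = x + - y

_*_ : ℝ → ℝ → ℝ
x * y = real (λ n → seq x n ℚ.* seq y n) λ e e>0 → go e e>0 (bounded x) (bounded y)
  where
  go : ∀ e → 0ℚ ℚ.< e → Bounded x → Bounded y → ∃[ N ] (∀ m n → N ℕ.≤ m → N ℕ.≤ n →
       Close e (seq x m ℚ.* seq y m) (seq x n ℚ.* seq y n))
  go e e>0 (a , a>0 , A , xa) (b , b>0 , B , yb) = close⇒ (close-product a>0 b>0 e>0)
    where
    close⇒ : CloseProduct a b e → ∃[ N ] (∀ m n → N ℕ.≤ m → N ℕ.≤ n →
             Close e (seq x m ℚ.* seq y m) (seq x n ℚ.* seq y n))
    close⇒ (f , g , f>0 , g>0 , close) = both₂
      (λ m n (c , sx) (d , sy) → close (seq x m) (seq x n) (seq y m) (seq y n) sx sy c d)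
      (both₂ (λ _ _ c s → c , s) (cauchy x f f>0) (A , λ m _ lm _ → xa m lm))
      (both₂ (λ _ _ c s → c , s) (cauchy y g g>0) (B , λ _ n _ ln → yb n ln))

min : ℝ → ℝ → ℝ
min x y = real (λ n → seq x n ℚ.⊓ seq y n) λ e e>0 → both₂
  (λ m n → close-⊓ {e} {seq x m} {seq x n} {seq y m} {seq y n})
  (cauchy x e e>0) (cauchy y e e>0)

+-cong : ∀ {x y u v} → x ≈ y → u ≈ v → x + u ≈ y + v
+-cong {x} {y} {u} {v} (≈-by p) (≈-by q) = ≈-by λ e e>0 → both
  (λ n c d → subst (λ t → Close t (seq x n ℚ.+ seq u n) (seq y n ℚ.+ seq v n)) (half+half e)
    (close-+ {½ ℚ.* e} {½ ℚ.* e} {seq x n} {seq y n} {seq u n} {seq v n} c d))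
  (p (½ ℚ.* e) (half>0 e>0)) (q (½ ℚ.* e) (half>0 e>0))

-‿cong : ∀ {x y} → x ≈ y → - x ≈ - y
-‿cong {x} {y} (≈-by p) = ≈-by λ e e>0 →
  map (λ n → close-neg {e} {seq x n} {seq y n}) (p e e>0)

*-cong : ∀ {x y u v} → x ≈ y → u ≈ v → x * u ≈ y * v
*-cong {x} {y} {u} {v} (≈-by p) (≈-by q) = ≈-by λ e e>0 → go e e>0 (bounded x) (bounded v)
  where
  go : ∀ e → 0ℚ ℚ.< e → Bounded x → Bounded v →
       Eventually λ n → Close e (seq x n ℚ.* seq u n) (seq y n ℚ.* seq v n)
  go e e>0 (a , a>0 , A , xa) (b , b>0 , B , vb) = close⇒ (close-product a>0 b>0 e>0)
    where
    close⇒ : CloseProduct a b e →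
             Eventually λ n → Close e (seq x n ℚ.* seq u n) (seq y n ℚ.* seq v n)
    close⇒ (f , g , f>0 , g>0 , close) = both
      (λ n (c , sx) (d , sv) → close (seq x n) (seq y n) (seq u n) (seq v n) sx sv c d)
      (both (λ _ c s → c , s) (p f f>0) (A , xa))
      (both (λ _ c s → c , s) (q g g>0) (B , vb))

ℝ-ring : CommutativeRing 0ℓ 0ℓ
ℝ-ring = record
  { Carrier = ℝ ; _≈_ = _≈_ ; _+_ = _+_ ; _*_ = _*_ ; -_ = -_ ; 0# = 0ℝ ; 1# = 1ℝ
  ; isCommutativeRing = record
    { isRing = record
      { +-isAbelianGroup = record
        { isGroup = record
          { isMonoid = record
            { isSemigroup = record
              { isMagma = record
                { isEquivalence = record
                  { refl  = ≈-refl
                  ; sym   = ≈-sym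
                  ; trans = ≈-trans
                  }
                ; ∙-cong = +-cong
                }
              ; assoc = λ x y z → pointwise λ n → ℚ.+-assoc (seq x n) (seq y n) (seq z n)
              }
            ; identity = (λ x → pointwise λ n → ℚ.+-identityˡ (seq x n))
                       , (λ x → pointwise λ n → ℚ.+-identityʳ (seq x n))
            }
          ; inverse = (λ x → pointwise λ n → ℚ.+-inverseˡ (seq x n))
                    , (λ x → pointwise λ n → ℚ.+-inverseʳ (seq x n))
          ; ⁻¹-cong = -‿cong
          }
        ; comm = λ x y → pointwise λ n → ℚ.+-comm (seq x n) (seq y n)
        }
      ; *-cong = *-cong
      ; *-assoc = λ x y z → pointwise λ n → ℚ.*-assoc (seq x n) (seq y n) (seq z n)
      ; *-identity = (λ x → pointwise λ n → ℚ.*-identityˡ (seq x n))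
                   , (λ x → pointwise λ n → ℚ.*-identityʳ (seq x n))
      ; distrib = (λ x y z → pointwise λ n → ℚ.*-distribˡ-+ (seq x n) (seq y n) (seq z n))
                , (λ x y z → pointwise λ n → ℚ.*-distribʳ-+ (seq x n) (seq y n) (seq z n))
      }
    ; *-comm = λ x y → pointwise λ n → ℚ.*-comm (seq x n) (seq y n)
    }
  }

+-cancelʳ-<ℚ : ∀ {p q} r → p ℚ.+ r ℚ.< q ℚ.+ r → p ℚ.< q
+-cancelʳ-<ℚ {p} {q} r lt = subst₂ ℚ._<_ (undo p r) (undo q r) (ℚ.+-monoˡ-< (ℚ.- r) lt)
  where
  undo : ∀ p r → p ℚ.+ r ℚ.- r ≡ p
  undo = solve 2 (λ p r → p :+ r :- r := p) refl

<-respʳ-≈ : ∀ {x y z} → y ≈ z → x < y → x < z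
<-respʳ-≈ {x} {y} {z} (≈-by y≈z) (<-by e e>0 lt) = <-by (½ ℚ.* e) (half>0 e>0) (both
  (λ n l c → +-cancelʳ-<ℚ (½ ℚ.* e)
    (subst (λ t → t ℚ.< seq z n ℚ.+ ½ ℚ.* e)
      (trans (cong (seq x n ℚ.+_) (sym (half+half e)))
             (sym (ℚ.+-assoc (seq x n) (½ ℚ.* e) (½ ℚ.* e))))
      (ℚ.<-trans l (close⇒< {p = seq y n} {seq z n} c))))
  lt (y≈z (½ ℚ.* e) (half>0 e>0)))

+-monoʳ-< : ∀ z {x y} → x < y → z + x < z + y
+-monoʳ-< z {x} {y} (<-by e e>0 lt) = <-by e e>0 (map
  (λ n l → subst (ℚ._< seq z n ℚ.+ seq y n) (sym (ℚ.+-assoc (seq z n) (seq x n) e))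
    (ℚ.+-monoʳ-< (seq z n) l)) lt)

x<y⇒0<y-x : ∀ {x y} → x < y → 0ℝ < y - x
x<y⇒0<y-x {x} {y} (<-by e e>0 lt) = <-by e e>0 (map
  (λ n l → subst (ℚ._< seq y n ℚ.- seq x n)
    (solve 2 (λ x e → x :+ e :- x := con 0ℚ :+ e) refl (seq x n) e)
    (ℚ.+-monoˡ-< (ℚ.- seq x n) l)) lt)

0<y-x⇒x<y : ∀ {x y} → 0ℝ < y - x → x < y
0<y-x⇒x<y {x} {y} (<-by e e>0 lt) = <-by e e>0 (map
  (λ n l → subst₂ ℚ._<_
    (solve 2 (λ x e → con 0ℚ :+ e :+ x := x :+ e) refl (seq x n) e)
    (solve 2 (λ x y → y :- x :+ x := y) refl (seq x n) (seq y n))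
    (ℚ.+-monoˡ-< (seq x n) l)) lt)

neg-anti-< : ∀ {x y} → x < y → - y < - x
neg-anti-< {x} {y} (<-by e e>0 lt) = <-by e e>0 (map
  (λ n l → subst₂ ℚ._<_
    (solve 3 (λ x y e → x :+ e :- x :- y := :- y :+ e) refl (seq x n) (seq y n) e)
    (solve 2 (λ x y → y :- x :- y := :- x) refl (seq x n) (seq y n))
    (ℚ.+-monoˡ-< (ℚ.- seq y n) (ℚ.+-monoˡ-< (ℚ.- seq x n) l))) lt)

+-pos : ∀ {x y} → 0ℝ < x → 0ℝ < y → 0ℝ < x + y
+-pos {x} {y} (<-by e e>0 lt) (<-by f f>0 lt′) = <-by (e ℚ.+ f) (ℚ.+-mono-< e>0 f>0) (both
  (λ n l l′ → subst (ℚ._< seq x n ℚ.+ seq y n)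
    (solve 2 (λ e f → (con 0ℚ :+ e) :+ (con 0ℚ :+ f) := con 0ℚ :+ (e :+ f)) refl e f)
    (ℚ.+-mono-< l l′))
  lt lt′)

*-pos : ∀ {x y} → 0ℝ < x → 0ℝ < y → 0ℝ < x * y
*-pos {x} {y} (<-by e e>0 lt) (<-by f f>0 lt′) = <-by (e ℚ.* f) (*>0 e>0 f>0) (both
  (λ n l l′ → subst (ℚ._< seq x n ℚ.* seq y n) (sym (ℚ.+-identityˡ (e ℚ.* f)))
    (*-mono-<₊ (ℚ.<⇒≤ e>0) (ℚ.<⇒≤ f>0)
      (subst (ℚ._< seq x n) (ℚ.+-identityˡ e) l)
      (subst (ℚ._< seq y n) (ℚ.+-identityˡ f) l′)))
  lt lt′)

⊓-glb-<ℚ : ∀ {p q r} → r ℚ.< p → r ℚ.< q → r ℚ.< p ℚ.⊓ q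
⊓-glb-<ℚ {p} {q} {r} r<p r<q with ℚ.≤-total p q
... | inj₁ p≤q = subst (r ℚ.<_) (sym (ℚ.p≤q⇒p⊓q≡p p≤q)) r<p
... | inj₂ q≤p = subst (r ℚ.<_) (sym (ℚ.p≥q⇒p⊓q≡q q≤p)) r<q

min-glb-< : ∀ {x y z} → z < x → z < y → z < min x y
min-glb-< {x} {y} {z} (<-by e e>0 lt) (<-by f f>0 lt′) = go (ℚ.≤-total e f)
  where
  go : (e ℚ.≤ f) ⊎ (f ℚ.≤ e) → z < min x y
  go (inj₁ e≤f) = <-by e e>0 (both
    (λ n l l′ → ⊓-glb-<ℚ {seq x n} {seq y n} {seq z n ℚ.+ e}
      l (ℚ.≤-<-trans (ℚ.+-monoʳ-≤ (seq z n) e≤f) l′)) lt lt′)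
  go (inj₂ f≤e) = <-by f f>0 (both
    (λ n l l′ → ⊓-glb-<ℚ {seq x n} {seq y n} {seq z n ℚ.+ f}
      (ℚ.≤-<-trans (ℚ.+-monoʳ-≤ (seq z n) f≤e) l) l′) lt lt′)

-- The first terms of a positive sequence may be 0, so they are replaced by the
-- term at the index from which the sequence is known to be bounded away from 0.
module _ (x : ℝ) (x>0 : 0ℝ < x) where
  private
    e   = gap x>0
    N   = proj₁ (<-eventually x>0)
    e>0 : 0ℚ ℚ.< e
    e>0 = gap>0 x>0

    term : ℕ → ℚ
    term n = seq x (N ℕ.⊔ n)

    e<term : ∀ n → e ℚ.< term n
    e<term n = subst (ℚ._< term n) (ℚ.+-identityˡ e)
      (proj₂ (<-eventually x>0) (N ℕ.⊔ n) (ℕ.m≤m⊔n N n))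

    term>0 : ∀ n → 0ℚ ℚ.< term n
    term>0 n = ℚ.<-trans e>0 (e<term n)

    recip : ℕ → ℚ
    recip n = (ℚ.1/ term n) {{ℚ.>-nonZero (term>0 n)}}

    1/e : ℚ
    1/e = (ℚ.1/ e) {{ℚ.>-nonZero e>0}}

    recip-inverse : ∀ n → recip n ℚ.* term n ≡ 1ℚ
    recip-inverse n = ℚ.*-inverseˡ (term n) {{ℚ.>-nonZero (term>0 n)}}

    ∣recip∣<1/e : ∀ n → ℚ.∣ recip n ∣ ℚ.< 1/e
    ∣recip∣<1/e n = subst (ℚ._< 1/e)
      (sym (ℚ.0≤p⇒∣p∣≡p (ℚ.<⇒≤ (1/>0 (term>0 n)))))
      (1/-anti-< e>0 (term>0 n) (e<term n))

    difference : ∀ m n → (recip m ℚ.* recip n) ℚ.* (term n ℚ.- term m) ≡ recip m ℚ.- recip n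
    difference m n = trans
      (solve 4 (λ i j p q → (i :* j) :* (q :- p) := i :* (j :* q) :- j :* (i :* p)) refl
        (recip m) (recip n) (term m) (term n))
      (cong₂ ℚ._-_
        (trans (cong (recip m ℚ.*_) (recip-inverse n)) (ℚ.*-identityʳ (recip m)))
        (trans (cong (recip n ℚ.*_) (recip-inverse m)) (ℚ.*-identityʳ (recip n))))

    difference′ : ∀ m n → (ℚ.∣ recip m ∣ ℚ.* ℚ.∣ recip n ∣) ℚ.* ℚ.∣ term n ℚ.- term m ∣
                        ≡ ℚ.∣ recip m ℚ.- recip n ∣
    difference′ m n = trans
      (cong (ℚ._* ℚ.∣ term n ℚ.- term m ∣) (sym (ℚ.∣p*q∣≡∣p∣*∣q∣ (recip m) (recip n))))
      (trans (sym (ℚ.∣p*q∣≡∣p∣*∣q∣ (recip m ℚ.* recip n) (term n ℚ.- term m)))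
        (cong ℚ.∣_∣ (difference m n)))

    *-nonNeg : ∀ p q → 0ℚ ℚ.≤ ℚ.∣ p ∣ ℚ.* ℚ.∣ q ∣
    *-nonNeg p q = subst (0ℚ ℚ.≤_) (ℚ.∣p*q∣≡∣p∣*∣q∣ p q) (ℚ.0≤∣p∣ (p ℚ.* q))

  infix 9 _⁻¹[_]
  _⁻¹[_] : ℝ
  _⁻¹[_] = real recip go
    where
    go : ∀ c → 0ℚ ℚ.< c → ∃[ M ] (∀ m n → M ℕ.≤ m → M ℕ.≤ n → Close c (recip m) (recip n))
    go c c>0 with cauchy x (e ℚ.* e ℚ.* c) (*>0 (*>0 e>0 e>0) c>0)
    ... | M , h = M , λ m n lm ln → subst₂ ℚ._<_ (difference′ m n) scale
      (*-mono-<₊ (*-nonNeg (recip m) (recip n)) (ℚ.0≤∣p∣ (term n ℚ.- term m))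
        (*-mono-<₊ (ℚ.0≤∣p∣ (recip m)) (ℚ.0≤∣p∣ (recip n)) (∣recip∣<1/e m) (∣recip∣<1/e n))
        (h (N ℕ.⊔ n) (N ℕ.⊔ m) (ℕ.≤-trans ln (ℕ.m≤n⊔m N n)) (ℕ.≤-trans lm (ℕ.m≤n⊔m N m))))
      where
      scale : (1/e ℚ.* 1/e) ℚ.* (e ℚ.* e ℚ.* c) ≡ c
      scale = trans
        (solve 3 (λ i e c → (i :* i) :* (e :* e :* c) := (i :* e) :* ((i :* e) :* c)) refl 1/e e c)
        (trans (cong (λ t → t ℚ.* (t ℚ.* c)) (ℚ.*-inverseˡ e {{ℚ.>-nonZero e>0}}))
          (trans (ℚ.*-identityˡ _) (ℚ.*-identityˡ c)))

  ⁻¹-inverseˡ : _⁻¹[_] * x ≈ 1ℝ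
  ⁻¹-inverseˡ = ≈-by λ c c>0 → N , λ n le → close-refl c>0
    (trans (cong (λ k → recip n ℚ.* seq x k) (sym (ℕ.m≤n⇒m⊔n≡n le))) (recip-inverse n))

  ⁻¹-pos : 0ℝ < _⁻¹[_]
  ⁻¹-pos = go (bounded x)
    where
    go : Bounded x → 0ℝ < _⁻¹[_]
    go (b , b>0 , B , xb) = <-by ((ℚ.1/ b) {{ℚ.>-nonZero b>0}}) (1/>0 b>0) (B , λ n le →
      subst (ℚ._< recip n) (sym (ℚ.+-identityˡ _))
        (1/-anti-< (term>0 n) b>0
          (ℚ.≤-<-trans (≤∣∣ (term n)) (xb (N ℕ.⊔ n) (ℕ.≤-trans le (ℕ.m≤n⊔m N n))))))

infixl 7 _÷_[_]

_÷_[_] : ∀ x y → 0ℝ < y → ℝ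
x ÷ y [ y>0 ] = x * y ⁻¹[ y>0 ]

x<y⇒1<y÷x : ∀ {x y} (x>0 : 0ℝ < x) → x < y → 1ℝ < y ÷ x [ x>0 ]
x<y⇒1<y÷x {x} {y} x>0 x<y = go (x ⁻¹[ x>0 ]) (⁻¹-pos x x>0) (⁻¹-inverseˡ x x>0)
  where
  go : ∀ i → 0ℝ < i → i * x ≈ 1ℝ → 1ℝ < y * i
  go i i>0 ix≈1 = 0<y-x⇒x<y {1ℝ} {y * i}
    (<-respʳ-≈ {0ℝ} {(y - x) * i} {y * i - 1ℝ} eq (*-pos {y - x} {i} (x<y⇒0<y-x x<y) i>0))
    where
    expand : (y - x) * i ≈ y * i - i * x
    expand = pointwise λ n → solve 3 (λ x y i → (y :- x) :* i := y :* i :- i :* x) refl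
      (seq x n) (seq y n) (seq i n)
    eq : (y - x) * i ≈ y * i - 1ℝ
    eq = ≈-trans expand
      (+-cong {y * i} {y * i} { - (i * x)} { - 1ℝ} ≈-refl (-‿cong {i * x} {1ℝ} ix≈1))

fromℕ-pos : ∀ {n} → 0 ℕ.< n → 0ℝ < fromℕ n
fromℕ-pos {suc n} _ = <-by (½ ℚ.* q) (half>0 q>0) (0 , λ _ _ →
  subst₂ ℚ._<_ (trans (ℚ.+-identityʳ (½ ℚ.* q)) (sym (ℚ.+-identityˡ (½ ℚ.* q)))) (half+half q)
    (ℚ.+-monoʳ-< (½ ℚ.* q) (half>0 q>0)))
  where
  q = + suc n ℚ./ 1
  q>0 : 0ℚ ℚ.< q
  q>0 = ℚ.positive⁻¹ q {{ℚ.normalize-pos (suc n) 1}}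

frac-* : ∀ p q → ℚ.fromℚᵘ p ℚ.* ℚ.fromℚᵘ q ≡ ℚ.fromℚᵘ (p ℚᵘ.* q)
frac-* p q = ℚ.toℚᵘ-injective (ℚᵘ.≃-trans (ℚ.toℚᵘ-homo-* (ℚ.fromℚᵘ p) (ℚ.fromℚᵘ q))
  (ℚᵘ.≃-trans (ℚᵘ.*-cong (ℚ.toℚᵘ-fromℚᵘ p) (ℚ.toℚᵘ-fromℚᵘ q))
    (ℚᵘ.≃-sym (ℚ.toℚᵘ-fromℚᵘ (p ℚᵘ.* q)))))

frac-+ : ∀ p q → ℚ.fromℚᵘ p ℚ.+ ℚ.fromℚᵘ q ≡ ℚ.fromℚᵘ (p ℚᵘ.+ q)
frac-+ p q = ℚ.toℚᵘ-injective (ℚᵘ.≃-trans (ℚ.toℚᵘ-homo-+ (ℚ.fromℚᵘ p) (ℚ.fromℚᵘ q))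
  (ℚᵘ.≃-trans (ℚᵘ.+-cong (ℚ.toℚᵘ-fromℚᵘ p) (ℚ.toℚᵘ-fromℚᵘ q))
    (ℚᵘ.≃-sym (ℚ.toℚᵘ-fromℚᵘ (p ℚᵘ.+ q)))))

frac-mono-≤ : ∀ {p q} → p ℚᵘ.≤ q → ℚ.fromℚᵘ p ℚ.≤ ℚ.fromℚᵘ q
frac-mono-≤ {p} {q} p≤q = ℚ.toℚᵘ-cancel-≤
  (ℚᵘ.≤-respˡ-≃ (ℚᵘ.≃-sym (ℚ.toℚᵘ-fromℚᵘ p)) (ℚᵘ.≤-respʳ-≃ (ℚᵘ.≃-sym (ℚ.toℚᵘ-fromℚᵘ q)) p≤q))

unit : ℕ → ℚ
unit k = + 1 ℚ./ suc k

unit>0 : ∀ k → 0ℚ ℚ.< unit k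
unit>0 k = ℚ.positive⁻¹ (unit k) {{ℚ.normalize-pos 1 (suc k)}}

unit-anti : ∀ {k l} → k ℕ.≤ l → unit l ℚ.≤ unit k
unit-anti {k} {l} k≤l = frac-mono-≤ {ℚᵘ.mkℚᵘ (+ 1) l} {ℚᵘ.mkℚᵘ (+ 1) k}
  (ℚᵘ.*≤* (ℤ.*-monoˡ-≤-nonNeg (+ 1) (ℤ.+≤+ (ℕ.s≤s k≤l))))

unit≤ : ∀ {e} → 0ℚ ℚ.< e → unit (ℚ.ℚ.denominator-1 e) ℚ.≤ e
unit≤ {e@(ℚ.mkℚ (+ suc p) d _)} _ = subst (unit d ℚ.≤_) (ℚ.fromℚᵘ-toℚᵘ e)
  (frac-mono-≤ {ℚᵘ.mkℚᵘ (+ 1) d} {ℚᵘ.mkℚᵘ (+ suc p) d}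
    (ℚᵘ.*≤* (ℤ.*-monoʳ-≤-nonNeg (+ suc d) (ℤ.+≤+ (ℕ.s≤s (ℕ.z≤n {p}))))))
unit≤ {ℚ.mkℚ (+ zero) _ _} (ℚ.*<* (ℤ.+<+ ()))
unit≤ {ℚ.mkℚ ℤ.-[1+ _ ] _ _} (ℚ.*<* ())

ι : ℕ → ℚ
ι k = + k ℚ./ 1

ι-suc-* : ∀ k q → ι (suc k) ℚ.* q ≡ q ℚ.+ ι k ℚ.* q
ι-suc-* k q = trans (cong (ℚ._* q) (sym ι-suc))
  (trans (ℚ.*-distribʳ-+ q 1ℚ (ι k)) (cong (ℚ._+ ι k ℚ.* q) (ℚ.*-identityˡ q)))
  where
  ι-suc : 1ℚ ℚ.+ ι k ≡ ι (suc k)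
  ι-suc = trans (frac-+ (ℚᵘ.mkℚᵘ (+ 1) 0) (ℚᵘ.mkℚᵘ (+ k) 0))
    (ℚ.fromℚᵘ-cong {ℚᵘ.mkℚᵘ (+ 1) 0 ℚᵘ.+ ℚᵘ.mkℚᵘ (+ k) 0} {ℚᵘ.mkℚᵘ (+ suc k) 0}
      (ℚᵘ.*≡* (cong (λ t → (+ 1 ℤ.+ t) ℤ.* + 1) (ℤ.*-identityʳ (+ k)))))

ι*unit : ∀ n m → ι (suc n) ℚ.* unit (m ℕ.+ n ℕ.* suc m) ≡ unit m
ι*unit n m = trans (frac-* (ℚᵘ.mkℚᵘ (+ suc n) 0) (ℚᵘ.mkℚᵘ (+ 1) (m ℕ.+ n ℕ.* suc m)))
  (ℚ.fromℚᵘ-cong {ℚᵘ.mkℚᵘ (+ suc n) 0 ℚᵘ.* ℚᵘ.mkℚᵘ (+ 1) (m ℕ.+ n ℕ.* suc m)}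
                 {ℚᵘ.mkℚᵘ (+ 1) m}
    (ℚᵘ.*≡* (trans (cong (ℤ._* + suc m) (ℤ.*-identityʳ (+ suc n)))
      (trans (sym (ℤ.pos-* (suc n) (suc m)))
        (trans (cong +_ (sym (ℕ.+-identityʳ (suc n ℕ.* suc m))))
          (sym (ℤ.*-identityˡ (+ (1 ℕ.* (suc n ℕ.* suc m))))))))))

harmonic : ℕ → ℚ
harmonic zero    = 0ℚ
harmonic (suc k) = harmonic k ℚ.+ + 1 ℚ./ suc k

block-≥ : ∀ q b l → (∀ i → i ℕ.< l → q ℚ.≤ unit (i ℕ.+ b)) →
          harmonic b ℚ.+ ι l ℚ.* q ℚ.≤ harmonic (l ℕ.+ b)
block-≥ q b zero    h = ℚ.≤-reflexive
  (trans (cong (harmonic b ℚ.+_) (ℚ.*-zeroˡ q)) (ℚ.+-identityʳ (harmonic b)))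
block-≥ q b (suc l) h = subst (ℚ._≤ harmonic (suc l ℕ.+ b))
  (trans (solve 3 (λ h t q → (h :+ t) :+ q := h :+ (q :+ t)) refl (harmonic b) (ι l ℚ.* q) q)
    (cong (harmonic b ℚ.+_) (sym (ι-suc-* l q))))
  (ℚ.+-mono-≤ (block-≥ q b l (λ i i<l → h i (ℕ.m<n⇒m<1+n i<l))) (h l (ℕ.n<1+n l)))

block-≤ : ∀ q b l → (∀ i → unit (i ℕ.+ b) ℚ.≤ q) →
          harmonic (l ℕ.+ b) ℚ.≤ harmonic b ℚ.+ ι l ℚ.* q
block-≤ q b zero    h = ℚ.≤-reflexive
  (sym (trans (cong (harmonic b ℚ.+_) (ℚ.*-zeroˡ q)) (ℚ.+-identityʳ (harmonic b))))
block-≤ q b (suc l) h = subst (harmonic (suc l ℕ.+ b) ℚ.≤_)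
  (trans (solve 3 (λ h t q → (h :+ t) :+ q := h :+ (q :+ t)) refl (harmonic b) (ι l ℚ.* q) q)
    (cong (harmonic b ℚ.+_) (sym (ι-suc-* l q))))
  (ℚ.+-mono-≤ (block-≤ q b l h) (h l))

module Log (n : ℕ) where
  S : ℕ → ℚ
  S m = harmonic (suc n ℕ.* suc m) ℚ.- harmonic (suc m)

  next : ∀ m → harmonic (suc n ℕ.* suc (suc m)) ≡ harmonic (suc n ℕ.+ suc n ℕ.* suc m)
  next m = cong harmonic (ℕ.*-suc (suc n) (suc m))

  S-step : ∀ m → S m ℚ.≤ S (suc m)
  S-step m = subst₂ ℚ._≤_
    (trans (cong (λ t → harmonic b ℚ.+ t ℚ.- harmonic (suc (suc m))) (ι*unit n (suc m)))
      (solve 3 (λ h u g → (h :+ u) :- (g :+ u) := h :- g) refl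
        (harmonic b) (unit (suc m)) (harmonic (suc m))))
    (cong (ℚ._- harmonic (suc (suc m))) (sym (next m)))
    (ℚ.+-monoˡ-≤ (ℚ.- harmonic (suc (suc m)))
      (block-≥ (unit (suc m ℕ.+ n ℕ.* suc (suc m))) b (suc n) λ i i<a →
        unit-anti (ℕ.≤-pred (subst (suc (i ℕ.+ b) ℕ.≤_) (sym (ℕ.*-suc (suc n) (suc m)))
          (ℕ.+-monoˡ-≤ b i<a)))))
    where b = suc n ℕ.* suc m

  U-step : ∀ m → S (suc m) ℚ.+ unit (suc m) ℚ.≤ S m ℚ.+ unit m
  U-step m = subst₂ ℚ._≤_
    (trans (cong (ℚ._- harmonic (suc m)) (sym (next m)))
      (solve 3 (λ h u g → h :- g := (h :- (g :+ u)) :+ u) refl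
        (harmonic (suc n ℕ.* suc (suc m))) (unit (suc m)) (harmonic (suc m))))
    (trans (cong (λ t → harmonic b ℚ.+ t ℚ.- harmonic (suc m)) (ι*unit n m))
      (solve 3 (λ h u g → (h :+ u) :- g := (h :- g) :+ u) refl
        (harmonic b) (unit m) (harmonic (suc m))))
    (ℚ.+-monoˡ-≤ (ℚ.- harmonic (suc m))
      (block-≤ (unit (m ℕ.+ n ℕ.* suc m)) b (suc n) λ i →
        unit-anti (ℕ.≤-trans (ℕ.n≤1+n _) (ℕ.m≤n+m b i))))
    where b = suc n ℕ.* suc m

  S-mono : ∀ {m k} → m ℕ.≤′ k → S m ℚ.≤ S k
  S-mono ℕ.≤′-refl       = ℚ.≤-refl
  S-mono {k = suc k} (ℕ.≤′-step m≤k) = ℚ.≤-trans (S-mono m≤k) (S-step k)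

  U-anti : ∀ {m k} → m ℕ.≤′ k → S k ℚ.+ unit k ℚ.≤ S m ℚ.+ unit m
  U-anti ℕ.≤′-refl       = ℚ.≤-refl
  U-anti {k = suc k} (ℕ.≤′-step m≤k) = ℚ.≤-trans (U-step k) (U-anti m≤k)

  p<p+q : ∀ p {q} → 0ℚ ℚ.< q → p ℚ.< p ℚ.+ q
  p<p+q p {q} q>0 = subst (ℚ._< p ℚ.+ q) (ℚ.+-identityʳ p) (ℚ.+-monoʳ-< p q>0)

  close : ∀ {e m k} → 0ℚ ℚ.< e → unit m ℚ.≤ e → m ℕ.≤ k → Close e (S m) (S k)
  close {e} {m} {k} e>0 u≤e m≤k = <⇒close
    (ℚ.≤-<-trans (S-mono (ℕ.≤⇒≤′ m≤k)) (p<p+q (S k) e>0))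
    (ℚ.<-≤-trans (p<p+q (S k) (unit>0 k))
      (ℚ.≤-trans (U-anti (ℕ.≤⇒≤′ m≤k)) (ℚ.+-monoʳ-≤ (S m) u≤e)))

  S-cauchy : ∀ e → 0ℚ ℚ.< e →
             ∃[ N ] (∀ m k → N ℕ.≤ m → N ℕ.≤ k → Close e (S m) (S k))
  S-cauchy e e>0 = N , go
    where
    N = ℚ.ℚ.denominator-1 e
    small : ∀ {m} → N ℕ.≤ m → unit m ℚ.≤ e
    small N≤m = ℚ.≤-trans (unit-anti N≤m) (unit≤ e>0)
    go : ∀ m k → N ℕ.≤ m → N ℕ.≤ k → Close e (S m) (S k)
    go m k N≤m N≤k with ℕ.≤-total m k
    ... | inj₁ m≤k = close e>0 (small N≤m) m≤k
    ... | inj₂ k≤m = close-sym {e} {S k} {S m} (close e>0 (small N≤k) k≤m)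

-- Natural logarithm.  With M = suc m, the m-th approximation is the right Riemann sum
-- Σ_{M < k ≤ nM} 1/k of mesh 1/M for ∫₁ⁿ dx/x.  The value at 0 is a dummy.
log : ℕ → ℝ
log zero    = 0ℝ
log (suc n) = real (λ m → harmonic (suc n ℕ.* suc m) ℚ.- harmonic (suc m)) (Log.S-cauchy n)

record ℂ : Set where
  constructor _+i_
  field re im : ℝ

open ℂ public

infix 4 _≈ᶜ_
infix 5 _+i_

record _≈ᶜ_ (z w : ℂ) : Set where
  constructor _,ᶜ_
  field
    re-≈ : re z ≈ re w
    im-≈ : im z ≈ im w

open _≈ᶜ_ public

infixl 6 _+ᶜ_
infixl 7 _*ᶜ_

_+ᶜ_ _*ᶜ_ : ℂ → ℂ → ℂ
z +ᶜ w = (re z + re w) +i (im z + im w)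
z *ᶜ w = (re z * re w - im z * im w) +i (re z * im w + im z * re w)

-ᶜ_ : ℂ → ℂ
-ᶜ z = (- re z) +i (- im z)

0ᶜ 1ᶜ : ℂ
0ᶜ = 0ℝ +i 0ℝ
1ᶜ = 1ℝ +i 0ℝ

private
  pointwiseᶜ : ∀ {z w} → (∀ n → seq (re z) n ≡ seq (re w) n) →
               (∀ n → seq (im z) n ≡ seq (im w) n) → z ≈ᶜ w
  pointwiseᶜ p q = pointwise p ,ᶜ pointwise q

  +ᶜ-cong : ∀ {z w u v} → z ≈ᶜ w → u ≈ᶜ v → z +ᶜ u ≈ᶜ w +ᶜ v
  +ᶜ-cong {a +i b} {c +i d} {e +i f} {g +i h} (p ,ᶜ q) (p′ ,ᶜ q′) =
    +-cong {a} {c} {e} {g} p p′ ,ᶜ +-cong {b} {d} {f} {h} q q′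

  -ᶜ‿cong : ∀ {z w} → z ≈ᶜ w → -ᶜ z ≈ᶜ -ᶜ w
  -ᶜ‿cong {a +i b} {c +i d} (p ,ᶜ q) = -‿cong {a} {c} p ,ᶜ -‿cong {b} {d} q

  *ᶜ-cong : ∀ {z w u v} → z ≈ᶜ w → u ≈ᶜ v → z *ᶜ u ≈ᶜ w *ᶜ v
  *ᶜ-cong {a +i b} {c +i d} {e +i f} {g +i h} (p ,ᶜ q) (p′ ,ᶜ q′) =
    +-cong {a * e} {c * g} {u = - (b * f)} {v = - (d * h)}
      (*-cong {a} {c} {e} {g} p p′) (-‿cong {b * f} {d * h} (*-cong {b} {d} {f} {h} q q′))
    ,ᶜ
    +-cong {a * f} {c * h} {b * e} {d * g}
      (*-cong {a} {c} {f} {h} p q′) (*-cong {b} {d} {e} {g} q p′)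

  +ᶜ-assoc : ∀ z w u → (z +ᶜ w) +ᶜ u ≈ᶜ z +ᶜ (w +ᶜ u)
  +ᶜ-assoc (a +i b) (c +i d) (e +i f) = pointwiseᶜ
    (λ n → ℚ.+-assoc (seq a n) (seq c n) (seq e n))
    (λ n → ℚ.+-assoc (seq b n) (seq d n) (seq f n))

  +ᶜ-comm : ∀ z w → z +ᶜ w ≈ᶜ w +ᶜ z
  +ᶜ-comm (a +i b) (c +i d) = pointwiseᶜ
    (λ n → ℚ.+-comm (seq a n) (seq c n)) (λ n → ℚ.+-comm (seq b n) (seq d n))

  +ᶜ-identityˡ : ∀ z → 0ᶜ +ᶜ z ≈ᶜ z
  +ᶜ-identityˡ (a +i b) = pointwiseᶜ
    (λ n → ℚ.+-identityˡ (seq a n)) (λ n → ℚ.+-identityˡ (seq b n))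

  -ᶜ‿inverseˡ : ∀ z → -ᶜ z +ᶜ z ≈ᶜ 0ᶜ
  -ᶜ‿inverseˡ (a +i b) = pointwiseᶜ
    (λ n → ℚ.+-inverseˡ (seq a n)) (λ n → ℚ.+-inverseˡ (seq b n))

  *ᶜ-assoc : ∀ z w u → (z *ᶜ w) *ᶜ u ≈ᶜ z *ᶜ (w *ᶜ u)
  *ᶜ-assoc (a +i b) (c +i d) (e +i f) = pointwiseᶜ
    (λ n → solve 6 (λ a b c d e f →
      (a :* c :- b :* d) :* e :- (a :* d :+ b :* c) :* f :=
      a :* (c :* e :- d :* f) :- b :* (c :* f :+ d :* e)) refl
      (seq a n) (seq b n) (seq c n) (seq d n) (seq e n) (seq f n))
    (λ n → solve 6 (λ a b c d e f →
      (a :* c :- b :* d) :* f :+ (a :* d :+ b :* c) :* e :=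
      a :* (c :* f :+ d :* e) :+ b :* (c :* e :- d :* f)) refl
      (seq a n) (seq b n) (seq c n) (seq d n) (seq e n) (seq f n))

  *ᶜ-comm : ∀ z w → z *ᶜ w ≈ᶜ w *ᶜ z
  *ᶜ-comm (a +i b) (c +i d) = pointwiseᶜ
    (λ n → solve 4 (λ a b c d → a :* c :- b :* d := c :* a :- d :* b) refl
      (seq a n) (seq b n) (seq c n) (seq d n))
    (λ n → solve 4 (λ a b c d → a :* d :+ b :* c := c :* b :+ d :* a) refl
      (seq a n) (seq b n) (seq c n) (seq d n))

  *ᶜ-identityˡ : ∀ z → 1ᶜ *ᶜ z ≈ᶜ z
  *ᶜ-identityˡ (a +i b) = pointwiseᶜ
    (λ n → solve 2 (λ a b → con 1ℚ :* a :- con 0ℚ :* b := a) refl (seq a n) (seq b n))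
    (λ n → solve 2 (λ a b → con 1ℚ :* b :+ con 0ℚ :* a := b) refl (seq a n) (seq b n))

  *ᶜ-distribˡ-+ᶜ : ∀ z w u → z *ᶜ (w +ᶜ u) ≈ᶜ z *ᶜ w +ᶜ z *ᶜ u
  *ᶜ-distribˡ-+ᶜ (a +i b) (c +i d) (e +i f) = pointwiseᶜ
    (λ n → solve 6 (λ a b c d e f →
      a :* (c :+ e) :- b :* (d :+ f) := (a :* c :- b :* d) :+ (a :* e :- b :* f)) refl
      (seq a n) (seq b n) (seq c n) (seq d n) (seq e n) (seq f n))
    (λ n → solve 6 (λ a b c d e f →
      a :* (d :+ f) :+ b :* (c :+ e) := (a :* d :+ b :* c) :+ (a :* f :+ b :* e)) refl
      (seq a n) (seq b n) (seq c n) (seq d n) (seq e n) (seq f n))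

ℂ-setoid : Setoid 0ℓ 0ℓ
ℂ-setoid = record
  { Carrier = ℂ
  ; _≈_ = _≈ᶜ_
  ; isEquivalence = record
    { refl  = ≈-refl ,ᶜ ≈-refl
    ; sym   = λ (p ,ᶜ q) → ≈-sym p ,ᶜ ≈-sym q
    ; trans = λ (p ,ᶜ q) (p′ ,ᶜ q′) → ≈-trans p p′ ,ᶜ ≈-trans q q′
    }
  }

private module Consequences = Algebra.Consequences.Setoid ℂ-setoid

ℂ-ring : CommutativeRing 0ℓ 0ℓ
ℂ-ring = record
  { Carrier = ℂ ; _≈_ = _≈ᶜ_ ; _+_ = _+ᶜ_ ; _*_ = _*ᶜ_ ; -_ = -ᶜ_ ; 0# = 0ᶜ ; 1# = 1ᶜ
  ; isCommutativeRing = record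
    { isRing = record
      { +-isAbelianGroup = record
        { isGroup = record
          { isMonoid = record
            { isSemigroup = record
              { isMagma = record
                { isEquivalence = Setoid.isEquivalence ℂ-setoid
                ; ∙-cong = λ {z} {w} {u} {v} → +ᶜ-cong {z} {w} {u} {v}
                }
              ; assoc = +ᶜ-assoc
              }
            ; identity = Consequences.comm∧idˡ⇒id {_+ᶜ_} +ᶜ-comm {0ᶜ} +ᶜ-identityˡ
            }
          ; inverse = Consequences.comm∧invˡ⇒inv {_+ᶜ_} { -ᶜ_} {0ᶜ} +ᶜ-comm -ᶜ‿inverseˡ
          ; ⁻¹-cong = λ {z} {w} → -ᶜ‿cong {z} {w}
          }
        ; comm = +ᶜ-comm
        }
      ; *-cong = λ {z} {w} {u} {v} → *ᶜ-cong {z} {w} {u} {v}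
      ; *-assoc = *ᶜ-assoc
      ; *-identity = Consequences.comm∧idˡ⇒id {_*ᶜ_} *ᶜ-comm {1ᶜ} *ᶜ-identityˡ
      ; distrib = Consequences.comm∧distrˡ⇒distr {_*ᶜ_} {_+ᶜ_}
          (λ {z} {w} {u} {v} → +ᶜ-cong {z} {w} {u} {v}) *ᶜ-comm *ᶜ-distribˡ-+ᶜ
      }
    ; *-comm = *ᶜ-comm
    }
  }

ofReal : ℝ → ℂ
ofReal x = x +i 0ℝ

module Series {c ℓ} (R : CommutativeRing c ℓ) where
  open CommutativeRing R using (Carrier; 0#; 1#; +-commutativeMonoid) renaming (_*_ to _·_)
  open Sum +-commutativeMonoid using (sum⁺-syntax)

  -- A polynomial, or more generally a formal power series, in n variables is given by
  -- the coefficient of x₁^α₁ ⋯ xₙ^αₙ for each exponent vector α.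
  Series : ℕ → Set c
  Series n = Vec ℕ n → Carrier

  infixl 7 _⊛_
  infixr 8 _^_

  -- The Cauchy product: the coefficient at α is the sum of p β · q γ over β + γ = α.
  _⊛_ : ∀ {n} → Series n → Series n → Series n
  (p ⊛ q) []      = p [] · q []
  (p ⊛ q) (a ∷ α) = ∑[ i ≤ a ] ((p ∘ (toℕ i ∷_)) ⊛ (q ∘ ((a ℕ.∸ toℕ i) ∷_))) α

  one : ∀ {n} → Series n
  one []          = 1#
  one (zero  ∷ α) = one α
  one (suc _ ∷ α) = 0#

  _^_ : ∀ {n} → Series n → ℕ → Series n
  p ^ zero  = one
  p ^ suc k = p ⊛ p ^ k

degree : ∀ {n} → Vec ℕ n → ℕ
degree = Vec.sum

-- The homogeneous polynomials R[x₁,…,xₙ]_d.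
record Form {c ℓ} (R : CommutativeRing c ℓ) (n d : ℕ) : Set (c ⊔ ℓ) where
  open CommutativeRing R using (Carrier; 0#) renaming (_≈_ to _≈ᴿ_)
  field
    coeff       : Vec ℕ n → Carrier
    homogeneous : ∀ α → degree α ≢ d → coeff α ≈ᴿ 0#

open Form public

complexify : ∀ {n d} → Form ℝ-ring n d → Form ℂ-ring n d
complexify f = record
  { coeff       = ofReal ∘ coeff f
  ; homogeneous = λ α ≢d → homogeneous f α ≢d ,ᶜ ≈-refl
  }

SumOfPowers : ∀ {n d} → Form ℂ-ring n d → ℕ → Set
SumOfPowers {n} {d} g r = Σ[ ℓ ∈ (Fin r → Form ℂ-ring n 1) ]
  (∀ α → coeff g α ≈ᶜ ∑[ j < r ] (coeff (ℓ j) ^ d) α)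
  where
  open Series ℂ-ring using (_^_)
  open Sum (CommutativeRing.+-commutativeMonoid ℂ-ring) using (sum-syntax)

Least : (ℕ → Set) → ℕ → Set
Least Q m = Q m × (∀ k → Q k → m ℕ.≤ k)

-- R(g) = r
WaringRank : ∀ {n d} → Form ℂ-ring n d → ℕ → Set
WaringRank g = Least (SumOfPowers g)

-- Exponent vectors of degree d with entries ≤ 1 are those of the monomials
-- x_{i₁} ⋯ x_{i_d} with i₁ < ⋯ < i_d.
𝔈 : (ε : ℝ) (n d : ℕ) → Form ℝ-ring n d → Set
𝔈 ε n d g =
  (∀ α → (¬ coeff g α ≈ 0ℝ) ⇔ (degree α ≡ d × All (ℕ._≤ 1) α)) ×
  (∀ α → ¬ coeff g α ≈ 0ℝ → 1ℝ - ε ≤ coeff g α × coeff g α ≤ 1ℝ + ε)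

-- A^ε(n,d) = a
MinRank : ℝ → ℕ → ℕ → ℕ → Set
MinRank ε n d = Least λ r → ∃[ g ] 𝔈 ε n d g × WaringRank (complexify g) r

module _ {ε₀ ε : ℝ} (0<ε₀ : 0ℝ < ε₀) (ε₀<ε : ε₀ < ε) (ε<1 : ε < 1ℝ) where

  1+ε₀>0 : 0ℝ < 1ℝ + ε₀
  1+ε₀>0 = +-pos {1ℝ} {ε₀} (fromℕ-pos {1} ℕ.z<s) 0<ε₀

  1-ε>0 : 0ℝ < 1ℝ - ε
  1-ε>0 = x<y⇒0<y-x ε<1

  δ : ℝ
  δ = min ((1ℝ + ε) ÷ (1ℝ + ε₀) [ 1+ε₀>0 ]) ((1ℝ - ε₀) ÷ (1ℝ - ε) [ 1-ε>0 ])

  1<δ : 1ℝ < δ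
  1<δ = min-glb-< {(1ℝ + ε) ÷ (1ℝ + ε₀) [ 1+ε₀>0 ]} {(1ℝ - ε₀) ÷ (1ℝ - ε) [ 1-ε>0 ]} {1ℝ}
    (x<y⇒1<y÷x {1ℝ + ε₀} {1ℝ + ε} 1+ε₀>0 (+-monoʳ-< 1ℝ ε₀<ε))
    (x<y⇒1<y÷x {1ℝ - ε} {1ℝ - ε₀} 1-ε>0 (+-monoʳ-< 1ℝ { - ε} { - ε₀} (neg-anti-< ε₀<ε)))

infix 9 _²

_² : ℝ → ℝ
x ² = x * x

P-pos : ∀ {n k} → k ℕ.≤ n → 0 ℕ.< n P k
P-pos {n} {k} k≤n with k ℕ.≤ᵇ n | ℕ.≤⇒≤ᵇ k≤n
... | true | _ = P′-pos k k≤n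
  where
  P′-pos : ∀ k → k ℕ.≤ n → 0 ℕ.< n P′ k
  P′-pos zero    _   = ℕ.z<s
  P′-pos (suc k) k<n = ℕ.*-mono-< (ℕ.m<n⇒0<n∸m k<n) (P′-pos k (ℕ.<⇒≤ k<n))

denominator>0 : ∀ n k x → k ℕ.≤ n → 1ℝ < x → 0ℝ < fromℕ (n P k) * (x - 1ℝ) ²
denominator>0 n k x k≤n 1<x =
  *-pos {fromℕ (n P k)} {(x - 1ℝ) ²} (fromℕ-pos (P-pos k≤n))
    (*-pos {x - 1ℝ} {x - 1ℝ} (x<y⇒0<y-x {1ℝ} {x} 1<x) (x<y⇒0<y-x {1ℝ} {x} 1<x))

{-# OPTIONS --safe #-}
module Submission where

-- Substituting y_j = Σ_{φ i = j} x_i in f, for a map φ from the n variables to the n₀ variables,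
-- does not increase the Waring rank, and the coefficient of a squarefree monomial becomes a
-- coefficient of f or 0 according to whether φ is injective on its support.  For random φ this
-- happens with probability p = (n₀)_d / n₀^d.  By a Chernoff bound and a union bound over the
-- squarefree monomials, among m ≈ d log n / (p (δ - 1)²) maps the number injective on a given
-- support is always close to mp, so that the sum of the forms f ∘ φ, scaled by about 1/(mp), lies
-- in 𝔈 ε n d.  The maps are chosen by conditional expectations on exponential moments in ℕ, the
-- exponential being replaced by powers of 1 ± 1/k with 1/k comparable to δ - 1.

open import Algebra.Bundles using (CommutativeRing)
open import Data.Bool.Base using (true)
open import Data.Fin.Base using (Fin; zero; suc; toℕ; splitAt)
import Data.Integer.Base as ℤ
import Data.Integer.Properties as ℤ
open import Data.List.Base as List using (List; []; _∷_; length)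
open import Data.List.Membership.Propositional using (_∈_)
open import Data.List.Membership.Propositional.Properties using (∈-++⁺ˡ; ∈-++⁺ʳ; ∈-++⁻; ∈-map⁺; ∈-map⁻)
import Data.List.Properties as List
open import Data.List.Relation.Unary.Any using (here; there)
open import Data.Nat.Base as ℕ using (ℕ; zero; suc)
open import Data.Nat.Combinatorics using (_P_)
open import Data.Nat.Combinatorics.Base using (_P′_)
import Data.Nat.Properties as ℕ
open import Data.Product.Base using (Σ-syntax; ∃; ∃-syntax; _×_; _,_; proj₁; proj₂)
open import Data.Rational.Base as ℚ using (ℚ; 0ℚ; 1ℚ; ½)
import Data.Rational.Properties as ℚ
open import Data.Rational.Solver using (module +-*-Solver)
import Data.Rational.Unnormalised.Base as ℚᵘ
open import Data.Sum.Base using (_⊎_; inj₁; inj₂; [_,_]; [_,_]′; map₁)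
open import Data.Vec.Base as Vec using (Vec; []; _∷_)
open import Data.Vec.Relation.Unary.All as All using (All; []; _∷_)
open import Function.Base using (_∘_; id; flip; case_of_)
open import Function.Bundles using (mk⇔; Equivalence)
import Level
open import Relation.Binary.PropositionalEquality
  using (_≡_; _≢_; refl; sym; trans; cong; cong₂; subst; subst₂; module ≡-Reasoning)
open import Relation.Nullary using (¬_; Dec; yes; no; contradiction)
open import Relation.Nullary.Decidable using (decidable-stable; toWitness; toWitnessFalse)
open import Relation.Unary using (Pred; Decidable)

open import Defs using (degree; module Series; Form; coeff; homogeneous; ι; unit; unit>0; unit-anti; unit≤;
  harmonic; frac-+; frac-*; frac-mono-≤; ι*unit; ι-suc-*; block-≥; log; seq; *>0)

-- Three obstacles shape the proof. A factor can be moved into a sum of d-th powers only if it is a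
-- d-th power, and no roots of reals are extracted: the scale is `(i / N) ^ d` with natural numbers
-- `i` and `N`, correct up to a factor `1 + 1/k`. Together with the deviation `2/k` of the hit
-- counts this stays within `1 + 5/k ≤ δ`, and `k` is chosen so that `k (δ - 1)` lies between 5 and
-- 17. Secondly, there is no exponential in ℕ: the role of `1 + t ≤ e^t` is taken by the inequality
-- of arithmetic and geometric means, and the final logarithm is a comparison of exponents of one
-- base. Thirdly, the reals are constructive. Whether a coefficient vanishes and whether a form is a
-- sum of `r` powers are not decided, so a minimal rank is only shown to be impossible to refute;
-- the bound on it survives because inequalities of natural numbers are decidable.

-- Inequalities between powers of natural numbers

module PowerInequalities where
  open import Data.Nat.Base using (_+_; _*_; _∸_; _^_; _≤_; _<_; NonZero; z≤n; s≤s; z<s; >-nonZero; >-nonZero⁻¹; nonZero)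
  open import Data.Nat.Properties
  open import Data.Nat.Tactic.RingSolver using (solve-∀)

  ^-distribʳ-* : ∀ a b n → (a * b) ^ n ≡ a ^ n * b ^ n
  ^-distribʳ-* a b zero    = refl
  ^-distribʳ-* a b (suc n) = trans (cong (a * b *_) (^-distribʳ-* a b n))
    (interchange a b (a ^ n) (b ^ n))
    where
    interchange : ∀ a b c d → a * b * (c * d) ≡ a * c * (b * d)
    interchange = solve-∀

  2ab≤a²+b² : ∀ a b → 2 * (a * b) ≤ a * a + b * b
  2ab≤a²+b² a b = [ ordered , (λ b≤a →
    subst₂ _≤_ (cong (2 *_) (*-comm b a)) (+-comm (b * b) (a * a)) (ordered b≤a)) ]′ (≤-total a b)
    where
    expand : ∀ a c → a * a + (a + c) * (a + c) ≡ 2 * (a * (a + c)) + c * c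
    expand = solve-∀
    ordered : ∀ {a b} → a ≤ b → 2 * (a * b) ≤ a * a + b * b
    ordered {a} {b} a≤b = subst (λ b → 2 * (a * b) ≤ a * a + b * b) (m+[n∸m]≡n a≤b)
      (≤-trans (m≤m+n _ ((b ∸ a) * (b ∸ a))) (≤-reflexive (sym (expand a (b ∸ a)))))

  -- Bernoulli's inequality for the ratio `a / b`, homogenised so that `a < b` is covered without
  -- subtraction. In the induction step `a * (n * b ^ suc n)` is added to both sides, so that
  -- `2ab≤a²+b²` leads to the induction hypothesis.
  bernoulli : ∀ a b n → suc n * (a * b ^ n) ≤ a ^ suc n + n * b ^ suc n
  bernoulli a b zero    = ≤-reflexive (base a b)
    where
    base : ∀ a b → 1 * (a * 1) ≡ a * 1 + 0
    base = solve-∀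
  bernoulli a b (suc n) = +-cancelʳ-≤ (a * (n * b ^ suc n)) _ _ (begin
    suc (suc n) * (a * b ^ suc n) + a * (n * b ^ suc n)
      ≡⟨ regroup n a b (b ^ n) ⟩
    suc n * b ^ n * (2 * (a * b))
      ≤⟨ *-monoʳ-≤ (suc n * b ^ n) (2ab≤a²+b² a b) ⟩
    suc n * b ^ n * (a * a + b * b)
      ≡⟨ split n a b (b ^ n) ⟩
    a * (suc n * (a * b ^ n)) + suc n * b ^ suc (suc n)
      ≤⟨ +-monoˡ-≤ _ (*-monoʳ-≤ a (bernoulli a b n)) ⟩
    a * (a ^ suc n + n * b ^ suc n) + suc n * b ^ suc (suc n)
      ≡⟨ collect a (a ^ suc n) (n * b ^ suc n) (suc n * b ^ suc (suc n)) ⟩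
    a ^ suc (suc n) + suc n * b ^ suc (suc n) + a * (n * b ^ suc n) ∎)
    where
    open ≤-Reasoning
    regroup : ∀ n a b c → (2 + n) * (a * (b * c)) + a * (n * (b * c)) ≡ (1 + n) * c * (2 * (a * b))
    regroup = solve-∀
    split : ∀ n a b c → (1 + n) * c * (a * a + b * b) ≡ a * ((1 + n) * (a * c)) + (1 + n) * (b * (b * c))
    split = solve-∀
    collect : ∀ a p q r → a * (p + q) + r ≡ a * p + r + a * q
    collect = solve-∀

  -- AM–GM for n copies of s/n and one x, with the denominators n and n + 1 cleared.
  am-gm-step : ∀ s x n → suc n ^ suc n * (s ^ n * x) ≤ n ^ n * (s + x) ^ suc n
  am-gm-step s x zero    = ≤-trans (≤-reflexive (base₁ x)) (≤-trans (m≤n+m x s) (≤-reflexive (sym (base₂ (s + x)))))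
    where
    base₁ : ∀ x → 1 * (1 * x) ≡ x
    base₁ = solve-∀
    base₂ : ∀ x → 1 * (x * 1) ≡ x
    base₂ = solve-∀
  am-gm-step s x n@(suc _) = *-cancelʳ-≤ _ _ n (+-cancelʳ-≤ (n * (suc n * s) ^ suc n) _ _ (begin
    suc n ^ suc n * (s ^ n * x) * n + n * (suc n * s) ^ suc n
      ≡⟨ cong (λ t → suc n ^ suc n * (s ^ n * x) * n + n * t) (^-distribʳ-* (suc n) s (suc n)) ⟩
    suc n ^ suc n * (s ^ n * x) * n + n * (suc n ^ suc n * s ^ suc n)
      ≡⟨ regroup n s x (suc n ^ n) (s ^ n) ⟩
    suc n * ((s + x) * n * (suc n ^ n * s ^ n))
      ≡⟨ cong (λ t → suc n * ((s + x) * n * t)) (sym (^-distribʳ-* (suc n) s n)) ⟩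
    suc n * ((s + x) * n * (suc n * s) ^ n)
      -- The arguments are the new mean `(s + x) / (n + 1)` and the old mean `s / n`, both
      -- multiplied by `n * suc n`.
      ≤⟨ bernoulli ((s + x) * n) (suc n * s) n ⟩
    ((s + x) * n) ^ suc n + n * (suc n * s) ^ suc n
      ≡⟨ cong (_+ n * (suc n * s) ^ suc n) (^-distribʳ-* (s + x) n (suc n)) ⟩
    (s + x) ^ suc n * n ^ suc n + n * (suc n * s) ^ suc n
      ≡⟨ cong (_+ n * (suc n * s) ^ suc n) (swap ((s + x) ^ suc n) n (n ^ n)) ⟩
    n ^ n * (s + x) ^ suc n * n + n * (suc n * s) ^ suc n ∎))
    where
    open ≤-Reasoning
    regroup : ∀ n s x c d → (1 + n) * c * (d * x) * n + n * ((1 + n) * c * (s * d))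
              ≡ (1 + n) * ((s + x) * n * (c * d))
    regroup = solve-∀
    swap : ∀ a n b → a * (n * b) ≡ b * a * n
    swap = solve-∀

  -- The copies of `x` join the `b` copies of `y` one at a time; without any `x` there is equality.
  am-gm : ∀ x y a b → (a + b) ^ (a + b) * (x ^ a * y ^ b) ≤ (a * x + b * y) ^ (a + b)
  am-gm x y zero b = ≤-reflexive (trans (cong (b ^ b *_) (*-identityˡ (y ^ b))) (sym (^-distribʳ-* b y b)))
  am-gm x y (suc a) b = *-cancelˡ-≤ (n ^ n) {{n^n≢0 n}} (begin
    n ^ n * (suc n ^ suc n * (x ^ suc a * y ^ b))
      ≡⟨ regroup (n ^ n) (suc n ^ suc n) x (x ^ a) (y ^ b) ⟩
    suc n ^ suc n * (n ^ n * (x ^ a * y ^ b) * x)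
      ≤⟨ *-monoʳ-≤ (suc n ^ suc n) (*-monoˡ-≤ x (am-gm x y a b)) ⟩
    suc n ^ suc n * (s ^ n * x)
      ≤⟨ am-gm-step s x n ⟩
    n ^ n * (s + x) ^ suc n
      ≡⟨ cong (λ t → n ^ n * t ^ suc n) (add x (a * x) (b * y)) ⟩
    n ^ n * (suc a * x + b * y) ^ suc n ∎)
    where
    open ≤-Reasoning
    n = a + b
    s = a * x + b * y
    n^n≢0 : ∀ n → NonZero (n ^ n)
    n^n≢0 zero      = nonZero
    n^n≢0 n@(suc _) = m^n≢0 n n
    regroup : ∀ p q x c d → p * (q * (x * c * d)) ≡ q * (p * (c * d) * x)
    regroup = solve-∀
    add : ∀ x p q → p + q + x ≡ x + p + q
    add = solve-∀

  -- The case p/w = 1 ± u/w and x/k = 1 ± 1/k is (1 ± u/w)^w ≤ (1 ± 1/k)^(u(k ± 1)) for w = vk.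
  power-compare : ∀ k u v p x .{{_ : NonZero k}} .{{_ : NonZero v}} .{{_ : NonZero x}} →
    p + u * k ≡ v * k + u * x →
    p ^ (v * k) * k ^ (u * x) ≤ (v * k) ^ (v * k) * x ^ (u * x)
  power-compare k u v p x eq = *-cancelˡ-≤ (n ^ n * (x ^ w * w ^ c)) {{nz}} (begin
    n ^ n * (x ^ w * w ^ c) * (p ^ w * k ^ c)
      ≡⟨ regroup (n ^ n) (x ^ w) (w ^ c) (p ^ w) (k ^ c) ⟩
    n ^ n * ((p ^ w * x ^ w) * (k ^ c * w ^ c))
      ≡⟨ cong₂ (λ s t → n ^ n * (s * t)) (sym (^-distribʳ-* p x w)) (sym (^-distribʳ-* k w c)) ⟩
    n ^ n * ((p * x) ^ w * (k * w) ^ c)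
      -- By `eq` the weighted mean of `p * x` and `k * w` is exactly `w * x`.
      ≤⟨ am-gm (p * x) (k * w) w c ⟩
    (w * (p * x) + c * (k * w)) ^ n
      ≡⟨ cong (_^ n) (trans (factor w p x u k) (trans (cong (λ t → w * x * t) eq) (*-comm (w * x) n))) ⟩
    (n * (w * x)) ^ n
      ≡⟨ trans (^-distribʳ-* n (w * x) n) (cong (n ^ n *_) (^-distribʳ-* w x n)) ⟩
    n ^ n * (w ^ n * x ^ n)
      ≡⟨ cong₂ (λ s t → n ^ n * (s * t)) (^-distribˡ-+-* w w c) (^-distribˡ-+-* x w c) ⟩
    n ^ n * (w ^ w * w ^ c * (x ^ w * x ^ c))
      ≡⟨ regroup′ (n ^ n) (w ^ w) (w ^ c) (x ^ w) (x ^ c) ⟩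
    n ^ n * (x ^ w * w ^ c) * (w ^ w * x ^ c) ∎)
    where
    open ≤-Reasoning
    w = v * k
    c = u * x
    n = w + c
    instance
      w≢0 : NonZero w
      w≢0 = m*n≢0 v k
      n≢0 : NonZero n
      n≢0 = >-nonZero (≤-trans (>-nonZero⁻¹ w) (m≤m+n w c))
    nz : NonZero (n ^ n * (x ^ w * w ^ c))
    nz = m*n≢0 _ _ {{m^n≢0 n n}} {{m*n≢0 _ _ {{m^n≢0 x w}} {{m^n≢0 w c}}}}
    regroup : ∀ a b c d e → a * (b * c) * (d * e) ≡ a * ((d * b) * (e * c))
    regroup = solve-∀
    factor : ∀ w p x u k → w * (p * x) + u * x * (k * w) ≡ w * x * (p + u * k)
    factor = solve-∀
    regroup′ : ∀ a b c d e → a * (b * c * (d * e)) ≡ a * (d * c) * (b * e)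
    regroup′ = solve-∀

  -- Stands in for the logarithm to the base `b / a > 1`: cross-multiplied, the last hypothesis is
  -- `(b / a) ^ P ≤ (b / a) ^ Q`.
  exponent-compare : ∀ a b P Q .{{_ : NonZero a}} → a < b → b ^ P * a ^ Q ≤ b ^ Q * a ^ P → P ≤ Q
  exponent-compare a b P Q a<b le with P ≤? Q
  ... | yes P≤Q = P≤Q
  ... | no P≰Q = contradiction le (<⇒≱ (subst (λ P → b ^ Q * a ^ P < b ^ P * a ^ Q) (m+[n∸m]≡n (<⇒≤ Q<P)) (go (P ∸ Q) (m<n⇒0<n∸m Q<P))))
    where
    Q<P = ≰⇒> P≰Q
    instance
      b≢0 : NonZero b
      b≢0 = >-nonZero (≤-<-trans z≤n a<b)
    go : ∀ r → 0 < r → b ^ Q * a ^ (Q + r) < b ^ (Q + r) * a ^ Q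
    go r 0<r = begin-strict
      b ^ Q * a ^ (Q + r)     ≡⟨ cong (b ^ Q *_) (^-distribˡ-+-* a Q r) ⟩
      b ^ Q * (a ^ Q * a ^ r) ≡⟨ *-assoc (b ^ Q) (a ^ Q) (a ^ r) ⟨
      b ^ Q * a ^ Q * a ^ r   <⟨ *-monoʳ-< (b ^ Q * a ^ Q) {{m*n≢0 _ _ {{m^n≢0 b Q}} {{m^n≢0 a Q}}}} (^-monoˡ-< r {{>-nonZero 0<r}} a<b) ⟩
      b ^ Q * a ^ Q * b ^ r   ≡⟨ swap (b ^ Q) (a ^ Q) (b ^ r) ⟩
      b ^ Q * b ^ r * a ^ Q   ≡⟨ cong (_* a ^ Q) (^-distribˡ-+-* b Q r) ⟨
      b ^ (Q + r) * a ^ Q     ∎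
      where
      open ≤-Reasoning
      swap : ∀ x y z → x * y * z ≡ x * z * y
      swap = solve-∀

  binomial-lower-bound : ∀ k n → k ^ suc n + suc n * k ^ n ≤ suc k ^ suc n
  binomial-lower-bound k zero = ≤-reflexive (base k)
    where
    base : ∀ k → k * 1 + 1 * 1 ≡ (1 + k) * 1
    base = solve-∀
  binomial-lower-bound k (suc n) = begin
    k ^ suc (suc n) + suc (suc n) * k ^ suc n
      ≤⟨ m≤m+n _ (suc n * k ^ n) ⟩
    k ^ suc (suc n) + suc (suc n) * k ^ suc n + suc n * k ^ n
      ≡⟨ collect k n (k ^ n) ⟩
    suc k * (k ^ suc n + suc n * k ^ n)
      ≤⟨ *-monoʳ-≤ (suc k) (binomial-lower-bound k n) ⟩
    suc k ^ suc (suc n) ∎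
    where
    open ≤-Reasoning
    collect : ∀ k n c → k * (k * c) + (2 + n) * (k * c) + (1 + n) * c ≡ (1 + k) * (k * c + (1 + n) * c)
    collect = solve-∀

  -- In terms of the base this is `(1 + 1/k) ^ k ≥ 2`, and the next lemma is its counterpart for
  -- `1 - 1/(k + 1)`. With them a factor 2 in the union bound is paid for by a fixed number of
  -- powers of the base.
  2*k^k≤[1+k]^k : ∀ k .{{_ : NonZero k}} → 2 * k ^ k ≤ suc k ^ k
  2*k^k≤[1+k]^k k@(suc n) = ≤-trans (≤-reflexive (double (k ^ k))) (binomial-lower-bound k n)
    where
    double : ∀ a → 2 * a ≡ a + a
    double = solve-∀

  2*k^[1+k]≤[1+k]^[1+k] : ∀ k → 2 * k ^ suc k ≤ suc k ^ suc k
  2*k^[1+k]≤[1+k]^[1+k] k = ≤-trans (≤-trans (≤-reflexive (double (k ^ suc k)))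
      (+-monoʳ-≤ (k ^ suc k) (*-monoˡ-≤ (k ^ k) (n≤1+n k)))) (binomial-lower-bound k k)
    where
    double : ∀ a → 2 * a ≡ a + a
    double = solve-∀

  -- Bernoulli for `j / (j + 1)` gives `(1 - 1/(j + 1)) ^ d ≥ 1 - d/(j + 1) ≥ k/(k + 1)`. So
  -- consecutive d-th powers have ratio at most `1 + 1/k` once `j` is large.
  root-ratio : ∀ d j k → d * suc k ≤ suc j → k * suc j ^ d ≤ suc k * j ^ d
  root-ratio zero    j k _  = *-monoˡ-≤ 1 (n≤1+n k)
  root-ratio (suc n) j k le = +-cancelʳ-≤ (suc j ^ suc n) _ _ (begin
    k * suc j ^ suc n + suc j ^ suc n
      ≡⟨ +-comm _ (suc j ^ suc n) ⟩
    suc k * suc j ^ suc n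
      ≤⟨ *-monoʳ-≤ (suc k) difference ⟩
    suc k * (j ^ suc n + suc n * suc j ^ n)
      ≡⟨ distrib (suc k) (j ^ suc n) (suc n) (suc j ^ n) ⟩
    suc k * j ^ suc n + suc n * suc k * suc j ^ n
      ≤⟨ +-monoʳ-≤ (suc k * j ^ suc n) (*-monoˡ-≤ (suc j ^ n) le) ⟩
    suc k * j ^ suc n + suc j ^ suc n ∎)
    where
    open ≤-Reasoning
    distrib : ∀ a b c d → a * (b + c * d) ≡ a * b + c * a * d
    distrib = solve-∀
    expand : ∀ n j c → (1 + j) * c + n * ((1 + j) * c) ≡ (1 + n) * (j * c) + (1 + n) * c
    expand = solve-∀
    collect : ∀ a b c → a + b + c ≡ a + c + b
    collect = solve-∀
    difference : suc j ^ suc n ≤ j ^ suc n + suc n * suc j ^ n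
    difference = +-cancelʳ-≤ (n * suc j ^ suc n) _ _ (begin
      suc j ^ suc n + n * suc j ^ suc n               ≡⟨ expand n j (suc j ^ n) ⟩
      suc n * (j * suc j ^ n) + suc n * suc j ^ n     ≤⟨ +-monoˡ-≤ _ (bernoulli j (suc j) n) ⟩
      j ^ suc n + n * suc j ^ suc n + suc n * suc j ^ n ≡⟨ collect (j ^ suc n) _ _ ⟩
      j ^ suc n + suc n * suc j ^ n + n * suc j ^ suc n ∎)

  -- A discrete intermediate value theorem. It does all the rounding in the proof: of a binary
  -- logarithm, a d-th root, the number of maps and the scale `k`.
  crossing : ∀ {ℓ} {P : Pred ℕ ℓ} → Decidable P → ∀ i l → P i → ¬ P (l + i) →
             ∃[ j ] i ≤ j × P j × ¬ P (suc j)
  crossing P? i zero    Pi ¬Ph = contradiction Pi ¬Ph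
  crossing {P = P} P? i (suc l) Pi ¬Ph with P? (suc i)
  ... | no ¬Psi = i , ≤-refl , Pi , ¬Psi
  ... | yes Psi with crossing P? (suc i) l Psi (subst (λ t → ¬ P t) (sym (+-suc l i)) ¬Ph)
  ...   | j , i<j , Pj , ¬Psj = j , <⇒≤ i<j , Pj , ¬Psj

  n<2^n : ∀ n → n < 2 ^ n
  n<2^n zero    = z<s
  n<2^n (suc n) = ≤-trans (+-mono-≤ (m^n>0 2 n) (n<2^n n)) (≤-reflexive (cong (2 ^ n +_) (sym (+-identityʳ (2 ^ n)))))

  log₂-floor : ∀ n → 2 ≤ n → ∃[ L ] 1 ≤ L × 2 ^ L ≤ n × n < 2 ^ suc L
  log₂-floor n 2≤n with crossing (λ L → 2 ^ L ≤? n) 1 n 2≤n (<⇒≱ (<-≤-trans (n<2^n n) (^-monoʳ-≤ 2 (m≤m+n n 1))))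
  ... | L , 1≤L , 2^L≤n , 2^sL≰n = L , 1≤L , 2^L≤n , ≰⇒> 2^sL≰n

  -- With N = suc N-1 and s = (i/N)^d this says 1 ≤ s·M/v ≤ 1 + 1/k.
  approximate-root : ∀ d M v k → 1 ≤ d → 1 ≤ M → 1 ≤ v →
    ∃[ i ] ∃[ N-1 ] 1 ≤ i × suc N-1 ^ d * v ≤ i ^ d * M × i ^ d * M * k ≤ suc N-1 ^ d * v * suc k
  approximate-root d@(suc d-1) M@(suc _) v@(suc _) k _ _ _
    with crossing (λ j → j ^ d * M ≤? N ^ d * v) i₀ (suc (N * v)) holds fails
    where
    open ≤-Reasoning
    -- From `i₀` on, consecutive d-th powers are within the ratio `1 + 1/k`; `N` is so large that
    -- `(i₀ / N) ^ d = 1 / M ^ d` still lies below the threshold `v / M`.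
    i₀ = d * suc k
    N  = M * i₀
    M≤M^d : M ≤ M ^ d
    M≤M^d = ≤-trans (≤-reflexive (sym (*-identityʳ M))) (*-monoʳ-≤ M (m^n>0 M d-1))
    holds : i₀ ^ d * M ≤ N ^ d * v
    holds = begin
      i₀ ^ d * M     ≤⟨ *-monoʳ-≤ (i₀ ^ d) M≤M^d ⟩
      i₀ ^ d * M ^ d ≡⟨ trans (*-comm (i₀ ^ d) (M ^ d)) (sym (^-distribʳ-* M i₀ d)) ⟩
      N ^ d          ≤⟨ m≤m*n (N ^ d) v ⟩
      N ^ d * v      ∎
    fails : ¬ (suc (N * v) + i₀) ^ d * M ≤ N ^ d * v
    fails = <⇒≱ (begin-strict
      N ^ d * v                     ≤⟨ *-monoʳ-≤ (N ^ d) (m≤m^n v) ⟩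
      N ^ d * v ^ d                 ≡⟨ ^-distribʳ-* N v d ⟨
      (N * v) ^ d                   <⟨ ^-monoˡ-< d (s≤s (m≤m+n (N * v) i₀)) ⟩
      (suc (N * v) + i₀) ^ d        ≤⟨ m≤m*n _ M ⟩
      (suc (N * v) + i₀) ^ d * M    ∎)
      where
      m≤m^n : ∀ m .{{_ : NonZero m}} → m ≤ m ^ d
      m≤m^n m = ≤-trans (≤-reflexive (sym (*-identityʳ m))) (*-monoʳ-≤ m (m^n>0 m d-1))
  -- The first point past the threshold overshoots by at most the ratio of consecutive d-th powers.
  ... | j , i₀≤j , below , above = suc j , ℕ.pred (M * (d * suc k)) , s≤s z≤n , <⇒≤ (≰⇒> above) , (begin
      suc j ^ d * M * k           ≡⟨ swap (suc j ^ d) M k ⟩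
      k * suc j ^ d * M           ≤⟨ *-monoˡ-≤ M (root-ratio d j k (m≤n⇒m≤1+n i₀≤j)) ⟩
      suc k * j ^ d * M           ≡⟨ swap′ (suc k) (j ^ d) M ⟩
      j ^ d * M * suc k           ≤⟨ *-monoˡ-≤ (suc k) below ⟩
      (M * (d * suc k)) ^ d * v * suc k ∎)
    where
    open ≤-Reasoning
    swap : ∀ a b c → a * b * c ≡ c * a * b
    swap = solve-∀
    swap′ : ∀ a b c → a * b * c ≡ b * c * a
    swap′ = solve-∀

-- Sums and products over lists, and the derandomisation

module ListSums where
  open import Data.Nat.Base using (_+_; _*_; _^_; _≤_; _<_; z≤n; s≤s)
  open import Data.Nat.Properties
  open import Data.Nat.Tactic.RingSolver using (solve-∀)

  ∑ : ∀ {A : Set} → List A → (A → ℕ) → ℕ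
  ∑ []       f = 0
  ∑ (x ∷ xs) f = f x + ∑ xs f

  module _ {A : Set} where

    ∑-cong : ∀ (xs : List A) {f g} → (∀ x → f x ≡ g x) → ∑ xs f ≡ ∑ xs g
    ∑-cong []       eq = refl
    ∑-cong (x ∷ xs) eq = cong₂ _+_ (eq x) (∑-cong xs eq)

    ∑-+ : ∀ (xs : List A) f g → ∑ xs (λ x → f x + g x) ≡ ∑ xs f + ∑ xs g
    ∑-+ []       f g = refl
    ∑-+ (x ∷ xs) f g = trans (cong (f x + g x +_) (∑-+ xs f g)) (interchange (f x) (g x) (∑ xs f) (∑ xs g))
      where
      interchange : ∀ a b c d → a + b + (c + d) ≡ a + c + (b + d)
      interchange = solve-∀

    ∑-* : ∀ (xs : List A) c f → ∑ xs (λ x → c * f x) ≡ c * ∑ xs f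
    ∑-* []       c f = sym (*-zeroʳ c)
    ∑-* (x ∷ xs) c f = trans (cong (c * f x +_) (∑-* xs c f)) (sym (*-distribˡ-+ c (f x) (∑ xs f)))

    ∑-const : ∀ (xs : List A) c → ∑ xs (λ _ → c) ≡ length xs * c
    ∑-const []       c = refl
    ∑-const (x ∷ xs) c = cong (c +_) (∑-const xs c)

    ∑-++ : ∀ (xs ys : List A) f → ∑ (xs List.++ ys) f ≡ ∑ xs f + ∑ ys f
    ∑-++ []       ys f = refl
    ∑-++ (x ∷ xs) ys f = trans (cong (f x +_) (∑-++ xs ys f)) (sym (+-assoc (f x) _ _))

    ∑-∈ : ∀ {xs : List A} {x} f → x ∈ xs → f x ≤ ∑ xs f
    ∑-∈ f (here refl) = m≤m+n _ _
    ∑-∈ f (there x∈xs) = ≤-trans (∑-∈ f x∈xs) (m≤n+m _ _)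

    averaging : ∀ (xs : List A) f B → 0 < length xs → ∑ xs f ≤ length xs * B → ∃[ x ] f x ≤ B
    averaging (x ∷ xs) f B _ le with f x ≤? B
    ... | yes fx≤B = x , fx≤B
    ... | no  fx≰B with xs
    ...   | []    = contradiction (≤-trans (m≤m+n (f x) 0) (≤-trans le (≤-reflexive (+-identityʳ B)))) fx≰B
    ...   | y ∷ ys = averaging (y ∷ ys) f B (s≤s z≤n) (+-cancelˡ-≤ B _ _
                      (≤-trans (+-monoˡ-≤ _ (<⇒≤ (≰⇒> fx≰B))) le))

  ∑-map : ∀ {A B : Set} (h : A → B) xs f → ∑ (List.map h xs) f ≡ ∑ xs (f ∘ h)
  ∑-map h []       f = refl
  ∑-map h (x ∷ xs) f = cong (f (h x) +_) (∑-map h xs f)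

  ∑-swap : ∀ {A B : Set} (xs : List A) (ys : List B) (f : A → B → ℕ) →
           ∑ xs (λ x → ∑ ys (f x)) ≡ ∑ ys (λ y → ∑ xs (λ x → f x y))
  ∑-swap []       ys f = sym (trans (∑-const ys 0) (*-zeroʳ (length ys)))
  ∑-swap (x ∷ xs) ys f = trans (cong (∑ ys (f x) +_) (∑-swap xs ys f))
    (sym (∑-+ ys (f x) (λ y → ∑ xs (λ x → f x y))))

  ∑-cartesianProductWith : ∀ {A B C : Set} (h : A → B → C) xs ys f →
    ∑ (List.cartesianProductWith h xs ys) f ≡ ∑ xs (λ x → ∑ ys (λ y → f (h x y)))
  ∑-cartesianProductWith h []       ys f = refl
  ∑-cartesianProductWith h (x ∷ xs) ys f = trans (∑-++ (List.map (h x) ys) _ f)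
    (cong₂ _+_ (∑-map (h x) ys f) (∑-cartesianProductWith h xs ys f))

  ∑-allFin : ∀ n f → ∑ (List.allFin (suc n)) f ≡ f zero + ∑ (List.allFin n) (f ∘ suc)
  ∑-allFin n f = cong (f zero +_) (trans (cong (λ xs → ∑ xs f) (sym (List.map-tabulate id suc)))
    (∑-map suc (List.allFin n) f))

  ∏ : ∀ {A : Set} {m} → (A → ℕ) → Vec A m → ℕ
  ∏ f []       = 1
  ∏ f (x ∷ xs) = f x * ∏ f xs

  ∏-scale : ∀ {A : Set} {m} c (f : A → ℕ) (xs : Vec A m) → ∏ (λ x → c * f x) xs ≡ c ^ m * ∏ f xs
  ∏-scale c f []       = refl
  ∏-scale {m = suc m} c f (x ∷ xs) = trans (cong (c * f x *_) (∏-scale c f xs)) (interchange c (f x) (c ^ m) (∏ f xs))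
    where
    interchange : ∀ a b c d → a * b * (c * d) ≡ a * c * (b * d)
    interchange = solve-∀

  -- The method of conditional expectations: the x's are chosen one at a time, the weights w
  -- recording the product over the choices already made.
  conditional-expectations : ∀ {A T : Set} (xs : List A) (ts : List T) (c : T → A → ℕ) B →
    0 < length xs → (∀ t → t ∈ ts → ∑ xs (c t) ≡ length xs * B) →
    ∀ m (w : T → ℕ) → Σ[ φ ∈ Vec A m ] ∑ ts (λ t → w t * ∏ (c t) φ) ≤ B ^ m * ∑ ts w
  conditional-expectations xs ts c B nonempty mean zero w =
    [] , ≤-reflexive (trans (∑-cong ts (λ t → *-identityʳ (w t))) (sym (*-identityˡ (∑ ts w))))
  conditional-expectations {A} {T} xs ts c B nonempty mean (suc m) w
    with averaging xs (λ x → ∑ ts (λ t → w t * c t x)) (B * ∑ ts w) nonempty (≤-reflexive total)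
    where
    open ≡-Reasoning
    swap : ∀ a b c → a * (b * c) ≡ b * c * a
    swap = solve-∀
    weighted : ∀ us → (∀ t → t ∈ us → ∑ xs (c t) ≡ length xs * B) →
               ∑ us (λ t → w t * ∑ xs (c t)) ≡ length xs * B * ∑ us w
    weighted []       _ = sym (*-zeroʳ (length xs * B))
    weighted (u ∷ us) h = trans (cong₂ _+_ (trans (cong (w u *_) (h u (here refl))) (*-comm (w u) _))
      (weighted us (λ t → h t ∘ there))) (sym (*-distribˡ-+ (length xs * B) (w u) (∑ us w)))
    total : ∑ xs (λ x → ∑ ts (λ t → w t * c t x)) ≡ length xs * (B * ∑ ts w)
    total = begin
      ∑ xs (λ x → ∑ ts (λ t → w t * c t x)) ≡⟨ ∑-swap xs ts (λ x t → w t * c t x) ⟩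
      ∑ ts (λ t → ∑ xs (λ x → w t * c t x)) ≡⟨ ∑-cong ts (λ t → ∑-* xs (w t) (c t)) ⟩
      ∑ ts (λ t → w t * ∑ xs (c t))         ≡⟨ weighted ts mean ⟩
      length xs * B * ∑ ts w                ≡⟨ *-assoc (length xs) B _ ⟩
      length xs * (B * ∑ ts w)              ∎
  ... | x , x-good with conditional-expectations xs ts c B nonempty mean m (λ t → w t * c t x)
  ...   | φ , φ-good = x ∷ φ , (begin
      ∑ ts (λ t → w t * (c t x * ∏ (c t) φ)) ≡⟨ ∑-cong ts (λ t → sym (*-assoc (w t) (c t x) _)) ⟩
      ∑ ts (λ t → w t * c t x * ∏ (c t) φ)   ≤⟨ φ-good ⟩
      B ^ m * ∑ ts (λ t → w t * c t x)       ≤⟨ *-monoʳ-≤ (B ^ m) x-good ⟩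
      B ^ m * (B * ∑ ts w)                   ≡⟨ swap (B ^ m) B (∑ ts w) ⟩
      B * B ^ m * ∑ ts w                     ∎)
    where
    open ≤-Reasoning
    swap : ∀ a b c → a * (b * c) ≡ b * a * c
    swap = solve-∀

-- Exponent vectors under maps of the variables

module ExponentVectors where
  open import Data.Nat.Base using (_+_; _*_; _∸_; _^_; _≤_; z≤n; s≤s)
  open import Data.Nat.Properties
  open import Data.Nat.Tactic.RingSolver using (solve-∀)
  open ListSums

  SquareFree : ∀ {n} → Vec ℕ n → Set
  SquareFree = All (_≤ 1)

  squareFree? : ∀ {n} → Decidable (SquareFree {n})
  squareFree? = All.all? (_≤? 1)

  0s : ∀ {n} → Vec ℕ n
  0s = Vec.replicate _ 0

  bump : ∀ {n} → ℕ → Fin n → Vec ℕ n → Vec ℕ n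
  bump a zero    (b ∷ β) = (a + b) ∷ β
  bump a (suc j) (b ∷ β) = b ∷ bump a j β

  -- The substitution x_i ↦ y_{φ i} turns the monomial x^α into y^(push φ α).
  push : ∀ {n n₀} → Vec (Fin n₀) n → Vec ℕ n → Vec ℕ n₀
  push []      []      = 0s
  push (j ∷ φ) (a ∷ α) = bump a j (push φ α)

  degree-0s : ∀ n → degree (0s {n}) ≡ 0
  degree-0s zero    = refl
  degree-0s (suc n) = degree-0s n

  0s-squareFree : ∀ n → SquareFree (0s {n})
  0s-squareFree zero    = []
  0s-squareFree (suc n) = z≤n ∷ 0s-squareFree n

  degree-bump : ∀ {n} a j (β : Vec ℕ n) → degree (bump a j β) ≡ a + degree β
  degree-bump a zero    (b ∷ β) = +-assoc a b (degree β)
  degree-bump a (suc j) (b ∷ β) = trans (cong (b +_) (degree-bump a j β)) (swap b a (degree β))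
    where
    swap : ∀ a b c → a + (b + c) ≡ b + (a + c)
    swap = solve-∀

  degree-push : ∀ {n n₀} (φ : Vec (Fin n₀) n) α → degree (push φ α) ≡ degree α
  degree-push {n₀ = n₀} [] [] = degree-0s n₀
  degree-push (j ∷ φ) (a ∷ α) = trans (degree-bump a j (push φ α)) (cong (a +_) (degree-push φ α))

  squareFree-bump⁻ : ∀ {n} a j (β : Vec ℕ n) → SquareFree (bump a j β) → a ≤ 1 × SquareFree β
  squareFree-bump⁻ a zero    (b ∷ β) (p ∷ ps) = ≤-trans (m≤m+n a b) p , ≤-trans (m≤n+m b a) p ∷ ps
  squareFree-bump⁻ a (suc j) (b ∷ β) (p ∷ ps) with squareFree-bump⁻ a j β ps
  ... | q , qs = q , p ∷ qs

  -- Pushing only adds entries together, so a repeated variable stays repeated. Hence a monomial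
  -- that is not squarefree has coefficient 0 in every substituted form.
  squareFree-push⁻ : ∀ {n n₀} (φ : Vec (Fin n₀) n) α → SquareFree (push φ α) → SquareFree α
  squareFree-push⁻ []      []      _  = []
  squareFree-push⁻ (j ∷ φ) (a ∷ α) sf with squareFree-bump⁻ a j (push φ α) sf
  ... | p , sf′ = p ∷ squareFree-push⁻ φ α sf′

  -- A number rather than a decision, so that it can be summed over maps and serve as an exponent;
  -- the recursion on entries makes `∑-bump` compute.
  𝟙 : ∀ {n} → Vec ℕ n → ℕ
  𝟙 []                  = 1
  𝟙 (zero ∷ β)          = 𝟙 β
  𝟙 (suc zero ∷ β)      = 𝟙 β
  𝟙 (suc (suc _) ∷ β)   = 0

  𝟙-yes : ∀ {n} {β : Vec ℕ n} → SquareFree β → 𝟙 β ≡ 1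
  𝟙-yes {β = []}           []       = refl
  𝟙-yes {β = zero ∷ β}     (_ ∷ sf) = 𝟙-yes sf
  𝟙-yes {β = suc zero ∷ β} (_ ∷ sf) = 𝟙-yes sf
  𝟙-yes {β = suc (suc _) ∷ β} (s≤s () ∷ _)

  𝟙-no : ∀ {n} {β : Vec ℕ n} → ¬ SquareFree β → 𝟙 β ≡ 0
  𝟙-no {β = []}              ¬sf = contradiction [] ¬sf
  𝟙-no {β = zero ∷ β}        ¬sf = 𝟙-no λ sf → ¬sf (z≤n ∷ sf)
  𝟙-no {β = suc zero ∷ β}    ¬sf = 𝟙-no λ sf → ¬sf (s≤s z≤n ∷ sf)
  𝟙-no {β = suc (suc _) ∷ β} ¬sf = refl

  𝟙-cases : ∀ {n} (β : Vec ℕ n) → 𝟙 β ≡ 0 ⊎ 𝟙 β ≡ 1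
  𝟙-cases β with squareFree? β
  ... | yes sf = inj₂ (𝟙-yes sf)
  ... | no ¬sf = inj₁ (𝟙-no ¬sf)

  bump-0 : ∀ {n} j (β : Vec ℕ n) → bump 0 j β ≡ β
  bump-0 zero    (b ∷ β) = refl
  bump-0 (suc j) (b ∷ β) = cong (b ∷_) (bump-0 j β)

  -- A squarefree `β` stays squarefree when raised at one of its `n - degree β` zeros; for other `β`
  -- everything is 0. The term with `degree β` stands on the left to avoid truncated subtraction.
  ∑-bump : ∀ {n} (β : Vec ℕ n) → ∑ (List.allFin n) (λ j → 𝟙 (bump 1 j β)) + degree β * 𝟙 β ≡ n * 𝟙 β
  ∑-bump [] = refl
  ∑-bump {suc n} (zero ∷ β) = trans (cong (_+ degree β * 𝟙 β) (∑-allFin n (λ j → 𝟙 (bump 1 j (0 ∷ β)))))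
    (trans (+-assoc (𝟙 β) _ _) (cong (𝟙 β +_) (∑-bump β)))
  ∑-bump {suc n} (suc zero ∷ β) = trans (cong (_+ suc (degree β) * 𝟙 β) (∑-allFin n (λ j → 𝟙 (bump 1 j (1 ∷ β)))))
    (trans (swap (∑ (List.allFin n) (λ j → 𝟙 (bump 1 j β))) (𝟙 β) (degree β * 𝟙 β)) (cong (𝟙 β +_) (∑-bump β)))
    where
    swap : ∀ a b c → a + (b + c) ≡ b + (a + c)
    swap = solve-∀
  ∑-bump {suc n} (suc (suc b) ∷ β) = trans (cong (_+ degree (suc (suc b) ∷ β) * 0) (∑-allFin n (λ j → 𝟙 (bump 1 j (suc (suc b) ∷ β)))))
    (trans (cong₂ _+_ (trans (∑-const (List.allFin n) 0) (*-zeroʳ (length (List.allFin n)))) (*-zeroʳ (degree (suc (suc b) ∷ β))))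
      (sym (*-zeroʳ (suc n))))

  maps : ∀ n n₀ → List (Vec (Fin n₀) n)
  maps zero    n₀ = [] ∷ []
  maps (suc n) n₀ = List.cartesianProductWith _∷_ (List.allFin n₀) (maps n n₀)

  length-maps : ∀ n n₀ → length (maps n n₀) ≡ n₀ ^ n
  length-maps zero    n₀ = refl
  length-maps (suc n) n₀ = begin
    length (maps (suc n) n₀)      ≡⟨ trans (sym (*-identityʳ _)) (sym (∑-const (maps (suc n) n₀) 1)) ⟩
    ∑ (maps (suc n) n₀) (λ _ → 1) ≡⟨ ∑-cartesianProductWith _∷_ (List.allFin n₀) (maps n n₀) (λ _ → 1) ⟩
    ∑ (List.allFin n₀) (λ _ → ∑ (maps n n₀) (λ _ → 1))
      ≡⟨ ∑-cong (List.allFin n₀) (λ _ → trans (∑-const (maps n n₀) 1) (trans (*-identityʳ _) (length-maps n n₀))) ⟩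
    ∑ (List.allFin n₀) (λ _ → n₀ ^ n) ≡⟨ ∑-const (List.allFin n₀) (n₀ ^ n) ⟩
    length (List.allFin n₀) * n₀ ^ n  ≡⟨ cong (_* n₀ ^ n) (List.length-tabulate {n = n₀} id) ⟩
    n₀ ^ suc n                        ∎
    where open ≡-Reasoning

  -- The maps counted are those injective on the support of α.
  count-injective : ∀ {n} n₀ (α : Vec ℕ n) → SquareFree α →
    ∑ (maps n n₀) (λ φ → 𝟙 (push φ α)) * n₀ ^ degree α ≡ n₀ ^ n * (n₀ P′ degree α)
  count-injective n₀ [] [] = trans (cong (λ t → (t + 0) * 1) (𝟙-yes (0s-squareFree n₀))) refl
  count-injective {suc n} n₀ (zero ∷ α) (_ ∷ sf) = begin
    ∑ (maps (suc n) n₀) (λ φ → 𝟙 (push φ (0 ∷ α))) * n₀ ^ degree α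
      ≡⟨ cong (_* n₀ ^ degree α) (∑-cartesianProductWith _∷_ (List.allFin n₀) (maps n n₀) (λ φ → 𝟙 (push φ (0 ∷ α)))) ⟩
    ∑ (List.allFin n₀) (λ j → ∑ (maps n n₀) (λ φ → 𝟙 (bump 0 j (push φ α)))) * n₀ ^ degree α
      ≡⟨ cong (_* n₀ ^ degree α) (trans (∑-cong (List.allFin n₀) (λ j → ∑-cong (maps n n₀) (λ φ → cong 𝟙 (bump-0 j (push φ α)))))
           (trans (∑-const (List.allFin n₀) good) (cong (_* good) (List.length-tabulate {n = n₀} id)))) ⟩
    n₀ * good * n₀ ^ degree α   ≡⟨ *-assoc n₀ good _ ⟩
    n₀ * (good * n₀ ^ degree α) ≡⟨ cong (n₀ *_) (count-injective n₀ α sf) ⟩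
    n₀ * (n₀ ^ n * (n₀ P′ degree α)) ≡⟨ *-assoc n₀ (n₀ ^ n) _ ⟨
    n₀ ^ suc n * (n₀ P′ degree α) ∎
    where
    open ≡-Reasoning
    good = ∑ (maps n n₀) (λ φ → 𝟙 (push φ α))
  count-injective {suc n} n₀ (suc zero ∷ α) (_ ∷ sf) = begin
    ∑ (maps (suc n) n₀) (λ φ → 𝟙 (push φ (1 ∷ α))) * (n₀ * n₀ ^ k)
      ≡⟨ cong (_* (n₀ * n₀ ^ k)) (trans (∑-cartesianProductWith _∷_ (List.allFin n₀) (maps n n₀) (λ φ → 𝟙 (push φ (1 ∷ α))))
           (∑-swap (List.allFin n₀) (maps n n₀) (λ j φ → 𝟙 (bump 1 j (push φ α))))) ⟩
    ∑ (maps n n₀) (λ φ → ∑ (List.allFin n₀) (λ j → 𝟙 (bump 1 j (push φ α)))) * (n₀ * n₀ ^ k)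
      ≡⟨ cong (_* (n₀ * n₀ ^ k)) (trans (∑-cong (maps n n₀) extensions) (∑-* (maps n n₀) (n₀ ∸ k) (λ φ → 𝟙 (push φ α)))) ⟩
    (n₀ ∸ k) * good * (n₀ * n₀ ^ k)
      ≡⟨ regroup (n₀ ∸ k) good n₀ (n₀ ^ k) ⟩
    (n₀ ∸ k) * n₀ * (good * n₀ ^ k)
      ≡⟨ cong ((n₀ ∸ k) * n₀ *_) (count-injective n₀ α sf) ⟩
    (n₀ ∸ k) * n₀ * (n₀ ^ n * (n₀ P′ k))
      ≡⟨ regroup′ (n₀ ∸ k) n₀ (n₀ ^ n) (n₀ P′ k) ⟩
    n₀ ^ suc n * (n₀ P′ suc k) ∎
    where
    open ≡-Reasoning
    k = degree α
    good = ∑ (maps n n₀) (λ φ → 𝟙 (push φ α))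
    -- If `φ` is injective on the support of `α`, then `n₀ - k` values remain for the additional
    -- variable; this is the next factor of the falling factorial.
    extensions : ∀ φ → ∑ (List.allFin n₀) (λ j → 𝟙 (bump 1 j (push φ α))) ≡ (n₀ ∸ k) * 𝟙 (push φ α)
    extensions φ = trans (sym (m+n∸n≡m _ (degree (push φ α) * 𝟙 (push φ α))))
      (trans (cong (_∸ degree (push φ α) * 𝟙 (push φ α)) (∑-bump (push φ α)))
        (trans (sym (*-distribʳ-∸ (𝟙 (push φ α)) n₀ (degree (push φ α)))) (cong (λ t → (n₀ ∸ t) * 𝟙 (push φ α)) (degree-push φ α))))
    regroup : ∀ a b c d → a * b * (c * d) ≡ a * c * (b * d)
    regroup = solve-∀
    regroup′ : ∀ a b c d → a * b * (c * d) ≡ b * c * (a * d)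
    regroup′ = solve-∀
  count-injective n₀ (suc (suc _) ∷ α) (s≤s () ∷ _)

  squareFrees : ∀ n (d : ℕ) → List (Vec ℕ n)
  squareFrees zero    zero    = [] ∷ []
  squareFrees zero    (suc d) = []
  squareFrees (suc n) zero    = 0s ∷ []
  squareFrees (suc n) (suc d) = List.map (0 ∷_) (squareFrees n (suc d)) List.++ List.map (1 ∷_) (squareFrees n d)

  -- A crude substitute for the binomial coefficient: only the logarithm of this count enters, and
  -- `d log n` is the order aimed at.
  length-squareFrees : ∀ n (d : ℕ) → length (squareFrees n d) ≤ n ^ d
  length-squareFrees zero    zero    = ≤-refl
  length-squareFrees zero    (suc d) = z≤n
  length-squareFrees (suc n) zero    = ≤-refl
  length-squareFrees (suc n) (suc d) = begin
    length (squareFrees (suc n) (suc d))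
      ≡⟨ List.length-++ (List.map (0 ∷_) (squareFrees n (suc d))) ⟩
    length (List.map (0 ∷_) (squareFrees n (suc d))) + length (List.map (1 ∷_) (squareFrees n d))
      ≡⟨ cong₂ _+_ (List.length-map (0 ∷_) (squareFrees n (suc d))) (List.length-map (1 ∷_) (squareFrees n d)) ⟩
    length (squareFrees n (suc d)) + length (squareFrees n d)
      ≤⟨ +-mono-≤ (length-squareFrees n (suc d)) (length-squareFrees n d) ⟩
    n ^ suc d + n ^ d ≡⟨ +-comm (n ^ suc d) (n ^ d) ⟩
    suc n * n ^ d     ≤⟨ *-monoʳ-≤ (suc n) (^-monoˡ-≤ d (n≤1+n n)) ⟩
    suc n ^ suc d     ∎
    where open ≤-Reasoning

  ∈-squareFrees : ∀ {n} (α : Vec ℕ n) → SquareFree α → α ∈ squareFrees n (degree α)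
  ∈-squareFrees [] [] = here refl
  ∈-squareFrees {suc n} (suc zero ∷ α) (_ ∷ sf) =
    ∈-++⁺ʳ (List.map (0 ∷_) (squareFrees n (suc (degree α)))) (∈-map⁺ (1 ∷_) (∈-squareFrees α sf))
  ∈-squareFrees (suc (suc _) ∷ α) (s≤s () ∷ _)
  ∈-squareFrees {suc n} (zero ∷ α) (_ ∷ sf) with degree α in eq
  ... | zero  = here (cong (0 ∷_) (degree≡0 α eq))
    where
    degree≡0 : ∀ {n} (α : Vec ℕ n) → degree α ≡ 0 → α ≡ 0s
    degree≡0 []         _  = refl
    degree≡0 (zero ∷ α) eq = cong (0 ∷_) (degree≡0 α eq)
  ... | suc d = ∈-++⁺ˡ (∈-map⁺ (0 ∷_) (subst (λ t → α ∈ squareFrees n t) eq (∈-squareFrees α sf)))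

  squareFrees-sound : ∀ n (d : ℕ) {α} → α ∈ squareFrees n d → SquareFree α × degree α ≡ d
  squareFrees-sound zero    zero    (here refl) = [] , refl
  squareFrees-sound (suc n) zero    (here refl) = 0s-squareFree (suc n) , degree-0s (suc n)
  squareFrees-sound (suc n) (suc d) α∈ with ∈-++⁻ (List.map (0 ∷_) (squareFrees n (suc d))) α∈
  ... | inj₁ α∈₀ with ∈-map⁻ (0 ∷_) α∈₀
  ...   | β , β∈ , refl with squareFrees-sound n (suc d) β∈
  ...     | sf , eq = z≤n ∷ sf , eq
  squareFrees-sound (suc n) (suc d) α∈ | inj₂ α∈₁ with ∈-map⁻ (1 ∷_) α∈₁
  ...   | β , β∈ , refl with squareFrees-sound n d β∈
  ...     | sf , eq = s≤s z≤n ∷ sf , cong suc eq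

-- A derandomised Chernoff bound

module Concentration where
  open import Data.Nat.Base using (_+_; _*_; _∸_; _^_; _≤_; _<_; s≤s; NonZero; >-nonZero; >-nonZero⁻¹)
  open import Data.Nat.Properties
  open import Data.Nat.Tactic.RingSolver using (solve-∀)
  open PowerInequalities
  open ListSums
  open ExponentVectors

  ^-swap : ∀ a m n → (a ^ m) ^ n ≡ (a ^ n) ^ m
  ^-swap a m n = trans (^-*-assoc a m n) (trans (cong (a ^_) (*-comm m n)) (sym (^-*-assoc a n m)))

  total : ∀ {A : Set} {m} → (A → ℕ) → Vec A m → ℕ
  total f []       = 0
  total f (x ∷ xs) = f x + total f xs

  -- By hypothesis `c a` is `k * (x / k) ^ I a`, so the product is an exponential moment, with the
  -- number of hits as the exponent of `x / k`.
  ∏-indicator : ∀ {A : Set} (I c : A → ℕ) x k → (∀ a → c a * k ^ I a ≡ x ^ I a * k) →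
    ∀ {m} (as : Vec A m) → ∏ c as * k ^ total I as ≡ x ^ total I as * k ^ m
  ∏-indicator I c x k eq []       = refl
  ∏-indicator I c x k eq {suc m} (a ∷ as) = begin
    c a * ∏ c as * k ^ (I a + X)        ≡⟨ cong (c a * ∏ c as *_) (^-distribˡ-+-* k (I a) X) ⟩
    c a * ∏ c as * (k ^ I a * k ^ X)    ≡⟨ interchange (c a) (∏ c as) (k ^ I a) (k ^ X) ⟩
    c a * k ^ I a * (∏ c as * k ^ X)    ≡⟨ cong₂ _*_ (eq a) (∏-indicator I c x k eq as) ⟩
    x ^ I a * k * (x ^ X * k ^ m)       ≡⟨ interchange (x ^ I a) k (x ^ X) (k ^ m) ⟩
    x ^ I a * x ^ X * (k * k ^ m)       ≡⟨ cong (_* (k * k ^ m)) (^-distribˡ-+-* x (I a) X) ⟨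
    x ^ (I a + X) * k ^ suc m           ∎
    where
    open ≡-Reasoning
    X = total I as
    interchange : ∀ a b c d → a * b * (c * d) ≡ a * c * (b * d)
    interchange = solve-∀

  -- The last two hypotheses combine to `(x / k) ^ X ≤ (p / (v * k)) ^ m * F`. After raising this to
  -- the power `v * k`, `power-compare` replaces `p / (v * k)` by a power of `x / k`, so that apart
  -- from `F` a single base is left.
  moment-bound : ∀ k u v p x F X m Π .{{_ : NonZero k}} .{{_ : NonZero v}} .{{_ : NonZero x}} →
    p + u * k ≡ v * k + u * x → Π * k ^ X ≡ x ^ X * k ^ m → v ^ m * Π ≤ p ^ m * F →
    x ^ (X * (v * k)) * k ^ (u * x * m) ≤ x ^ (u * x * m) * k ^ (X * (v * k)) * F ^ (v * k)
  moment-bound k u v p x F X m Π eq Πeq le = *-cancelˡ-≤ ((w ^ w) ^ m) {{m^n≢0 (w ^ w) m {{m^n≢0 w w {{m*n≢0 v k}}}}}} (begin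
    (w ^ w) ^ m * (x ^ (X * w) * k ^ (c * m))
      ≡⟨ cong₂ (λ s t → s * (t * k ^ (c * m))) (^-swap w w m) (sym (^-*-assoc x X w)) ⟩
    (w ^ m) ^ w * ((x ^ X) ^ w * k ^ (c * m))
      ≡⟨ *-assoc ((w ^ m) ^ w) _ _ ⟨
    (w ^ m) ^ w * (x ^ X) ^ w * k ^ (c * m)
      ≡⟨ cong (_* k ^ (c * m)) (^-distribʳ-* (w ^ m) (x ^ X) w) ⟨
    (w ^ m * x ^ X) ^ w * k ^ (c * m)
      ≡⟨ cong (λ t → t ^ w * k ^ (c * m)) product ⟩
    (v ^ m * Π * k ^ X) ^ w * k ^ (c * m)
      ≤⟨ *-monoˡ-≤ (k ^ (c * m)) (^-monoˡ-≤ w (*-monoˡ-≤ (k ^ X) le)) ⟩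
    (p ^ m * F * k ^ X) ^ w * k ^ (c * m)
      ≡⟨ cong (_* k ^ (c * m)) (trans (^-distribʳ-* (p ^ m * F) (k ^ X) w) (cong₂ _*_ (^-distribʳ-* (p ^ m) F w) (^-*-assoc k X w))) ⟩
    (p ^ m) ^ w * F ^ w * k ^ (X * w) * k ^ (c * m)
      ≡⟨ cong₂ (λ s t → s * F ^ w * k ^ (X * w) * t) (^-swap p m w) (sym (^-*-assoc k c m)) ⟩
    (p ^ w) ^ m * F ^ w * k ^ (X * w) * (k ^ c) ^ m
      ≡⟨ regroup ((p ^ w) ^ m) (F ^ w) (k ^ (X * w)) ((k ^ c) ^ m) ⟩
    (p ^ w) ^ m * (k ^ c) ^ m * (k ^ (X * w) * F ^ w)
      ≡⟨ cong (_* (k ^ (X * w) * F ^ w)) (^-distribʳ-* (p ^ w) (k ^ c) m) ⟨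
    (p ^ w * k ^ c) ^ m * (k ^ (X * w) * F ^ w)
      ≤⟨ *-monoˡ-≤ (k ^ (X * w) * F ^ w) (^-monoˡ-≤ m (power-compare k u v p x eq)) ⟩
    (w ^ w * x ^ c) ^ m * (k ^ (X * w) * F ^ w)
      ≡⟨ cong (_* (k ^ (X * w) * F ^ w)) (trans (^-distribʳ-* (w ^ w) (x ^ c) m) (cong ((w ^ w) ^ m *_) (^-*-assoc x c m))) ⟩
    (w ^ w) ^ m * x ^ (c * m) * (k ^ (X * w) * F ^ w)
      ≡⟨ regroup′ ((w ^ w) ^ m) (x ^ (c * m)) (k ^ (X * w)) (F ^ w) ⟩
    (w ^ w) ^ m * (x ^ (c * m) * k ^ (X * w) * F ^ w) ∎)
    where
    open ≤-Reasoning
    w = v * k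
    c = u * x
    regroup : ∀ a b c d → a * b * c * d ≡ a * d * (c * b)
    regroup = solve-∀
    regroup′ : ∀ a b c d → a * b * (c * d) ≡ a * (b * c * d)
    regroup′ = solve-∀
    rotate : ∀ a b c → a * b * c ≡ a * (c * b)
    rotate = solve-∀
    product : w ^ m * x ^ X ≡ v ^ m * Π * k ^ X
    product = trans (cong (_* x ^ X) (^-distribʳ-* v k m)) (trans (rotate (v ^ m) (k ^ m) (x ^ X))
      (trans (cong (v ^ m *_) (sym Πeq)) (sym (*-assoc (v ^ m) Π (k ^ X)))))

  -- Turns the cost `2 ^ e` of the union bound into a power of `b / a`, so that `exponent-compare`
  -- becomes applicable.
  absorb : ∀ a k b e w → 2 * a ^ k ≤ b ^ k → (2 ^ e) ^ w * a ^ (k * (e * w)) ≤ b ^ (k * (e * w))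
  absorb a k b e w le = begin
    (2 ^ e) ^ w * a ^ (k * (e * w))   ≡⟨ cong₂ _*_ (^-*-assoc 2 e w) (sym (^-*-assoc a k (e * w))) ⟩
    2 ^ (e * w) * (a ^ k) ^ (e * w)   ≡⟨ ^-distribʳ-* 2 (a ^ k) (e * w) ⟨
    (2 * a ^ k) ^ (e * w)             ≤⟨ ^-monoˡ-≤ (e * w) le ⟩
    (b ^ k) ^ (e * w)                 ≡⟨ ^-*-assoc b k (e * w) ⟩
    b ^ (k * (e * w))                 ∎
    where open ≤-Reasoning

  -- Comparing exponents gives `X * (v * k) ≤ m * u * (k + 1) + e * (k * k) *
  -- v`. The mean corresponds to `m * u * k`; one more `m * u` is lost to the discrete exponential
  -- and another, by `large`, to the union bound.
  upper-tail : ∀ κ u v e X m Π (let k = suc κ) .{{_ : NonZero v}} →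
    Π * k ^ X ≡ suc k ^ X * k ^ m → v ^ m * Π ≤ (v * k + u) ^ m * 2 ^ e → e * (k * k) * v ≤ m * u →
    X * (v * k) ≤ m * u * suc (suc k)
  upper-tail κ u v e X m Π Πeq le large = begin
    X * w                              ≤⟨ exponent-compare k x (X * w) (c * m + r) (n<1+n k) compare ⟩
    c * m + r                          ≡⟨ cong₂ _+_ (regroup u x m) (regroup′ k e v) ⟩
    m * u * x + e * (k * k) * v        ≤⟨ +-monoʳ-≤ (m * u * x) large ⟩
    m * u * x + m * u                  ≡⟨ trans (+-comm (m * u * x) (m * u)) (sym (*-suc (m * u) x)) ⟩
    m * u * suc x                      ∎
    where
    open ≤-Reasoning
    k = suc κ
    x = suc k
    w = v * k
    c = u * x
    r = k * (e * w)
    regroup : ∀ a b c → a * b * c ≡ c * a * b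
    regroup = solve-∀
    regroup′ : ∀ k e v → k * (e * (v * k)) ≡ e * (k * k) * v
    regroup′ = solve-∀
    balance : ∀ u k v → v * k + u + u * k ≡ v * k + u * (1 + k)
    balance = solve-∀
    regroup″ : ∀ a b c d → a * b * c * d ≡ a * (c * d) * b
    regroup″ = solve-∀
    compare : x ^ (X * w) * k ^ (c * m + r) ≤ x ^ (c * m + r) * k ^ (X * w)
    compare = begin
      x ^ (X * w) * k ^ (c * m + r)
        ≡⟨ trans (cong (x ^ (X * w) *_) (^-distribˡ-+-* k (c * m) r)) (sym (*-assoc (x ^ (X * w)) _ _)) ⟩
      x ^ (X * w) * k ^ (c * m) * k ^ r
        ≤⟨ *-monoˡ-≤ (k ^ r) (moment-bound k u v (v * k + u) x (2 ^ e) X m Π (balance u k v) Πeq le) ⟩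
      x ^ (c * m) * k ^ (X * w) * (2 ^ e) ^ w * k ^ r
        ≡⟨ regroup″ (x ^ (c * m)) (k ^ (X * w)) ((2 ^ e) ^ w) (k ^ r) ⟩
      x ^ (c * m) * ((2 ^ e) ^ w * k ^ r) * k ^ (X * w)
        ≤⟨ *-monoˡ-≤ (k ^ (X * w)) (*-monoʳ-≤ (x ^ (c * m)) (absorb k k x e w (2*k^k≤[1+k]^k k))) ⟩
      x ^ (c * m) * x ^ r * k ^ (X * w)
        ≡⟨ cong (_* k ^ (X * w)) (^-distribˡ-+-* x (c * m) r) ⟨
      x ^ (c * m + r) * k ^ (X * w) ∎

  -- The mirror image with base `κ / k < 1`, hence with nonzero `κ`. The two losses leave
  -- `X ≥ (1 - 2/k) * m * u / v`; the summand `m * u` on the right replaces a subtraction.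
  lower-tail : ∀ κ u v e X m Π (let k = suc κ) .{{_ : NonZero κ}} .{{_ : NonZero v}} → u ≤ v →
    Π * k ^ X ≡ κ ^ X * k ^ m → v ^ m * Π ≤ (v * k ∸ u) ^ m * 2 ^ e → e * (k * k) * v ≤ m * u →
    m * u * κ ≤ X * (v * k) + m * u
  lower-tail κ u v e X m Π u≤v Πeq le large = begin
    m * u * κ                          ≡⟨ regroup u κ m ⟨
    c * m                              ≤⟨ exponent-compare κ k (c * m) (X * w + r) (n<1+n κ) compare ⟩
    X * w + r                          ≡⟨ cong (X * w +_) (regroup′ k e v) ⟩
    X * w + e * (k * k) * v            ≤⟨ +-monoʳ-≤ (X * w) large ⟩
    X * w + m * u                      ∎
    where
    open ≤-Reasoning
    k = suc κ
    w = v * k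
    c = u * κ
    r = k * (e * w)
    u≤w : u ≤ v * k
    u≤w = ≤-trans u≤v (m≤m*n v k)
    regroup : ∀ a b c → a * b * c ≡ c * a * b
    regroup = solve-∀
    regroup′ : ∀ k e v → k * (e * (v * k)) ≡ e * (k * k) * v
    regroup′ = solve-∀
    balance : v * k ∸ u + u * k ≡ v * k + u * κ
    balance = trans (cong (v * k ∸ u +_) (*-suc u κ)) (trans (sym (+-assoc (v * k ∸ u) u (u * κ)))
      (cong (_+ u * κ) (m∸n+n≡m u≤w)))
    regroup″ : ∀ a b c d → a * b * c * d ≡ b * (c * d) * a
    regroup″ = solve-∀
    compare : k ^ (c * m) * κ ^ (X * w + r) ≤ k ^ (X * w + r) * κ ^ (c * m)
    compare = begin
      k ^ (c * m) * κ ^ (X * w + r)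
        ≡⟨ trans (cong (k ^ (c * m) *_) (^-distribˡ-+-* κ (X * w) r)) (trans (sym (*-assoc (k ^ (c * m)) _ _))
             (cong (_* κ ^ r) (*-comm (k ^ (c * m)) (κ ^ (X * w))))) ⟩
      κ ^ (X * w) * k ^ (c * m) * κ ^ r
        ≤⟨ *-monoˡ-≤ (κ ^ r) (moment-bound k u v (v * k ∸ u) κ (2 ^ e) X m Π balance Πeq le) ⟩
      κ ^ (c * m) * k ^ (X * w) * (2 ^ e) ^ w * κ ^ r
        ≡⟨ regroup″ (κ ^ (c * m)) (k ^ (X * w)) ((2 ^ e) ^ w) (κ ^ r) ⟩
      k ^ (X * w) * ((2 ^ e) ^ w * κ ^ r) * κ ^ (c * m)
        ≤⟨ *-monoˡ-≤ (κ ^ (c * m)) (*-monoʳ-≤ (k ^ (X * w)) (absorb κ k k e w (2*k^[1+k]≤[1+k]^[1+k] κ))) ⟩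
      k ^ (X * w) * k ^ r * κ ^ (c * m)
        ≡⟨ cong (_* κ ^ (c * m)) (^-distribˡ-+-* k (X * w) r) ⟨
      k ^ (X * w + r) * κ ^ (c * m) ∎

  hits : ∀ {n n₀ m} → Vec (Vec (Fin n₀) n) m → Vec ℕ n → ℕ
  hits φs α = total (λ φ → 𝟙 (push φ α)) φs

  P′≤^ : ∀ n d → n P′ d ≤ n ^ d
  P′≤^ n zero    = ≤-refl
  P′≤^ n (suc d) = *-mono-≤ (m∸n≤m n d) (P′≤^ n d)

  concentration : ∀ n₀ n d κ e m (let k = suc κ ; u = n₀ P′ d ; v = n₀ ^ d) →
    .{{_ : NonZero n₀}} .{{_ : NonZero κ}} → 2 * n ^ d ≤ 2 ^ e → e * (k * k) * v ≤ m * u →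
    Σ[ φs ∈ Vec (Vec (Fin n₀) n) m ] (∀ α → SquareFree α → degree α ≡ d →
      hits φs α * (v * k) ≤ m * u * suc (suc k) × m * u * κ ≤ hits φs α * (v * k) + m * u)
  concentration n₀ n d κ e m few large = φs , λ { α sf refl →
      upper-tail κ u v e (hits φs α) m (∏ (up α) φs) (∏-indicator (I α) (up α) (suc k) k (up-indicator α) φs) (up-bound (∈-squareFrees α sf)) large
    , lower-tail κ u v e (hits φs α) m (∏ (down α) φs) u≤v (∏-indicator (I α) (down α) κ k (down-indicator α) φs) (down-bound (∈-squareFrees α sf)) large }
    where
    k = suc κ
    u = n₀ P′ d
    v = n₀ ^ d
    W = n₀ ^ n
    p₊ = v * k + u
    p₋ = v * k ∸ u
    u≤v = P′≤^ n₀ d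
    instance
      v≢0 : NonZero v
      v≢0 = m^n≢0 n₀ d
      p₊≢0 : NonZero p₊
      p₊≢0 = >-nonZero (≤-trans (>-nonZero⁻¹ (v * k) {{m*n≢0 v k}}) (m≤m+n (v * k) u))
      p₋≢0 : NonZero p₋
      p₋≢0 = >-nonZero (m<n⇒0<n∸m (≤-<-trans u≤v (m<m*n v k (s≤s (>-nonZero⁻¹ κ)))))
    Φ = maps n n₀
    L = squareFrees n d
    I up down : Vec ℕ n → Vec (Fin n₀) n → ℕ
    I α φ = 𝟙 (push φ α)
    up α φ = k + I α φ
    down α φ = k ∸ I α φ
    up-indicator : ∀ α φ → up α φ * k ^ I α φ ≡ suc k ^ I α φ * k
    up-indicator α φ with I α φ | 𝟙-cases (push φ α)
    ... | _ | inj₁ refl = trans (*-identityʳ (k + 0)) (trans (+-identityʳ k) (sym (*-identityˡ k)))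
    ... | _ | inj₂ refl = cong₂ _*_ (trans (+-comm k 1) (sym (*-identityʳ (suc k)))) (*-identityʳ k)
    down-indicator : ∀ α φ → down α φ * k ^ I α φ ≡ κ ^ I α φ * k
    down-indicator α φ with I α φ | 𝟙-cases (push φ α)
    ... | _ | inj₁ refl = trans (*-identityʳ k) (sym (*-identityˡ k))
    ... | _ | inj₂ refl = cong₂ _*_ (sym (*-identityʳ κ)) (*-identityʳ k)
    -- Each squarefree monomial is tested for both tails. The factors `v * p₋` and `v * p₊` give all
    -- tests the common mean `p₊ * p₋` required by `conditional-expectations`; the surplus is
    -- cancelled at the end.
    T = List.map inj₁ L List.++ List.map inj₂ L
    c : Vec ℕ n ⊎ Vec ℕ n → Vec (Fin n₀) n → ℕ
    c = [ (λ α φ → v * p₋ * up α φ) , (λ α φ → v * p₊ * down α φ) ]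
    W≡ : ∀ b → ∑ Φ (λ _ → b) ≡ W * b
    W≡ b = trans (∑-const Φ b) (cong (_* b) (length-maps n n₀))
    hit-mean : ∀ {α} → α ∈ L → v * ∑ Φ (I α) ≡ W * u
    hit-mean {α} α∈ with squareFrees-sound n d α∈
    ... | sf , refl = trans (*-comm v _) (count-injective n₀ α sf)
    up-mean : ∀ {α} → α ∈ L → v * ∑ Φ (up α) ≡ W * p₊
    up-mean {α} α∈ = begin
      v * ∑ Φ (up α)              ≡⟨ cong (v *_) (trans (∑-+ Φ (λ _ → k) (I α)) (cong (_+ ∑ Φ (I α)) (W≡ k))) ⟩
      v * (W * k + ∑ Φ (I α))     ≡⟨ *-distribˡ-+ v (W * k) _ ⟩
      v * (W * k) + v * ∑ Φ (I α) ≡⟨ cong₂ _+_ (swap v W k) (hit-mean α∈) ⟩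
      W * (v * k) + W * u         ≡⟨ *-distribˡ-+ W (v * k) u ⟨
      W * p₊                      ∎
      where
      open ≡-Reasoning
      swap : ∀ a b c → a * (b * c) ≡ b * (a * c)
      swap = solve-∀
    down-mean : ∀ {α} → α ∈ L → v * ∑ Φ (down α) ≡ W * p₋
    down-mean {α} α∈ = begin
      v * ∑ Φ (down α)                                   ≡⟨ m+n∸n≡m _ (v * ∑ Φ (I α)) ⟨
      v * ∑ Φ (down α) + v * ∑ Φ (I α) ∸ v * ∑ Φ (I α)   ≡⟨ cong₂ _∸_ complement (hit-mean α∈) ⟩
      W * (v * k) ∸ W * u                                ≡⟨ *-distribˡ-∸ W (v * k) u ⟨
      W * p₋                                             ∎
      where
      open ≡-Reasoning
      swap : ∀ a b c → a * (b * c) ≡ b * (a * c)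
      swap = solve-∀
      cancel : ∀ φ → down α φ + I α φ ≡ k
      cancel φ with I α φ | 𝟙-cases (push φ α)
      ... | _ | inj₁ refl = +-identityʳ k
      ... | _ | inj₂ refl = +-comm κ 1
      complement : v * ∑ Φ (down α) + v * ∑ Φ (I α) ≡ W * (v * k)
      complement = trans (sym (*-distribˡ-+ v _ _)) (trans (cong (v *_)
        (trans (sym (∑-+ Φ (down α) (I α))) (trans (∑-cong Φ cancel) (W≡ k)))) (swap v W k))
    mean : ∀ t → t ∈ T → ∑ Φ (c t) ≡ length Φ * (p₊ * p₋)
    mean t t∈ with ∈-++⁻ (List.map inj₁ L) t∈
    ... | inj₁ t∈₁ with ∈-map⁻ inj₁ t∈₁
    ...   | α , α∈ , refl = begin
      ∑ Φ (λ φ → v * p₋ * up α φ) ≡⟨ ∑-* Φ (v * p₋) (up α) ⟩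
      v * p₋ * ∑ Φ (up α)         ≡⟨ swap v p₋ _ ⟩
      v * ∑ Φ (up α) * p₋         ≡⟨ cong (_* p₋) (up-mean α∈) ⟩
      W * p₊ * p₋                 ≡⟨ *-assoc W p₊ p₋ ⟩
      W * (p₊ * p₋)               ≡⟨ cong (_* (p₊ * p₋)) (length-maps n n₀) ⟨
      length Φ * (p₊ * p₋)        ∎
      where
      open ≡-Reasoning
      swap : ∀ a b c → a * b * c ≡ a * c * b
      swap = solve-∀
    mean t t∈ | inj₂ t∈₂ with ∈-map⁻ inj₂ t∈₂
    ...   | α , α∈ , refl = begin
      ∑ Φ (λ φ → v * p₊ * down α φ) ≡⟨ ∑-* Φ (v * p₊) (down α) ⟩
      v * p₊ * ∑ Φ (down α)         ≡⟨ swap v p₊ _ ⟩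
      p₊ * (v * ∑ Φ (down α))       ≡⟨ cong (p₊ *_) (down-mean α∈) ⟩
      p₊ * (W * p₋)                 ≡⟨ swap′ p₊ W p₋ ⟩
      W * (p₊ * p₋)                 ≡⟨ cong (_* (p₊ * p₋)) (length-maps n n₀) ⟨
      length Φ * (p₊ * p₋)          ∎
      where
      open ≡-Reasoning
      swap : ∀ a b c → a * b * c ≡ b * (a * c)
      swap = solve-∀
      swap′ : ∀ a b c → a * (b * c) ≡ b * (a * c)
      swap′ = solve-∀
    selected = conditional-expectations Φ T c (p₊ * p₋)
      (subst (0 <_) (sym (length-maps n n₀)) (m^n>0 n₀ n)) mean m (λ _ → 1)
    φs = proj₁ selected
    -- The union bound: a single product is at most the sum of all of them, which starts from at
    -- most `2 * n ^ d` terms equal to 1.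
    potential : ∀ t → t ∈ T → ∏ (c t) φs ≤ (p₊ * p₋) ^ m * 2 ^ e
    potential t t∈ = begin
      ∏ (c t) φs                     ≡⟨ *-identityˡ _ ⟨
      1 * ∏ (c t) φs                 ≤⟨ ∑-∈ (λ t → 1 * ∏ (c t) φs) t∈ ⟩
      ∑ T (λ t → 1 * ∏ (c t) φs)     ≤⟨ proj₂ selected ⟩
      (p₊ * p₋) ^ m * ∑ T (λ _ → 1)  ≤⟨ *-monoʳ-≤ ((p₊ * p₋) ^ m) size ⟩
      (p₊ * p₋) ^ m * 2 ^ e          ∎
      where
      open ≤-Reasoning
      ones : ∑ L (λ _ → 1) ≤ n ^ d
      ones = ≤-trans (≤-reflexive (trans (∑-const L 1) (*-identityʳ _))) (length-squareFrees n d)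
      size : ∑ T (λ _ → 1) ≤ 2 ^ e
      size = begin
        ∑ T (λ _ → 1) ≡⟨ ∑-++ (List.map inj₁ L) (List.map inj₂ L) (λ _ → 1) ⟩
        ∑ (List.map inj₁ L) (λ _ → 1) + ∑ (List.map inj₂ L) (λ _ → 1)
          ≡⟨ cong₂ _+_ (∑-map inj₁ L (λ _ → 1)) (∑-map inj₂ L (λ _ → 1)) ⟩
        ∑ L (λ _ → 1) + ∑ L (λ _ → 1) ≤⟨ +-mono-≤ ones ones ⟩
        n ^ d + n ^ d                 ≡⟨ cong (n ^ d +_) (+-identityʳ (n ^ d)) ⟨
        2 * n ^ d                     ≤⟨ few ⟩
        2 ^ e                         ∎
    cancel : ∀ p q .{{_ : NonZero q}} Π → (v * q) ^ m * Π ≤ (p * q) ^ m * 2 ^ e → v ^ m * Π ≤ p ^ m * 2 ^ e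
    cancel p q Π le = *-cancelʳ-≤ _ _ (q ^ m) {{m^n≢0 q m}} (begin
      v ^ m * Π * q ^ m         ≡⟨ swap (v ^ m) Π (q ^ m) ⟩
      v ^ m * q ^ m * Π         ≡⟨ cong (_* Π) (^-distribʳ-* v q m) ⟨
      (v * q) ^ m * Π           ≤⟨ le ⟩
      (p * q) ^ m * 2 ^ e       ≡⟨ cong (_* 2 ^ e) (^-distribʳ-* p q m) ⟩
      p ^ m * q ^ m * 2 ^ e     ≡⟨ swap (p ^ m) (q ^ m) (2 ^ e) ⟩
      p ^ m * 2 ^ e * q ^ m     ∎)
      where
      open ≤-Reasoning
      swap : ∀ a b c → a * b * c ≡ a * c * b
      swap = solve-∀
    up-bound : ∀ {α} → α ∈ L → v ^ m * ∏ (up α) φs ≤ p₊ ^ m * 2 ^ e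
    up-bound {α} α∈ = cancel p₊ p₋ _ (≤-trans (≤-reflexive (sym (∏-scale (v * p₋) (up α) φs)))
      (potential (inj₁ α) (∈-++⁺ˡ (∈-map⁺ inj₁ α∈))))
    down-bound : ∀ {α} → α ∈ L → v ^ m * ∏ (down α) φs ≤ p₋ ^ m * 2 ^ e
    down-bound {α} α∈ = cancel p₋ p₊ _ (≤-trans (≤-reflexive (sym (∏-scale (v * p₊) (down α) φs)))
      (≤-trans (potential (inj₂ α) (∈-++⁺ʳ (List.map inj₁ L) (∈-map⁺ inj₂ α∈)))
        (≤-reflexive (cong (λ t → t ^ m * 2 ^ e) (*-comm p₊ p₋)))))

-- The number of maps and the total relative error

module Parameters where
  open import Data.Nat.Base using (_+_; _*_; _^_; _≤_; _<_; z≤n; s≤s; NonZero; >-nonZero)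
  open import Data.Nat.Properties
  open import Data.Nat.Tactic.RingSolver using (solve-∀)
  open PowerInequalities
  open Concentration

  P′-pos : ∀ n d → d ≤ n → 0 < n P′ d
  P′-pos n zero    _   = s≤s z≤n
  P′-pos n (suc d) d<n = *-mono-< (m<n⇒0<n∸m d<n) (P′-pos n d (<⇒≤ d<n))

  -- m ≈ 3Ldk²v/u maps are used, where u/v = (n₀)_d / n₀^d and L = ⌊log₂ n⌋.
  number-of-maps : ∀ n₀ d n k → 1 ≤ d → d ≤ n₀ → 2 ≤ n → 1 ≤ k → let u = n₀ P′ d ; v = n₀ ^ d in
    ∃[ L ] ∃[ e ] ∃[ m ] 2 ^ L ≤ n × 2 * n ^ d ≤ 2 ^ e × e * (k * k) * v ≤ m * u
      × m * u ≤ 6 * (L * d * (k * k) * v) × 1 ≤ m * u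
  number-of-maps n₀ d n k 1≤d d≤n₀ 2≤n 1≤k with log₂-floor n 2≤n
  ... | L , 1≤L , 2^L≤n , n<2^sL
    with crossing (λ j → j * u ≤? T) 0 (suc T) z≤n
           (<⇒≱ (≤-trans (≤-reflexive (sym (*-identityʳ (suc T))))
             (*-mono-≤ (≤-reflexive (sym (+-identityʳ (suc T)))) u≥1)))
    where
    u = n₀ P′ d
    T = 3 * (L * d) * (k * k) * n₀ ^ d
    u≥1 = P′-pos n₀ d d≤n₀
  ... | j , _ , ju≤T , sju≰T = L , 3 * (L * d) , suc j , 2^L≤n , few , <⇒≤ (≰⇒> sju≰T) , small
      , ≤-trans (s≤s z≤n) (≰⇒> sju≰T)
    where
    u = n₀ P′ d
    v = n₀ ^ d
    T = 3 * (L * d) * (k * k) * v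
    1≤Ld : 1 ≤ L * d
    1≤Ld = *-mono-≤ 1≤L 1≤d
    -- The exponent is `1 + d + L * d`, and each of the three summands is at most `L * d`; hence the
    -- 3 in `e`.
    few : 2 * n ^ d ≤ 2 ^ (3 * (L * d))
    few = begin
      2 * n ^ d                ≤⟨ *-monoʳ-≤ 2 (^-monoˡ-≤ d (<⇒≤ n<2^sL)) ⟩
      2 * (2 ^ suc L) ^ d      ≡⟨ cong (2 *_) (^-*-assoc 2 (suc L) d) ⟩
      2 ^ suc (d + L * d)      ≤⟨ ^-monoʳ-≤ 2 (+-mono-≤ 1≤Ld (+-mono-≤ (m≤n*m d L {{>-nonZero 1≤L}}) (≤-reflexive (sym (+-identityʳ (L * d)))))) ⟩
      2 ^ (3 * (L * d))        ∎
      where open ≤-Reasoning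
    T≥v : v ≤ T
    T≥v = ≤-trans (≤-reflexive (sym (*-identityˡ v))) (*-monoˡ-≤ v (*-mono-≤ (*-mono-≤ {1} {3} (s≤s z≤n) 1≤Ld) (*-mono-≤ 1≤k 1≤k)))
    double : ∀ a b c → 3 * a * b * c + 3 * a * b * c ≡ 6 * (a * b * c)
    double = solve-∀
    -- Rounding up adds one `u ≤ v ≤ T`, which at most doubles the factor 3.
    small : suc j * u ≤ 6 * (L * d * (k * k) * v)
    small = ≤-trans (+-mono-≤ (≤-trans (P′≤^ n₀ d) T≥v) ju≤T) (≤-reflexive (double (L * d) (k * k) v))

  -- Here `M` is `m * u`, `A / B` is the scale `(i / N) ^ d`, and `X` counts the hits of a monomial.
  -- The scaled count `A * X / B` is to lie within a factor `1 + 5/k` of 1 on either side.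
  module _ (c v M A B X : ℕ) .{{_ : NonZero v}}
    (root-lower : B * v ≤ A * M) (root-upper : A * M * (4 + c) ≤ B * v * (5 + c))
    (hits-upper : X * (v * (4 + c)) ≤ M * (6 + c)) (hits-lower : M * (3 + c) ≤ X * (v * (4 + c)) + M) where
    open ≤-Reasoning

    private
      k = 4 + c
      instance
        vk≢0 : NonZero (v * k)
        vk≢0 = m*n≢0 v k

    scaled-hits-upper : A * X * k ≤ B * (5 + k)
    scaled-hits-upper = *-cancelʳ-≤ _ _ (v * k) (begin
      A * X * k * (v * k)           ≡⟨ e₁ A X k (v * k) ⟩
      A * k * (X * (v * k))         ≤⟨ *-monoʳ-≤ (A * k) hits-upper ⟩
      A * k * (M * (2 + k))         ≡⟨ e₂ A k M (2 + k) ⟩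
      A * M * k * (2 + k)           ≤⟨ *-monoˡ-≤ (2 + k) root-upper ⟩
      -- This is `(1 + 1/k) * (1 + 2/k) ≤ 1 + 5/k`, with the slack written out in `c`.
      B * v * suc k * (2 + k)       ≤⟨ m≤m+n _ (B * v * (6 + 2 * c)) ⟩
      B * v * suc k * (2 + k) + B * v * (6 + 2 * c) ≡⟨ e₃ B v c ⟩
      B * (5 + k) * (v * k)         ∎)
      where
      e₁ : ∀ a x k w → a * x * k * w ≡ a * k * (x * w)
      e₁ = solve-∀
      e₂ : ∀ a k m l → a * k * (m * l) ≡ a * m * k * l
      e₂ = solve-∀
      e₃ : ∀ b v c → b * v * (5 + c) * (6 + c) + b * v * (6 + 2 * c) ≡ b * (9 + c) * (v * (4 + c))
      e₃ = solve-∀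

    -- Rests on `(1 - 2/k) * (1 + 5/k) ≥ 1`, that is `3 * k ≥ 10`, which is why `k` has the form
    -- `4 + c`.
    scaled-hits-lower : B * k ≤ A * X * (5 + k)
    scaled-hits-lower = *-cancelʳ-≤ _ _ (v * k) (begin
      B * k * (v * k)               ≤⟨ m≤m+n _ (B * v * (2 + 3 * c)) ⟩
      B * k * (v * k) + B * v * (2 + 3 * c) ≡⟨ e₁ B v c ⟩
      B * v * ((5 + k) * (2 + c))   ≤⟨ *-monoˡ-≤ ((5 + k) * (2 + c)) root-lower ⟩
      A * M * ((5 + k) * (2 + c))   ≡⟨ e₂ A M (5 + k) (2 + c) ⟩
      A * (5 + k) * (M * (2 + c))   ≤⟨ *-monoʳ-≤ (A * (5 + k)) lower ⟩
      A * (5 + k) * (X * (v * k))   ≡⟨ e₃ A (5 + k) X (v * k) ⟩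
      A * X * (5 + k) * (v * k)     ∎)
      where
      e₁ : ∀ b v c → b * (4 + c) * (v * (4 + c)) + b * v * (2 + 3 * c) ≡ b * v * ((9 + c) * (2 + c))
      e₁ = solve-∀
      e₂ : ∀ a m k l → a * m * (k * l) ≡ a * k * (m * l)
      e₂ = solve-∀
      e₃ : ∀ a k x w → a * k * (x * w) ≡ a * x * k * w
      e₃ = solve-∀
      lower : M * (2 + c) ≤ X * (v * k)
      lower = +-cancelʳ-≤ M _ _ (≤-trans (≤-reflexive (trans (+-comm (M * (2 + c)) M) (sym (*-suc M (2 + c))))) hits-lower)

-- Multinomial coefficients

module Multinomial where
  open import Data.Nat.Base using (_+_; _*_; _<_; z≤n; s≤s; z<s; _!)
  open import Data.Nat.Properties
  open ExponentVectors

  -- For a multinomial `m` this is Pascal's rule in `n` variables, with one term for each variable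
  -- dividing the monomial. The rule mirrors multiplication by a linear form and avoids quotients of
  -- factorials.
  lowerings : ∀ {n} → (Vec ℕ n → ℕ) → Vec ℕ n → ℕ
  lowerings m []          = 0
  lowerings m (zero ∷ α)  = lowerings (m ∘ (zero ∷_)) α
  lowerings m (suc a ∷ α) = m (a ∷ α) + lowerings (m ∘ (suc a ∷_)) α

  -- The coefficient of x^α in (x₁ + ⋯ + xₙ)^d.
  multinomial : ∀ {n} → ℕ → Vec ℕ n → ℕ
  multinomial zero    []          = 1
  multinomial zero    (zero ∷ α)  = multinomial zero α
  multinomial zero    (suc _ ∷ α) = 0
  multinomial (suc d) α           = lowerings (multinomial d) α

  lowerings-zero : ∀ {n} (m : Vec ℕ n → ℕ) α → (∀ β → suc (degree β) ≡ degree α → m β ≡ 0) → lowerings m α ≡ 0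
  lowerings-zero m []          h = refl
  lowerings-zero m (zero ∷ α)  h = lowerings-zero (m ∘ (zero ∷_)) α (λ β → h (zero ∷ β))
  lowerings-zero m (suc a ∷ α) h = cong₂ _+_ (h (a ∷ α) refl)
    (lowerings-zero (m ∘ (suc a ∷_)) α (λ β eq → h (suc a ∷ β) (trans (sym (+-suc (suc a) (degree β))) (cong (suc a +_) eq))))

  lowerings-positive : ∀ {n} (m : Vec ℕ n → ℕ) α d → degree α ≡ suc d → (∀ β → degree β ≡ d → 0 < m β) → 0 < lowerings m α
  lowerings-positive m (zero ∷ α)  d eq h = lowerings-positive (m ∘ (zero ∷_)) α d eq (λ β → h (zero ∷ β))
  lowerings-positive m (suc a ∷ α) d eq h = ≤-trans (h (a ∷ α) (suc-injective eq)) (m≤m+n _ _)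

  lowerings-squareFree : ∀ {n} (m : Vec ℕ n → ℕ) α c → SquareFree α →
    (∀ β → SquareFree β → suc (degree β) ≡ degree α → m β ≡ c) → lowerings m α ≡ degree α * c
  lowerings-squareFree m []             c _        h = refl
  lowerings-squareFree m (zero ∷ α)     c (_ ∷ sf) h = lowerings-squareFree (m ∘ (zero ∷_)) α c sf (λ β sfβ → h (zero ∷ β) (z≤n ∷ sfβ))
  lowerings-squareFree m (suc zero ∷ α) c (_ ∷ sf) h = cong₂ _+_ (h (0 ∷ α) (z≤n ∷ sf) refl)
    (lowerings-squareFree (m ∘ (1 ∷_)) α c sf (λ β sfβ eq → h (1 ∷ β) (s≤s z≤n ∷ sfβ) (cong suc eq)))
  lowerings-squareFree m (suc (suc _) ∷ α) c (s≤s () ∷ _) h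

  multinomial-zero : ∀ {n} d (α : Vec ℕ n) → degree α ≢ d → multinomial d α ≡ 0
  multinomial-zero zero    []          ≢d = contradiction refl ≢d
  multinomial-zero zero    (zero ∷ α)  ≢d = multinomial-zero zero α ≢d
  multinomial-zero zero    (suc _ ∷ α) ≢d = refl
  multinomial-zero (suc d) α           ≢d = lowerings-zero (multinomial d) α
    λ β eq → multinomial-zero d β λ { refl → ≢d (sym eq) }

  multinomial-positive : ∀ {n} d (α : Vec ℕ n) → degree α ≡ d → 0 < multinomial d α
  multinomial-positive zero    []         _  = z<s
  multinomial-positive zero    (zero ∷ α) eq = multinomial-positive zero α eq
  multinomial-positive (suc d) α          eq = lowerings-positive (multinomial d) α d eq (multinomial-positive d)

  multinomial-squareFree : ∀ {n} d (α : Vec ℕ n) → SquareFree α → degree α ≡ d → multinomial d α ≡ d !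
  multinomial-squareFree zero    []         _        _  = refl
  multinomial-squareFree zero    (zero ∷ α) (_ ∷ sf) eq = multinomial-squareFree zero α sf eq
  multinomial-squareFree (suc d) α          sf       eq = trans
    (lowerings-squareFree (multinomial d) α (d !) sf
      λ β sfβ eqβ → multinomial-squareFree d β sfβ (suc-injective (trans eqβ eq)))
    (cong (_* d !) eq)

-- Powers of linear forms over a commutative ring

module PowersOfLinearForms {r₁ r₂} (R : CommutativeRing r₁ r₂) where
  open CommutativeRing R hiding (zero) renaming (refl to ≈-refl; sym to ≈-sym; trans to ≈-trans)
  open Series R using (Series; _⊛_; one) renaming (_^_ to _^ˢ_)
  open import Algebra.Properties.Monoid.Sum +-monoid public using (sum; sum-cong-≋; sum-replicate-zero)
  open import Algebra.Properties.CommutativeMonoid.Mult +-commutativeMonoid using (×-distrib-+)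
  open import Algebra.Properties.Monoid.Mult +-monoid public using (×-congʳ; ×-homo-+; ×-congˡ) renaming (_×_ to infixr 8 _·_)
  open import Algebra.Properties.Semiring.Mult semiring public using (×-comm-*)
  open import Algebra.Properties.Semiring.Exp semiring public using (_^_; ^-congˡ; ^-homo-*)
  open import Algebra.Properties.CommutativeSemiring.Exp commutativeSemiring using (^-distrib-*)
  open import Algebra.Properties.CommutativeSemigroup *-commutativeSemigroup using (interchange; x∙yz≈y∙xz)
  open import Relation.Binary.Reasoning.Setoid setoid
  open ExponentVectors
  open Multinomial

  sum-zero : ∀ n {f : Fin n → Carrier} → (∀ i → f i ≈ 0#) → sum f ≈ 0#
  sum-zero n f≈0 = ≈-trans (sum-cong-≋ f≈0) (sum-replicate-zero n)

  unitVector : ∀ {n} → Fin n → Vec ℕ n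
  unitVector j = bump 1 j 0s

  ⊛-zeroˡ : ∀ {n} (p q : Series n) α → (∀ β → p β ≈ 0#) → (p ⊛ q) α ≈ 0#
  ⊛-zeroˡ p q []      p≈0 = ≈-trans (*-congʳ (p≈0 [])) (zeroˡ (q []))
  ⊛-zeroˡ p q (a ∷ α) p≈0 = sum-zero (suc a) λ i → ⊛-zeroˡ _ (q ∘ ((a ℕ.∸ toℕ i) ∷_)) α (λ β → p≈0 (toℕ i ∷ β))

  ⊛-constantˡ : ∀ {n} (p q : Series n) α → (∀ β → degree β ≢ 0 → p β ≈ 0#) → (p ⊛ q) α ≈ p 0s * q α
  ⊛-constantˡ p q []      p≈0 = ≈-refl
  ⊛-constantˡ p q (a ∷ α) p≈0 = ≈-trans
    (+-cong (⊛-constantˡ _ _ α (λ β → p≈0 (0 ∷ β)))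
      (sum-zero a λ i → ⊛-zeroˡ _ _ α λ β → p≈0 (suc (toℕ i) ∷ β) λ ()))
    (+-identityʳ _)

  -- The coefficients of the product of `q` with the linear form that has the coefficients `ℓ`.
  weightedLowerings : ∀ {n} → (Fin n → Carrier) → Series n → Series n
  weightedLowerings ℓ q []          = 0#
  weightedLowerings ℓ q (zero ∷ α)  = weightedLowerings (ℓ ∘ suc) (q ∘ (zero ∷_)) α
  weightedLowerings ℓ q (suc a ∷ α) = ℓ zero * q (a ∷ α) + weightedLowerings (ℓ ∘ suc) (q ∘ (suc a ∷_)) α

  weightedLowerings-cong : ∀ {n} ℓ {p q : Series n} → (∀ α → p α ≈ q α) → ∀ α → weightedLowerings ℓ p α ≈ weightedLowerings ℓ q α
  weightedLowerings-cong ℓ eq []          = ≈-refl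
  weightedLowerings-cong ℓ eq (zero ∷ α)  = weightedLowerings-cong (ℓ ∘ suc) (λ β → eq (zero ∷ β)) α
  weightedLowerings-cong ℓ eq (suc a ∷ α) = +-cong (*-congˡ (eq (a ∷ α)))
    (weightedLowerings-cong (ℓ ∘ suc) (λ β → eq (suc a ∷ β)) α)

  -- In the Cauchy product only the degrees 0 and 1 of `p` in the first variable survive: the former
  -- leaves a linear form in the other variables, the latter a constant.
  ⊛-linearˡ : ∀ {n} (p q : Series n) α → (∀ β → degree β ≢ 1 → p β ≈ 0#) →
              (p ⊛ q) α ≈ weightedLowerings (p ∘ unitVector) q α
  ⊛-linearˡ p q [] p≈0 = ≈-trans (*-congʳ (p≈0 [] λ ())) (zeroˡ (q []))
  ⊛-linearˡ p q (zero ∷ α) p≈0 = ≈-trans (+-identityʳ _) (⊛-linearˡ _ _ α (λ β → p≈0 (0 ∷ β)))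
  ⊛-linearˡ {suc n} p q (suc a ∷ α) p≈0 = begin
    (p₀ ⊛ (q ∘ (suc a ∷_))) α + ((p₁ ⊛ (q ∘ (a ∷_))) α + rest)
      ≈⟨ +-cong (⊛-linearˡ _ _ α (λ β → p≈0 (0 ∷ β))) (+-cong
           (⊛-constantˡ p₁ _ α λ β ≢0 → p≈0 (1 ∷ β) (≢0 ∘ ℕ.suc-injective))
           (sum-zero a λ i → ⊛-zeroˡ _ _ α λ β → p≈0 (suc (suc (toℕ i)) ∷ β) λ ())) ⟩
    lower + (p₁ 0s * q (a ∷ α) + 0#) ≈⟨ +-congˡ (+-identityʳ _) ⟩
    lower + p₁ 0s * q (a ∷ α)        ≈⟨ +-comm _ _ ⟩
    p₁ 0s * q (a ∷ α) + lower        ∎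
    where
    p₀ = p ∘ (0 ∷_)
    p₁ = p ∘ (1 ∷_)
    rest = sum {a} λ i → ((p ∘ (suc (suc (toℕ i)) ∷_)) ⊛ (q ∘ ((a ℕ.∸ suc (toℕ i)) ∷_))) α
    lower = weightedLowerings (p₀ ∘ unitVector) (q ∘ (suc a ∷_)) α

  monomial : ∀ {n} → (Fin n → Carrier) → Vec ℕ n → Carrier
  monomial ℓ []      = 1#
  monomial ℓ (a ∷ α) = ℓ zero ^ a * monomial (ℓ ∘ suc) α

  monomial-cong : ∀ {n} {ℓ ℓ′ : Fin n → Carrier} → (∀ i → ℓ i ≈ ℓ′ i) → ∀ α → monomial ℓ α ≈ monomial ℓ′ α
  monomial-cong eq []      = ≈-refl
  monomial-cong eq (a ∷ α) = *-cong (^-congˡ a (eq zero)) (monomial-cong (eq ∘ suc) α)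

  -- Removing a variable and multiplying by its coefficient restores the monomial, so only the
  -- multiplicities change. The factor `b` holds the powers of the variables already passed.
  weightedLowerings-monomial : ∀ {n} (ℓ : Fin n → Carrier) m b α →
    weightedLowerings ℓ (λ β → m β · (b * monomial ℓ β)) α ≈ lowerings m α · (b * monomial ℓ α)
  weightedLowerings-monomial ℓ m b []         = ≈-refl
  weightedLowerings-monomial ℓ m b (zero ∷ α) = begin
    weightedLowerings ℓ′ (λ β → m (0 ∷ β) · (b * (1# * monomial ℓ′ β))) α
      ≈⟨ weightedLowerings-cong ℓ′ (λ β → ×-congʳ (m (0 ∷ β)) (≈-sym (*-assoc b 1# _))) α ⟩
    weightedLowerings ℓ′ (λ β → m (0 ∷ β) · (b * 1# * monomial ℓ′ β)) α
      ≈⟨ weightedLowerings-monomial ℓ′ (m ∘ (0 ∷_)) (b * 1#) α ⟩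
    k · (b * 1# * monomial ℓ′ α)   ≈⟨ ×-congʳ k (*-assoc b 1# _) ⟩
    k · (b * (1# * monomial ℓ′ α)) ∎
    where
    ℓ′ = ℓ ∘ suc
    k = lowerings (m ∘ (0 ∷_)) α
  weightedLowerings-monomial ℓ m b (suc a ∷ α) = begin
    x * (j · (b * (x ^ a * y))) + weightedLowerings ℓ′ (λ β → m (suc a ∷ β) · (b * (x ^ suc a * monomial ℓ′ β))) α
      ≈⟨ +-cong
           (≈-trans (×-comm-* j x _) (×-congʳ j (≈-trans (x∙yz≈y∙xz x b _) (*-congˡ (≈-sym (*-assoc x (x ^ a) y))))))
           (≈-trans (weightedLowerings-cong ℓ′ (λ β → ×-congʳ (m (suc a ∷ β)) (≈-sym (*-assoc b (x ^ suc a) _))) α)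
             (≈-trans (weightedLowerings-monomial ℓ′ (m ∘ (suc a ∷_)) (b * x ^ suc a) α)
               (×-congʳ k (*-assoc b (x ^ suc a) y)))) ⟩
    j · (b * (x ^ suc a * y)) + k · (b * (x ^ suc a * y)) ≈⟨ ×-homo-+ _ j k ⟨
    (j ℕ.+ k) · (b * (x ^ suc a * y)) ∎
    where
    ℓ′ = ℓ ∘ suc
    x = ℓ zero
    y = monomial ℓ′ α
    j = m (a ∷ α)
    k = lowerings (m ∘ (suc a ∷_)) α

  -- The multinomial theorem, by induction on `d` through Pascal's rule.
  linear-^ : ∀ {n} (p : Series n) → (∀ β → degree β ≢ 1 → p β ≈ 0#) →
             ∀ d α → (p ^ˢ d) α ≈ multinomial d α · monomial (p ∘ unitVector) α
  linear-^ p p≈0 zero α = constant (p ∘ unitVector) α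
    where
    constant : ∀ {n} (ℓ : Fin n → Carrier) α → one α ≈ multinomial zero α · monomial ℓ α
    constant ℓ []          = ≈-sym (+-identityʳ 1#)
    constant ℓ (zero ∷ α)  = ≈-trans (constant (ℓ ∘ suc) α) (×-congʳ (multinomial zero α) (≈-sym (*-identityˡ _)))
    constant ℓ (suc _ ∷ α) = ≈-refl
  linear-^ p p≈0 (suc d) α = begin
    (p ⊛ (p ^ˢ d)) α                  ≈⟨ ⊛-linearˡ p _ α p≈0 ⟩
    weightedLowerings ℓ (p ^ˢ d) α    ≈⟨ weightedLowerings-cong ℓ (λ β → ≈-trans (linear-^ p p≈0 d β)
                                          (×-congʳ (multinomial d β) (≈-sym (*-identityˡ _)))) α ⟩
    weightedLowerings ℓ (λ β → multinomial d β · (1# * monomial ℓ β)) α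
                                      ≈⟨ weightedLowerings-monomial ℓ (multinomial d) 1# α ⟩
    multinomial (suc d) α · (1# * monomial ℓ α) ≈⟨ ×-congʳ (multinomial (suc d) α) (*-identityˡ _) ⟩
    multinomial (suc d) α · monomial ℓ α        ∎
    where ℓ = p ∘ unitVector

  monomial-bump : ∀ {n} (ℓ : Fin n → Carrier) a j β → monomial ℓ (bump a j β) ≈ ℓ j ^ a * monomial ℓ β
  monomial-bump ℓ a zero    (b ∷ β) = ≈-trans (*-congʳ (^-homo-* (ℓ zero) a b)) (*-assoc _ _ _)
  monomial-bump ℓ a (suc j) (b ∷ β) = ≈-trans (*-congˡ (monomial-bump (ℓ ∘ suc) a j β)) (x∙yz≈y∙xz _ _ _)

  monomial-0s : ∀ n (ℓ : Fin n → Carrier) → monomial ℓ 0s ≈ 1#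
  monomial-0s zero    ℓ = ≈-refl
  monomial-0s (suc n) ℓ = ≈-trans (*-identityˡ _) (monomial-0s n (ℓ ∘ suc))

  monomial-push : ∀ {n n₀} (φ : Vec (Fin n₀) n) t (ℓ : Fin n₀ → Carrier) α →
    monomial (λ i → t * ℓ (Vec.lookup φ i)) α ≈ t ^ degree α * monomial ℓ (push φ α)
  monomial-push {n₀ = n₀} [] t ℓ [] = ≈-sym (≈-trans (*-identityˡ _) (monomial-0s n₀ ℓ))
  monomial-push (j ∷ φ) t ℓ (a ∷ α) = begin
    (t * ℓ j) ^ a * monomial (λ i → t * ℓ (Vec.lookup φ i)) α
      ≈⟨ *-cong (^-distrib-* t (ℓ j) a) (monomial-push φ t ℓ α) ⟩
    t ^ a * ℓ j ^ a * (t ^ degree α * monomial ℓ (push φ α))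
      ≈⟨ interchange _ _ _ _ ⟩
    t ^ a * t ^ degree α * (ℓ j ^ a * monomial ℓ (push φ α))
      ≈⟨ *-cong (^-homo-* t a (degree α)) (monomial-bump ℓ a j (push φ α)) ⟨
    t ^ (a ℕ.+ degree α) * monomial ℓ (bump a j (push φ α)) ∎

  push-0s : ∀ {n n₀} (φ : Vec (Fin n₀) n) → push φ 0s ≡ 0s
  push-0s []      = refl
  push-0s (j ∷ φ) = trans (bump-0 j (push φ 0s)) (push-0s φ)

  push-unitVector : ∀ {n n₀} (φ : Vec (Fin n₀) n) i → push φ (unitVector i) ≡ unitVector (Vec.lookup φ i)
  push-unitVector (j ∷ φ) zero    = cong (bump 1 j) (push-0s φ)
  push-unitVector (j ∷ φ) (suc i) = trans (bump-0 j _) (push-unitVector φ i)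

  -- By `push-unitVector` the coefficient of `x_i` is `t` times that of `y_{φ i}`, so on linear
  -- forms this is the substitution. In a d-th power the factor `t` becomes `t ^ d`.
  pullback : ∀ {n n₀} → Vec (Fin n₀) n → Carrier → Series n₀ → Series n
  pullback φ t p γ = t * p (push φ γ)

  pullback-linear : ∀ {n n₀} (φ : Vec (Fin n₀) n) t (p : Series n₀) →
    (∀ β → degree β ≢ 1 → p β ≈ 0#) → ∀ γ → degree γ ≢ 1 → pullback φ t p γ ≈ 0#
  pullback-linear φ t p p≈0 γ ≢1 = ≈-trans (*-congˡ (p≈0 (push φ γ) (≢1 ∘ trans (sym (degree-push φ γ))))) (zeroʳ t)

  pullback-^ : ∀ {n n₀} (φ : Vec (Fin n₀) n) t (p : Series n₀) → (∀ β → degree β ≢ 1 → p β ≈ 0#) →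
    ∀ d α → (pullback φ t p ^ˢ d) α ≈ multinomial d α · (t ^ degree α * monomial (p ∘ unitVector) (push φ α))
  pullback-^ φ t p p≈0 d α = ≈-trans (linear-^ (pullback φ t p) (pullback-linear φ t p p≈0) d α)
    (×-congʳ (multinomial d α) (≈-trans
      (monomial-cong (λ i → *-congˡ (reflexive (cong p (push-unitVector φ i)))) α)
      (monomial-push φ t (p ∘ unitVector) α)))

  ·-zeroʳ : ∀ m → m · 0# ≈ 0#
  ·-zeroʳ zero    = ≈-refl
  ·-zeroʳ (suc m) = ≈-trans (+-identityˡ _) (·-zeroʳ m)

  sum-·-* : ∀ {r} m b (x : Fin r → Carrier) → sum (λ j → m · (b * x j)) ≈ m · (b * sum x)
  sum-·-* {zero}  m b x = ≈-sym (≈-trans (×-congʳ m (zeroʳ b)) (·-zeroʳ m))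
  sum-·-* {suc r} m b x = begin
    m · (b * x zero) + sum (λ j → m · (b * x (suc j))) ≈⟨ +-congˡ (sum-·-* m b (x ∘ suc)) ⟩
    m · (b * x zero) + m · (b * sum (x ∘ suc))         ≈⟨ ×-distrib-+ _ _ m ⟨
    m · (b * x zero + b * sum (x ∘ suc))               ≈⟨ ×-congʳ m (distribˡ b _ _) ⟨
    m · (b * sum x)                                    ∎

  sum-splitAt : ∀ r {s} (f : Fin r ⊎ Fin s → Carrier) →
    sum (f ∘ splitAt r) ≈ sum (f ∘ inj₁) + sum (f ∘ inj₂)
  sum-splitAt zero    f = ≈-sym (+-identityˡ _)
  sum-splitAt (suc r) f = ≈-trans (+-congˡ (sum-splitAt r (f ∘ map₁ suc))) (≈-sym (+-assoc _ _ _))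

  ^-unique : ∀ t (h : ℕ → Carrier) → h 0 ≈ 1# → (∀ d → h (suc d) ≈ t * h d) → ∀ d → h d ≈ t ^ d
  ^-unique t h h₀ step zero    = h₀
  ^-unique t h h₀ step (suc d) = ≈-trans (step d) (*-congˡ (^-unique t h h₀ step d))

  -- Lets a zero coefficient at a non-squarefree `y^β` force the sum of monomial values itself to
  -- vanish, although the multinomials of `α` and `β` may differ.
  CharacteristicZero : Set (r₁ Level.⊔ r₂)
  CharacteristicZero = ∀ m z → 0 ℕ.< m → m · z ≈ 0# → z ≈ 0#

  -- Comparing the coefficients of x^α in (ℓ ∘ φ)^d and of y^β, β = push φ α, in ℓ^d: they are
  -- the same multiple of the monomial in the coefficients of ℓ, except for the multinomials.
  -- These agree if β is squarefree, and otherwise the coefficients of y^β cancel.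
  pullback-sumOfPowers : CharacteristicZero → ∀ {n n₀ d r} (p : Series n₀) (ℓ : Fin r → Series n₀) →
    (∀ j β → degree β ≢ 1 → ℓ j β ≈ 0#) → (∀ β → p β ≈ sum (λ j → (ℓ j ^ˢ d) β)) →
    (∀ β → degree β ≢ d → p β ≈ 0#) → (∀ β → ¬ SquareFree β → p β ≈ 0#) →
    ∀ t (φ : Vec (Fin n₀) n) α → t ^ d * p (push φ α) ≈ sum (λ j → (pullback φ t (ℓ j) ^ˢ d) α)
  pullback-sumOfPowers cancel {n} {n₀} {d} {r} p ℓ ℓ≈0 p≈ p≈0 vanish t φ α = ≈-trans matches (≈-sym expansion)
    where
    β = push φ α
    x : Fin r → Carrier
    x j = monomial (ℓ j ∘ unitVector) β
    expansion : sum (λ j → (pullback φ t (ℓ j) ^ˢ d) α) ≈ multinomial d α · (t ^ degree α * sum x)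
    expansion = ≈-trans (sum-cong-≋ (λ j → pullback-^ φ t (ℓ j) (ℓ≈0 j) d α))
      (sum-·-* (multinomial d α) (t ^ degree α) x)
    original : p β ≈ multinomial d β · sum x
    original = begin
      p β                                        ≈⟨ p≈ β ⟩
      sum (λ j → (ℓ j ^ˢ d) β)                   ≈⟨ sum-cong-≋ (λ j → ≈-trans (linear-^ (ℓ j) (ℓ≈0 j) d β)
                                                      (×-congʳ (multinomial d β) (≈-sym (*-identityˡ _)))) ⟩
      sum (λ j → multinomial d β · (1# * x j))   ≈⟨ sum-·-* (multinomial d β) 1# x ⟩
      multinomial d β · (1# * sum x)             ≈⟨ ×-congʳ (multinomial d β) (*-identityˡ _) ⟩
      multinomial d β · sum x                    ∎
    matches : t ^ d * p β ≈ multinomial d α · (t ^ degree α * sum x)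
    matches with degree α ℕ.≟ d
    ... | no ≢d = begin
      t ^ d * p β                                ≈⟨ *-congˡ (p≈0 β (≢d ∘ trans (sym (degree-push φ α)))) ⟩
      t ^ d * 0#                                 ≈⟨ zeroʳ _ ⟩
      0#                                         ≈⟨ ×-congˡ (multinomial-zero d α ≢d) ⟨
      multinomial d α · (t ^ degree α * sum x)   ∎
    ... | yes refl with squareFree? β
    ...   | yes sf = begin
      t ^ d * p β                                ≈⟨ *-congˡ original ⟩
      t ^ d * (multinomial d β · sum x)          ≈⟨ ×-comm-* (multinomial d β) _ _ ⟩
      multinomial d β · (t ^ d * sum x)          ≈⟨ ×-congˡ (trans (multinomial-squareFree d β sf (degree-push φ α))
                                                      (sym (multinomial-squareFree d α (squareFree-push⁻ φ α sf) refl))) ⟩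
      multinomial d α · (t ^ d * sum x)          ∎
    ...   | no ¬sf = begin
      t ^ d * p β                                ≈⟨ *-congˡ (vanish β ¬sf) ⟩
      t ^ d * 0#                                 ≈⟨ zeroʳ _ ⟩
      0#                                         ≈⟨ ·-zeroʳ (multinomial d α) ⟨
      multinomial d α · 0#                       ≈⟨ ×-congʳ (multinomial d α) (zeroʳ _) ⟨
      multinomial d α · (t ^ d * 0#)             ≈⟨ ×-congʳ (multinomial d α) (*-congˡ sum≈0) ⟨
      multinomial d α · (t ^ d * sum x)          ∎
      where
      sum≈0 : sum x ≈ 0#
      sum≈0 = cancel (multinomial d β) (sum x) (multinomial-positive d β (degree-push φ α))
        (≈-trans (≈-sym original) (vanish β ¬sf))

  -- Over `ℂ-ring` this unfolds to `SumOfPowers`; a general ring keeps real and imaginary parts out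
  -- of the algebra.
  PowerSum : ∀ {n d} → Form R n d → ℕ → Set (r₁ Level.⊔ r₂)
  PowerSum {n} {d} g r = Σ[ ℓ ∈ (Fin r → Form R n 1) ] (∀ α → coeff g α ≈ sum (λ j → (coeff (ℓ j) ^ˢ d) α))

  powerSum-pullback : CharacteristicZero → ∀ {n n₀ d r} (f : Form R n₀ d) (g : Form R n d) t s φ →
    s ≈ t ^ d → (∀ α → coeff g α ≈ s * coeff f (push φ α)) → (∀ β → ¬ SquareFree β → coeff f β ≈ 0#) →
    PowerSum f r → PowerSum g r
  powerSum-pullback cancel f g t s φ s≈ g≈ vanish (ℓ , f≈) =
    (λ j → record
      { coeff       = pullback φ t (coeff (ℓ j))
      ; homogeneous = pullback-linear φ t (coeff (ℓ j)) (homogeneous (ℓ j))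
      }) ,
    λ α → ≈-trans (g≈ α) (≈-trans (*-congʳ s≈)
      (pullback-sumOfPowers cancel (coeff f) (coeff ∘ ℓ) (homogeneous ∘ ℓ) f≈ (homogeneous f) vanish t φ α))

  powerSum-0 : ∀ {n d} (g : Form R n d) → (∀ α → coeff g α ≈ 0#) → PowerSum g 0
  powerSum-0 g g≈0 = (λ ()) , g≈0

  powerSum-+ : ∀ {n d r s} (f g h : Form R n d) → (∀ α → coeff h α ≈ coeff f α + coeff g α) →
    PowerSum f r → PowerSum g s → PowerSum h (r ℕ.+ s)
  powerSum-+ {n} {d} {r} {s} f g h h≈ (ℓ , f≈) (ℓ′ , g≈) = either ∘ splitAt r , λ α → ≈-trans (h≈ α) (≈-trans
    (+-cong (f≈ α) (g≈ α)) (≈-sym (sum-splitAt r (λ x → (coeff (either x) ^ˢ d) α))))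
    where
    either : Fin r ⊎ Fin s → Form R n 1
    either = [ ℓ , ℓ′ ]

-- Rational arithmetic and harmonic sums

module RationalLemmas where
  open import Data.Integer.Base using (+_)
  open import Data.Rational.Base
  open ℚ.≤-Reasoning
  open +-*-Solver using (solve; _:=_; _:+_; _:*_; _:-_; :-_; con)

  ι-+ : ∀ m n → ι (m ℕ.+ n) ≡ ι m + ι n
  ι-+ m n = sym (trans (frac-+ (ℚᵘ.mkℚᵘ (+ m) 0) (ℚᵘ.mkℚᵘ (+ n) 0))
    (cong (λ z → ℚ.fromℚᵘ (ℚᵘ.mkℚᵘ z 0)) (cong₂ ℤ._+_ (ℤ.*-identityʳ (+ m)) (ℤ.*-identityʳ (+ n)))))

  ι-* : ∀ m n → ι (m ℕ.* n) ≡ ι m * ι n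
  ι-* m n = sym (trans (frac-* (ℚᵘ.mkℚᵘ (+ m) 0) (ℚᵘ.mkℚᵘ (+ n) 0))
    (cong (λ z → ℚ.fromℚᵘ (ℚᵘ.mkℚᵘ z 0)) (sym (ℤ.pos-* m n))))

  ι-mono-≤ : ∀ {m n} → m ℕ.≤ n → ι m ≤ ι n
  ι-mono-≤ {m} {n} m≤n = frac-mono-≤ {ℚᵘ.mkℚᵘ (+ m) 0} {ℚᵘ.mkℚᵘ (+ n) 0}
    (ℚᵘ.*≤* (ℤ.*-monoʳ-≤-nonNeg (+ 1) (ℤ.+≤+ m≤n)))

  ι≥0 : ∀ n → 0ℚ ≤ ι n
  ι≥0 n = ι-mono-≤ (ℕ.z≤n {n})

  ι>0 : ∀ {n} → 0 ℕ.< n → 0ℚ < ι n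
  ι>0 {suc n} _ = ℚ.positive⁻¹ (ι (suc n)) {{ℚ.normalize-pos (suc n) 1}}

  ι*unit≡1 : ∀ n → ι (suc n) * unit n ≡ 1ℚ
  ι*unit≡1 n = trans (cong (λ t → ι (suc n) * unit t) (sym (ℕ.*-identityʳ n))) (ι*unit n 0)

  *-monoˡ : ∀ {p q} r → 0ℚ ≤ r → p ≤ q → r * p ≤ r * q
  *-monoˡ r r≥0 = ℚ.*-monoˡ-≤-nonNeg r {{nonNegative r≥0}}

  *-monoʳ : ∀ {p q} r → 0ℚ ≤ r → p ≤ q → p * r ≤ q * r
  *-monoʳ r r≥0 = ℚ.*-monoʳ-≤-nonNeg r {{nonNegative r≥0}}

  *-cancelˡ : ∀ {p q} r → 0ℚ < r → r * p ≤ r * q → p ≤ q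
  *-cancelˡ r r>0 = ℚ.*-cancelˡ-≤-pos r {{positive r>0}}

  *-nonNegative : ∀ {p q} → 0ℚ ≤ p → 0ℚ ≤ q → 0ℚ ≤ p * q
  *-nonNegative {p} {q} p≥0 q≥0 = subst (_≤ p * q) (ℚ.*-zeroʳ p) (*-monoˡ p p≥0 q≥0)

  square-mono : ∀ {p q} → 0ℚ ≤ p → p ≤ q → p * p ≤ q * q
  square-mono {p} {q} p≥0 p≤q = ℚ.≤-trans (*-monoˡ p p≥0 p≤q) (*-monoʳ q (ℚ.≤-trans p≥0 p≤q) p≤q)

  p≤p+q : ∀ p {q} → 0ℚ ≤ q → p ≤ p + q
  p≤p+q p {q} q≥0 = subst (_≤ p + q) (ℚ.+-identityʳ p) (ℚ.+-monoʳ-≤ p q≥0)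

  p<p+q : ∀ p {q} → 0ℚ < q → p < p + q
  p<p+q p {q} q>0 = subst (_< p + q) (ℚ.+-identityʳ p) (ℚ.+-monoʳ-< p q>0)

  infixr 8 _^ℚ_

  _^ℚ_ : ℚ → ℕ → ℚ
  p ^ℚ zero  = 1ℚ
  p ^ℚ suc n = p * p ^ℚ n

  ^ℚ>0 : ∀ {p} → 0ℚ < p → ∀ n → 0ℚ < p ^ℚ n
  ^ℚ>0 p>0 zero    = ℚ.positive⁻¹ 1ℚ
  ^ℚ>0 p>0 (suc n) = *>0 p>0 (^ℚ>0 p>0 n)

  ^ℚ-fraction : ∀ {p a b} → p * ι b ≡ ι a → ∀ n → p ^ℚ n * ι (b ℕ.^ n) ≡ ι (a ℕ.^ n)
  ^ℚ-fraction eq zero = refl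
  ^ℚ-fraction {p} {a} {b} eq (suc n) = begin-equality
    p * p ^ℚ n * ι (b ℕ.* b ℕ.^ n)       ≡⟨ cong (p * p ^ℚ n *_) (ι-* b (b ℕ.^ n)) ⟩
    p * p ^ℚ n * (ι b * ι (b ℕ.^ n))     ≡⟨ solve 4 (λ p q b c → p :* q :* (b :* c) := p :* b :* (q :* c)) refl p (p ^ℚ n) (ι b) (ι (b ℕ.^ n)) ⟩
    p * ι b * (p ^ℚ n * ι (b ℕ.^ n))     ≡⟨ cong₂ _*_ eq (^ℚ-fraction eq n) ⟩
    ι a * ι (a ℕ.^ n)                    ≡⟨ ι-* a (a ℕ.^ n) ⟨
    ι (a ℕ.* a ℕ.^ n)                    ∎

  harmonic-mono : ∀ l b → harmonic b ≤ harmonic (l ℕ.+ b)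
  harmonic-mono zero    b = ℚ.≤-refl
  harmonic-mono (suc l) b = ℚ.≤-trans (harmonic-mono l b) (p≤p+q _ (ℚ.<⇒≤ (unit>0 (l ℕ.+ b))))

  -- Oresme's argument: each of the `b + 1` terms following `1/(b + 1)` is at least `1/(2b + 2)`.
  harmonic-double : ∀ b → harmonic (suc b) + ½ ≤ harmonic (suc b ℕ.+ suc b)
  harmonic-double b = subst (λ t → harmonic (suc b) + t ≤ harmonic (suc b ℕ.+ suc b)) (ι*unit b 1)
    (block-≥ (unit (1 ℕ.+ b ℕ.* 2)) (suc b) (suc b) λ i i<suc-b → unit-anti (ℕ.≤-trans
      (ℕ.+-monoˡ-≤ (suc b) (ℕ.≤-pred i<suc-b)) (ℕ.≤-reflexive (twice b))))
    where
    twice : ∀ b → b ℕ.+ suc b ≡ 1 ℕ.+ b ℕ.* 2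
    twice b = trans (ℕ.+-suc b b) (cong suc (trans (cong (b ℕ.+_) (sym (ℕ.+-identityʳ b))) (ℕ.*-comm 2 b)))

  harmonic-2^ : ∀ L M .{{_ : ℕ.NonZero M}} → harmonic M + ι L * ½ ≤ harmonic (2 ℕ.^ L ℕ.* M)
  harmonic-2^ zero    M = ℚ.≤-reflexive (trans (cong (λ t → harmonic M + t) (ℚ.*-zeroˡ ½))
    (trans (ℚ.+-identityʳ (harmonic M)) (cong harmonic (sym (ℕ.*-identityˡ M)))))
  harmonic-2^ (suc L) M = begin
    harmonic M + ι (suc L) * ½       ≡⟨ cong (λ t → harmonic M + t) (ι-suc-* L ½) ⟩
    harmonic M + (½ + ι L * ½)       ≡⟨ solve 3 (λ h a b → h :+ (a :+ b) := h :+ b :+ a) refl (harmonic M) ½ (ι L * ½) ⟩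
    harmonic M + ι L * ½ + ½         ≤⟨ ℚ.+-monoˡ-≤ ½ (harmonic-2^ L M) ⟩
    harmonic (2 ℕ.^ L ℕ.* M) + ½     ≤⟨ double (2 ℕ.^ L ℕ.* M) {{ℕ.m*n≢0 _ _ {{ℕ.m^n≢0 2 L}}}} ⟩
    harmonic (2 ℕ.^ L ℕ.* M ℕ.+ 2 ℕ.^ L ℕ.* M) ≡⟨ cong harmonic (trans (cong (2 ℕ.^ L ℕ.* M ℕ.+_) (sym (ℕ.+-identityʳ _))) (sym (ℕ.*-assoc 2 (2 ℕ.^ L) M))) ⟩
    harmonic (2 ℕ.^ suc L ℕ.* M)     ∎
    where
    double : ∀ b .{{_ : ℕ.NonZero b}} → harmonic b + ½ ≤ harmonic (b ℕ.+ b)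
    double (suc b) = harmonic-double b

  -- Every approximation to `log n` is a harmonic sum over a range containing `L` doublings, each
  -- worth at least 1/2. This exchanges the binary for the natural logarithm at the cost of a factor
  -- 2.
  log₂≤2log : ∀ n L → 2 ℕ.^ L ℕ.≤ n → ∀ j → ι L ≤ ι 2 * seq (log n) j
  log₂≤2log zero    L le j = contradiction (ℕ.m^n>0 2 L) (ℕ.≤⇒≯ le)
  log₂≤2log (suc n) L le j = begin
    ι L                              ≡⟨ solve 2 (λ h l → l := con (ι 2) :* ((h :+ l :* con ½) :- h)) refl (harmonic M) (ι L) ⟩
    ι 2 * (harmonic M + ι L * ½ - harmonic M) ≤⟨ *-monoˡ (ι 2) (ι≥0 2) (ℚ.+-monoˡ-≤ (- harmonic M) bound) ⟩
    ι 2 * (harmonic (suc n ℕ.* M) - harmonic M) ∎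
    where
    M = suc j
    bound : harmonic M + ι L * ½ ≤ harmonic (suc n ℕ.* M)
    bound = ℚ.≤-trans (harmonic-2^ L M) (subst (λ t → harmonic (2 ℕ.^ L ℕ.* M) ≤ harmonic t)
      (ℕ.m∸n+n≡m (ℕ.*-monoˡ-≤ M le)) (harmonic-mono (suc n ℕ.* M ℕ.∸ 2 ℕ.^ L ℕ.* M) _))

open import Defs

-- Order, zero and reciprocals of real numbers

module RealLemmas where
  open RationalLemmas
  open +-*-Solver using (solve; _:=_; _:+_; _:*_; _:-_; :-_)

  eventually-≤ : ∀ {x y} → Eventually (λ n → seq x n ℚ.≤ seq y n) → x ≤ y
  eventually-≤ {x} {y} le = ≤-by λ e e>0 → map (λ n l → ℚ.≤-<-trans l (p<p+q (seq y n) e>0)) le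

  ≈⇒≤ : ∀ {x y} → x ≈ y → x ≤ y
  ≈⇒≤ {x} {y} (≈-by p) = ≤-by λ e e>0 → map (λ n c → close⇒< {p = seq x n} {seq y n} c) (p e e>0)

  ≤-trans : ∀ {x y z} → x ≤ y → y ≤ z → x ≤ z
  ≤-trans {x} {y} {z} (≤-by p) (≤-by q) = ≤-by λ e e>0 → both
    (λ n l l′ → ℚ.<-trans l (subst (seq y n ℚ.+ ½ ℚ.* e ℚ.<_)
      (trans (ℚ.+-assoc (seq z n) _ _) (cong (seq z n ℚ.+_) (half+half e)))
      (ℚ.+-monoˡ-< (½ ℚ.* e) l′)))
    (p (½ ℚ.* e) (half>0 e>0)) (q (½ ℚ.* e) (half>0 e>0))

  +-mono-≤ : ∀ {x y u v} → x ≤ y → u ≤ v → x + u ≤ y + v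
  +-mono-≤ {x} {y} {u} {v} (≤-by p) (≤-by q) = ≤-by λ e e>0 → both
    (λ n l l′ → subst (seq x n ℚ.+ seq u n ℚ.<_)
      (trans (solve 3 (λ y v h → (y :+ h) :+ (v :+ h) := (y :+ v) :+ (h :+ h)) refl (seq y n) (seq v n) (½ ℚ.* e))
        (cong (seq y n ℚ.+ seq v n ℚ.+_) (half+half e)))
      (ℚ.+-mono-< l l′))
    (p (½ ℚ.* e) (half>0 e>0)) (q (½ ℚ.* e) (half>0 e>0))

  fromℚ-*-monoˡ-≤ : ∀ {σ x y} → 0ℚ ℚ.< σ → x ≤ y → fromℚ σ * x ≤ fromℚ σ * y
  fromℚ-*-monoˡ-≤ {σ} {x} {y} σ>0 (≤-by p) = ≤-by λ e e>0 → map
    (λ n l → subst (σ ℚ.* seq x n ℚ.<_)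
      (trans (ℚ.*-distribˡ-+ σ (seq y n) _) (cong (σ ℚ.* seq y n ℚ.+_)
        (trans (solve 3 (λ s i e → s :* (i :* e) := (s :* i) :* e) refl σ 1/σ e)
          (trans (cong (ℚ._* e) (ℚ.*-inverseʳ σ {{ℚ.>-nonZero σ>0}})) (ℚ.*-identityˡ e)))))
      (ℚ.*-monoʳ-<-pos σ {{ℚ.positive σ>0}} l))
    (p (1/σ ℚ.* e) (*>0 (1/>0 σ>0) e>0))
    where
    1/σ = (ℚ.1/ σ) {{ℚ.>-nonZero σ>0}}

  -- The index `N` comes from the Cauchy modulus of `x`, not from the doubly negated hypothesis, and
  -- what remains is a decidable comparison of rationals. Since `𝔈` describes the support by negated
  -- equalities, this is how coefficients are shown to vanish.
  ≈0-stable : ∀ {x} → ¬ ¬ x ≈ 0ℝ → x ≈ 0ℝ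
  ≈0-stable {x} ¬¬x≈0 = ≈-by close
    where
    close : ∀ e → 0ℚ ℚ.< e → Eventually λ n → Close e (seq x n) 0ℚ
    close e e>0 with cauchy x (½ ℚ.* e) (half>0 e>0)
    ... | N , c = N , λ n N≤n → decidable-stable (ℚ.∣ seq x n ℚ.- 0ℚ ∣ ℚ.<? e) λ ¬c →
      ¬¬x≈0 λ x≈0 → let (M , d) = ≈-eventually x≈0 (½ ℚ.* e) (half>0 e>0) in
        ¬c (subst (λ t → Close t (seq x n) 0ℚ) (half+half e)
          (close-trans {½ ℚ.* e} {½ ℚ.* e} {seq x n} {seq x (N ℕ.⊔ M)} {0ℚ}
            (c n (N ℕ.⊔ M) N≤n (ℕ.m≤m⊔n N M)) (d (N ℕ.⊔ M) (ℕ.m≤n⊔m N M))))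

  0<⇒≉0 : ∀ {x y} → 0ℝ < x → x ≤ y → ¬ y ≈ 0ℝ
  0<⇒≉0 {x} {y} (<-by g g>0 (N , lt)) (≤-by le) (≈-by eq) =
    let (M , l) = le (½ ℚ.* g) (half>0 g>0)
        (K , c) = eq (½ ℚ.* g) (half>0 g>0)
        n = N ℕ.⊔ (M ℕ.⊔ K)
        N≤n = ℕ.m≤m⊔n N (M ℕ.⊔ K)
        M≤n = ℕ.≤-trans (ℕ.m≤m⊔n M K) (ℕ.m≤n⊔m N (M ℕ.⊔ K))
        K≤n = ℕ.≤-trans (ℕ.m≤n⊔m M K) (ℕ.m≤n⊔m N (M ℕ.⊔ K))
    in ℚ.<-irrefl refl (ℚ.<-trans (lt n N≤n) (ℚ.<-trans (l n M≤n)
         (subst (seq y n ℚ.+ ½ ℚ.* g ℚ.<_)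
           (trans (ℚ.+-assoc 0ℚ (½ ℚ.* g) _) (cong (0ℚ ℚ.+_) (half+half g)))
           (ℚ.+-monoˡ-< (½ ℚ.* g) (close⇒< {p = seq y n} {0ℚ} (c n K≤n))))))

  -- From the index `N` on, the inverse is exact term by term, so estimates with quotients reduce to
  -- rationals at one index.
  reciprocal : ∀ x (x>0 : 0ℝ < x) →
    Eventually λ n → 0ℚ ℚ.< seq (x ⁻¹[ x>0 ]) n × seq (x ⁻¹[ x>0 ]) n ℚ.* seq x n ≡ 1ℚ
  reciprocal x x>0@(<-by g g>0 (N , lt)) = N , λ n N≤n →
    1/>0 (term>0 n) , trans (cong (λ k → recip n ℚ.* seq x k) (sym (ℕ.m≤n⇒m⊔n≡n N≤n)))
      (ℚ.*-inverseˡ (seq x (N ℕ.⊔ n)) {{ℚ.>-nonZero (term>0 n)}})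
    where
    term>0 : ∀ n → 0ℚ ℚ.< seq x (N ℕ.⊔ n)
    term>0 n = ℚ.<-trans g>0 (subst (ℚ._< seq x (N ℕ.⊔ n)) (ℚ.+-identityˡ g) (lt (N ℕ.⊔ n) (ℕ.m≤m⊔n N n)))
    recip : ℕ → ℚ
    recip n = (ℚ.1/ seq x (N ℕ.⊔ n)) {{ℚ.>-nonZero (term>0 n)}}

  <⇒eventually-< : ∀ {x y} → x < y → Eventually λ n → seq x n ℚ.< seq y n
  <⇒eventually-< {x} {y} (<-by g g>0 lt) = map (λ n l → ℚ.<-trans (p<p+q (seq x n) g>0) l) lt

-- The parameter δ and its scale

module Delta where
  open RationalLemmas
  open RealLemmas
  open PowerInequalities
  open ℚ.≤-Reasoning
  open +-*-Solver using (solve; _:=_; _:+_; _:*_; _:-_; :-_; con)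

  -- The facts about δ at one index, with the denominators of its two quotients cleared. The field
  -- `≤2` reflects `(1 + ε) / (1 + ε₀) < 2` and serves to bound `k` from below.
  record At (D e₀ e : ℚ) : Set where
    field
      plus  : D ℚ.* (1ℚ ℚ.+ e₀) ℚ.≤ 1ℚ ℚ.+ e
      minus : D ℚ.* (1ℚ ℚ.- e) ℚ.≤ 1ℚ ℚ.- e₀
      1+e₀≥0 : 0ℚ ℚ.≤ 1ℚ ℚ.+ e₀
      1-e≥0 : 0ℚ ℚ.≤ 1ℚ ℚ.- e
      ≤2    : D ℚ.≤ ι 2

  at : ∀ {D e₀ e r s} → 0ℚ ℚ.< e₀ → e ℚ.< 1ℚ → 0ℚ ℚ.< 1ℚ ℚ.- e →
       0ℚ ℚ.< r → r ℚ.* (1ℚ ℚ.+ e₀) ≡ 1ℚ → s ℚ.* (1ℚ ℚ.- e) ≡ 1ℚ →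
       D ℚ.≤ (1ℚ ℚ.+ e) ℚ.* r → D ℚ.≤ (1ℚ ℚ.- e₀) ℚ.* s → At D e₀ e
  at {D} {e₀} {e} {r} {s} e₀>0 e<1 1-e>0 r>0 r≡ s≡ D≤a D≤b = record
    { plus = begin
        D ℚ.* (1ℚ ℚ.+ e₀)                ≤⟨ *-monoʳ (1ℚ ℚ.+ e₀) (ℚ.<⇒≤ 1+e₀>0) D≤a ⟩
        (1ℚ ℚ.+ e) ℚ.* r ℚ.* (1ℚ ℚ.+ e₀) ≡⟨ cancel (1ℚ ℚ.+ e) r (1ℚ ℚ.+ e₀) r≡ ⟩
        1ℚ ℚ.+ e ∎
    ; minus = begin
        D ℚ.* (1ℚ ℚ.- e)                 ≤⟨ *-monoʳ (1ℚ ℚ.- e) (ℚ.<⇒≤ 1-e>0) D≤b ⟩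
        (1ℚ ℚ.- e₀) ℚ.* s ℚ.* (1ℚ ℚ.- e) ≡⟨ cancel (1ℚ ℚ.- e₀) s (1ℚ ℚ.- e) s≡ ⟩
        1ℚ ℚ.- e₀ ∎
    ; 1+e₀≥0 = ℚ.<⇒≤ 1+e₀>0
    ; 1-e≥0 = ℚ.<⇒≤ 1-e>0
    ; ≤2 = begin
        D                              ≤⟨ D≤a ⟩
        (1ℚ ℚ.+ e) ℚ.* r               ≤⟨ *-monoʳ r (ℚ.<⇒≤ r>0) (ℚ.+-monoʳ-≤ 1ℚ (ℚ.<⇒≤ e<1)) ⟩
        ι 2 ℚ.* r                      ≤⟨ p≤p+q (ι 2 ℚ.* r) (*-nonNegative (*-nonNegative (ι≥0 2) (ℚ.<⇒≤ r>0)) (ℚ.<⇒≤ e₀>0)) ⟩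
        ι 2 ℚ.* r ℚ.+ ι 2 ℚ.* r ℚ.* e₀ ≡⟨ solve 2 (λ r e → con (ι 2) :* r :+ con (ι 2) :* r :* e := con (ι 2) :* r :* (con 1ℚ :+ e)) refl r e₀ ⟩
        ι 2 ℚ.* r ℚ.* (1ℚ ℚ.+ e₀)      ≡⟨ cancel (ι 2) r (1ℚ ℚ.+ e₀) r≡ ⟩
        ι 2                            ∎
    }
    where
    1+e₀>0 = ℚ.+-mono-< (ℚ.positive⁻¹ 1ℚ) e₀>0
    cancel : ∀ p q t → q ℚ.* t ≡ 1ℚ → p ℚ.* q ℚ.* t ≡ p
    cancel p q t eq = trans (ℚ.*-assoc p q t) (trans (cong (p ℚ.*_) eq) (ℚ.*-identityʳ p))

  module _ {ε₀ ε : ℝ} (0<ε₀ : 0ℝ < ε₀) (ε₀<ε : ε₀ < ε) (ε<1 : ε < 1ℝ) where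

    δ-eventually : Eventually λ n → At (seq (δ 0<ε₀ ε₀<ε ε<1) n) (seq ε₀ n) (seq ε n)
    δ-eventually = both (λ n (e₀>0 , e<1 , 1-e>0) ((r>0 , r≡) , (s>0 , s≡)) →
        at e₀>0 e<1 1-e>0 r>0 r≡ s≡ (ℚ.p⊓q≤p (seq a n) (seq b n)) (ℚ.p⊓q≤q (seq a n) (seq b n)))
      (both (λ _ p q → p , q) (<⇒eventually-< 0<ε₀) (both (λ _ p q → p , q) (<⇒eventually-< ε<1) (<⇒eventually-< 0<1-ε)))
      (both (λ _ p q → p , q) (reciprocal (1ℝ + ε₀) 0<1+ε₀) (reciprocal (1ℝ - ε) 0<1-ε))
      where
      0<1+ε₀ = 1+ε₀>0 0<ε₀ ε₀<ε ε<1
      0<1-ε = 1-ε>0 0<ε₀ ε₀<ε ε<1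
      a = (1ℝ + ε) ÷ (1ℝ + ε₀) [ 0<1+ε₀ ]
      b = (1ℝ - ε₀) ÷ (1ℝ - ε) [ 0<1-ε ]

  -- Here `suc j` is the ceiling of `10 / q`. As `q ≤ 1`, it is at least 10; what
  -- `scaled-hits-lower` asks for is only 4.
  scale-factor : ∀ {q} → 0ℚ ℚ.< q → q ℚ.≤ 1ℚ → ∃[ j ] 3 ℕ.≤ j × ι j ℚ.* q ℚ.< ι 10 × ι 10 ℚ.≤ ι (suc j) ℚ.* q
  scale-factor {q} q>0 q≤1 = found (crossing (λ j → ι j ℚ.* q ℚ.<? ι 10) 0 (10 ℕ.* suc D)
      (subst (ℚ._< ι 10) (sym (ℚ.*-zeroˡ q)) (ι>0 {10} ℕ.z<s)) large)
    where
    D = ℚ.ℚ.denominator-1 q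
    large : ¬ ι (10 ℕ.* suc D ℕ.+ 0) ℚ.* q ℚ.< ι 10
    large lt = ℚ.<-irrefl refl (ℚ.<-≤-trans lt (begin
      ι 10                              ≡⟨ ℚ.*-identityʳ (ι 10) ⟨
      ι 10 ℚ.* 1ℚ                       ≡⟨ cong (ι 10 ℚ.*_) (ι*unit≡1 D) ⟨
      ι 10 ℚ.* (ι (suc D) ℚ.* unit D)   ≤⟨ *-monoˡ (ι 10) (ι≥0 10) (*-monoˡ (ι (suc D)) (ι≥0 (suc D)) (unit≤ q>0)) ⟩
      ι 10 ℚ.* (ι (suc D) ℚ.* q)        ≡⟨ ℚ.*-assoc (ι 10) (ι (suc D)) q ⟨
      ι 10 ℚ.* ι (suc D) ℚ.* q          ≡⟨ cong (ℚ._* q) (ι-* 10 (suc D)) ⟨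
      ι (10 ℕ.* suc D) ℚ.* q            ≡⟨ cong (λ t → ι t ℚ.* q) (ℕ.+-identityʳ (10 ℕ.* suc D)) ⟨
      ι (10 ℕ.* suc D ℕ.+ 0) ℚ.* q      ∎))
    10≰3 : ¬ ι 10 ℚ.≤ ι 3
    10≰3 = toWitnessFalse {a? = ι 10 ℚ.≤? ι 3} _
    found : ∃[ j ] 0 ℕ.≤ j × ι j ℚ.* q ℚ.< ι 10 × ¬ ι (suc j) ℚ.* q ℚ.< ι 10 →
            ∃[ j ] 3 ℕ.≤ j × ι j ℚ.* q ℚ.< ι 10 × ι 10 ℚ.≤ ι (suc j) ℚ.* q
    found (j , _ , below , ¬above) = j , ℕ.≮⇒≥ (λ j<3 → 10≰3 (begin
      ι 10             ≤⟨ ℚ.≮⇒≥ ¬above ⟩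
      ι (suc j) ℚ.* q  ≤⟨ *-monoˡ (ι (suc j)) (ι≥0 (suc j)) q≤1 ⟩
      ι (suc j) ℚ.* 1ℚ ≡⟨ ℚ.*-identityʳ (ι (suc j)) ⟩
      ι (suc j)        ≤⟨ ι-mono-≤ j<3 ⟩
      ι 3              ∎)) , below , ℚ.≮⇒≥ ¬above

  scaled-lower : ∀ {k p q g} → 0ℚ ℚ.≤ k → g ℚ.≤ q → q ℚ.≤ p ℚ.+ ½ ℚ.* g → ι 10 ℚ.≤ k ℚ.* q → ι 5 ℚ.≤ k ℚ.* p
  scaled-lower {k} {p} {q} {g} k≥0 g≤q q≤p+½g 10≤kq = begin
    ½ ℚ.* ι 10                      ≤⟨ *-monoˡ ½ ½≥0 10≤kq ⟩
    ½ ℚ.* (k ℚ.* q)                 ≡⟨ solve 2 (λ k q → con ½ :* (k :* q) := k :* (q :- con ½ :* q)) refl k q ⟩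
    k ℚ.* (q ℚ.- ½ ℚ.* q)           ≤⟨ *-monoˡ k k≥0 (ℚ.+-mono-≤ q≤p+½g (ℚ.neg-antimono-≤ (*-monoˡ ½ ½≥0 g≤q))) ⟩
    k ℚ.* (p ℚ.+ ½ ℚ.* g ℚ.- ½ ℚ.* g) ≡⟨ cong (k ℚ.*_) (solve 2 (λ p h → p :+ h :- h := p) refl p (½ ℚ.* g)) ⟩
    k ℚ.* p                         ∎
    where ½≥0 = ℚ.<⇒≤ (ℚ.positive⁻¹ ½)

  scaled-upper : ∀ {j k p q g} → 0ℚ ℚ.≤ k → g ℚ.≤ q → p ℚ.≤ q ℚ.+ ½ ℚ.* g → q ℚ.≤ 1ℚ →
    k ℚ.* q ≡ q ℚ.+ j ℚ.* q → j ℚ.* q ℚ.≤ ι 10 → k ℚ.* p ℚ.≤ ι 17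
  scaled-upper {j} {k} {p} {q} {g} k≥0 g≤q p≤q+½g q≤1 kq≡q+jq jq≤10 = begin
    k ℚ.* p                          ≤⟨ *-monoˡ k k≥0 (ℚ.≤-trans p≤q+½g (ℚ.+-monoʳ-≤ q (*-monoˡ ½ (ℚ.<⇒≤ (ℚ.positive⁻¹ ½)) g≤q))) ⟩
    k ℚ.* (q ℚ.+ ½ ℚ.* q)            ≡⟨ solve 2 (λ k q → k :* (q :+ con ½ :* q) := (con 1ℚ :+ con ½) :* (k :* q)) refl k q ⟩
    (1ℚ ℚ.+ ½) ℚ.* (k ℚ.* q)         ≡⟨ cong ((1ℚ ℚ.+ ½) ℚ.*_) kq≡q+jq ⟩
    (1ℚ ℚ.+ ½) ℚ.* (q ℚ.+ j ℚ.* q)   ≤⟨ *-monoˡ (1ℚ ℚ.+ ½) (ℚ.<⇒≤ (ℚ.positive⁻¹ (1ℚ ℚ.+ ½))) (ℚ.+-mono-≤ q≤1 jq≤10) ⟩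
    (1ℚ ℚ.+ ½) ℚ.* (1ℚ ℚ.+ ι 10)     ≤⟨ toWitness {a? = (1ℚ ℚ.+ ½) ℚ.* (1ℚ ℚ.+ ι 10) ℚ.≤? ι 17} _ ⟩
    ι 17                             ∎

  -- One approximation `q` to `x - 1` fixes `k`; later ones differ from it by at most `½ * g` with
  -- `g < q`, so they lie between `q / 2` and `3q / 2`. Thus `10 ≤ k * q ≤ 11` becomes the range
  -- from 5 to 16.5, rounded up to 17.
  scale : ∀ {x} → 1ℝ < x → Eventually (λ n → seq x n ℚ.≤ ι 2) →
    ∃[ c ] Eventually λ n → ι 5 ℚ.≤ ι (4 ℕ.+ c) ℚ.* (seq x n ℚ.- 1ℚ) × ι (4 ℕ.+ c) ℚ.* (seq x n ℚ.- 1ℚ) ℚ.≤ ι 17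
  scale {x} (<-by g g>0 (N , lt)) (K , ≤2) = go (cauchy x (½ ℚ.* g) (half>0 g>0))
    where
    shift : ∀ y z h → y ℚ.≤ z ℚ.+ h → y ℚ.- 1ℚ ℚ.≤ z ℚ.- 1ℚ ℚ.+ h
    shift y z h le = subst (y ℚ.- 1ℚ ℚ.≤_) (solve 2 (λ z h → z :+ h :- con 1ℚ := z :- con 1ℚ :+ h) refl z h)
      (ℚ.+-monoˡ-≤ (ℚ.- 1ℚ) le)
    go : ∃[ M ] (∀ m n → M ℕ.≤ m → M ℕ.≤ n → Close (½ ℚ.* g) (seq x m) (seq x n)) →
      ∃[ c ] Eventually λ n → ι 5 ℚ.≤ ι (4 ℕ.+ c) ℚ.* (seq x n ℚ.- 1ℚ) × ι (4 ℕ.+ c) ℚ.* (seq x n ℚ.- 1ℚ) ℚ.≤ ι 17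
    go (M , close) = result (scale-factor (ℚ.<-trans g>0 g<q) q≤1)
      where
      n₁ = N ℕ.⊔ (M ℕ.⊔ K)
      N≤n₁ = ℕ.m≤m⊔n N (M ℕ.⊔ K)
      M≤n₁ = ℕ.≤-trans (ℕ.m≤m⊔n M K) (ℕ.m≤n⊔m N (M ℕ.⊔ K))
      K≤n₁ = ℕ.≤-trans (ℕ.m≤n⊔m M K) (ℕ.m≤n⊔m N (M ℕ.⊔ K))
      q = seq x n₁ ℚ.- 1ℚ
      g<q : g ℚ.< q
      g<q = subst (ℚ._< q) (solve 1 (λ g → con 1ℚ :+ g :- con 1ℚ := g) refl g) (ℚ.+-monoˡ-< (ℚ.- 1ℚ) (lt n₁ N≤n₁))
      q≤1 : q ℚ.≤ 1ℚ
      q≤1 = ℚ.+-monoˡ-≤ (ℚ.- 1ℚ) (≤2 n₁ K≤n₁)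
      result : ∃[ j ] 3 ℕ.≤ j × ι j ℚ.* q ℚ.< ι 10 × ι 10 ℚ.≤ ι (suc j) ℚ.* q →
        ∃[ c ] Eventually λ n → ι 5 ℚ.≤ ι (4 ℕ.+ c) ℚ.* (seq x n ℚ.- 1ℚ) × ι (4 ℕ.+ c) ℚ.* (seq x n ℚ.- 1ℚ) ℚ.≤ ι 17
      result (suc (suc (suc c)) , _ , jq<10 , 10≤kq) = c , n₁ , λ n n₁≤n → let M≤n = ℕ.≤-trans M≤n₁ n₁≤n in
          scaled-lower (ι≥0 (4 ℕ.+ c)) (ℚ.<⇒≤ g<q)
            (shift (seq x n₁) (seq x n) (½ ℚ.* g) (ℚ.<⇒≤ (close⇒< {p = seq x n₁} {seq x n} (close n₁ n M≤n₁ M≤n)))) 10≤kq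
        , scaled-upper {ι (3 ℕ.+ c)} (ι≥0 (4 ℕ.+ c)) (ℚ.<⇒≤ g<q)
            (shift (seq x n) (seq x n₁) (½ ℚ.* g) (ℚ.<⇒≤ (close⇒< {p = seq x n} {seq x n₁} (close n n₁ M≤n M≤n₁))))
            q≤1 (ι-suc-* (3 ℕ.+ c) q) (ℚ.<⇒≤ jq<10)
      result (suc zero , ℕ.s≤s () , _)
      result (suc (suc zero) , ℕ.s≤s (ℕ.s≤s ()) , _)

-- Substituted forms and their sums

module Forms where
  open RationalLemmas
  open RealLemmas
  open ExponentVectors
  open Multinomial
  open PowersOfLinearForms ℂ-ring using (_·_; _^_; ^-unique; powerSum-pullback; powerSum-0; powerSum-+)

  scaled≈0⇒≈0 : ∀ {x y} m → 0 ℕ.< m → (∀ k → seq x k ≡ ι m ℚ.* seq y k) → x ≈ 0ℝ → y ≈ 0ℝ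
  scaled≈0⇒≈0 {x} {y} m 0<m eq (≈-by x≈0) = ≈-by λ e e>0 → map
    (λ k c → ℚ.≤-<-trans (smaller (seq y k)) (subst (λ t → ℚ.∣ t ∣ ℚ.< e) (trans (ℚ.+-identityʳ _) (eq k)) c))
    (x≈0 e e>0)
    where
    smaller : ∀ q → ℚ.∣ q ℚ.- 0ℚ ∣ ℚ.≤ ℚ.∣ ι m ℚ.* q ∣
    smaller q = subst₂ ℚ._≤_
      (trans (ℚ.*-identityˡ ℚ.∣ q ∣) (cong ℚ.∣_∣ (sym (ℚ.+-identityʳ q))))
      (sym (trans (ℚ.∣p*q∣≡∣p∣*∣q∣ (ι m) q) (cong (ℚ._* ℚ.∣ q ∣) (ℚ.0≤p⇒∣p∣≡p (ι≥0 m)))))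
      (*-monoʳ ℚ.∣ q ∣ (ℚ.0≤∣p∣ q) (ι-mono-≤ {1} {m} 0<m))

  ·-cancel-0 : ∀ m z → 0 ℕ.< m → m · z ≈ᶜ 0ᶜ → z ≈ᶜ 0ᶜ
  ·-cancel-0 m z 0<m (p ,ᶜ q) = scaled≈0⇒≈0 m 0<m (re-· m) p ,ᶜ scaled≈0⇒≈0 m 0<m (im-· m) q
    where
    re-· : ∀ m k → seq (re (m · z)) k ≡ ι m ℚ.* seq (re z) k
    re-· zero    k = sym (ℚ.*-zeroˡ (seq (re z) k))
    re-· (suc m) k = trans (cong (seq (re z) k ℚ.+_) (re-· m k)) (sym (ι-suc-* m (seq (re z) k)))
    im-· : ∀ m k → seq (im (m · z)) k ≡ ι m ℚ.* seq (im z) k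
    im-· zero    k = sym (ℚ.*-zeroˡ (seq (im z) k))
    im-· (suc m) k = trans (cong (seq (im z) k ℚ.+_) (im-· m k)) (sym (ι-suc-* m (seq (im z) k)))

  ofReal-cong : ∀ {x y} → x ≈ y → ofReal x ≈ᶜ ofReal y
  ofReal-cong p = p ,ᶜ ≈-refl

  real-part : ∀ a b → a ℚ.* b ≡ a ℚ.* b ℚ.- 0ℚ ℚ.* 0ℚ
  real-part = solve 2 (λ a b → a :* b := a :* b :- con 0ℚ :* con 0ℚ) refl
    where open +-*-Solver using (solve; _:=_; _:*_; _:-_; con)

  imaginary-part : ∀ a b → 0ℚ ≡ a ℚ.* 0ℚ ℚ.+ 0ℚ ℚ.* b
  imaginary-part = solve 2 (λ a b → con 0ℚ := a :* con 0ℚ :+ con 0ℚ :* b) refl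
    where open +-*-Solver using (solve; _:=_; _:+_; _:*_; con)

  ofReal-^ : ∀ τ d → ofReal (fromℚ (τ ^ℚ d)) ≈ᶜ ofReal (fromℚ τ) ^ d
  ofReal-^ τ = ^-unique (ofReal (fromℚ τ)) (λ d → ofReal (fromℚ (τ ^ℚ d))) (pointwise (λ _ → refl) ,ᶜ pointwise (λ _ → refl))
    (λ d → pointwise (λ _ → real-part τ (τ ^ℚ d)) ,ᶜ pointwise (λ _ → imaginary-part τ (τ ^ℚ d)))

  fromℚ-*-≈0 : ∀ σ x → x ≈ 0ℝ → fromℚ σ * x ≈ 0ℝ
  fromℚ-*-≈0 σ x x≈0 = ≈-trans (*-cong {fromℚ σ} {fromℚ σ} {x} {0ℝ} ≈-refl x≈0) (pointwise λ _ → ℚ.*-zeroʳ σ)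

  module _ {n n₀ d : ℕ} (f : Form ℝ-ring n₀ d) where

    -- For an `f` with squarefree monomials only, this is `f` after the substitution along `φ`, with
    -- no multinomial factors, times `τ ^ d`. The scale is given as a d-th power so that it passes
    -- into the linear forms.
    pullbackForm : ℚ → Vec (Fin n₀) n → Form ℝ-ring n d
    pullbackForm τ φ = record
      { coeff       = λ α → fromℚ (τ ^ℚ d) * coeff f (push φ α)
      ; homogeneous = λ α ≢d → fromℚ-*-≈0 (τ ^ℚ d) (coeff f (push φ α)) (homogeneous f (push φ α) (≢d ∘ trans (sym (degree-push φ α))))
      }

    pullbackForm-sumOfPowers : (∀ β → ¬ SquareFree β → coeff f β ≈ 0ℝ) →
      ∀ {r} → SumOfPowers (complexify f) r → ∀ τ φ → SumOfPowers (complexify (pullbackForm τ φ)) r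
    pullbackForm-sumOfPowers vanish {r} f-powers τ φ = powerSum-pullback ·-cancel-0 {n} {n₀} {d} {r}
      (complexify f) (complexify (pullbackForm τ φ)) (ofReal (fromℚ τ)) (ofReal (fromℚ (τ ^ℚ d))) φ
      (ofReal-^ τ d) (λ α → pointwise (λ k → real-part (τ ^ℚ d) (seq (coeff f (push φ α)) k))
          ,ᶜ pointwise (λ k → imaginary-part (τ ^ℚ d) (seq (coeff f (push φ α)) k)))
      (λ β ¬sf → ofReal-cong {coeff f β} {0ℝ} (vanish β ¬sf)) f-powers

  zeroForm : ∀ {n d} → Form ℝ-ring n d
  zeroForm = record { coeff = λ _ → 0ℝ ; homogeneous = λ _ _ → ≈-refl }

  infixl 6 _+ᶠ_

  _+ᶠ_ : ∀ {n d} → Form ℝ-ring n d → Form ℝ-ring n d → Form ℝ-ring n d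
  g +ᶠ h = record
    { coeff       = λ α → coeff g α + coeff h α
    ; homogeneous = λ α ≢d → ≈-trans
        (+-cong {coeff g α} {0ℝ} {coeff h α} {0ℝ} (homogeneous g α ≢d) (homogeneous h α ≢d)) (pointwise λ _ → refl)
    }

  mixture : ∀ {n n₀ d m} → Form ℝ-ring n₀ d → ℚ → Vec (Vec (Fin n₀) n) m → Form ℝ-ring n d
  mixture f τ []       = zeroForm
  mixture f τ (φ ∷ φs) = pullbackForm f τ φ +ᶠ mixture f τ φs

  mixture-sumOfPowers : ∀ {n n₀ d} (f : Form ℝ-ring n₀ d) → (∀ β → ¬ SquareFree β → coeff f β ≈ 0ℝ) →
    ∀ {r} → SumOfPowers (complexify f) r → ∀ τ {m} (φs : Vec (Vec (Fin n₀) n) m) →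
    SumOfPowers (complexify (mixture f τ φs)) (m ℕ.* r)
  mixture-sumOfPowers {n} {n₀} {d} f vanish {r} f-powers τ [] =
    powerSum-0 {n} {d} (complexify zeroForm) (λ _ → pointwise (λ _ → refl) ,ᶜ pointwise (λ _ → refl))
  mixture-sumOfPowers {n} {n₀} {d} f vanish {r} f-powers τ {suc m} (φ ∷ φs) = powerSum-+ {n} {d} {r} {m ℕ.* r}
    (complexify (pullbackForm f τ φ)) (complexify (mixture f τ φs)) (complexify (mixture f τ (φ ∷ φs)))
    (λ _ → pointwise (λ _ → refl) ,ᶜ pointwise (λ _ → refl))
    (pullbackForm-sumOfPowers f vanish f-powers τ φ) (mixture-sumOfPowers f vanish f-powers τ φs)

-- Coefficients of a mixture

module MixtureCoefficients where
  open RationalLemmas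
  open RealLemmas
  open ExponentVectors
  open Concentration using (hits)
  open Forms

  module _ {n n₀ d : ℕ} (f : Form ℝ-ring n₀ d) (vanish : ∀ β → ¬ SquareFree β → coeff f β ≈ 0ℝ) where

    pullbackForm-vanish : ∀ τ (φ : Vec (Fin n₀) n) α → ¬ SquareFree (push φ α) → coeff (pullbackForm f τ φ) α ≈ 0ℝ
    pullbackForm-vanish τ φ α ¬sf = fromℚ-*-≈0 (τ ^ℚ d) (coeff f (push φ α)) (vanish (push φ α) ¬sf)

    mixture-vanish : ∀ τ {m} (φs : Vec (Vec (Fin n₀) n) m) α → ¬ SquareFree α → coeff (mixture f τ φs) α ≈ 0ℝ
    mixture-vanish τ []       α ¬sf = ≈-refl
    mixture-vanish τ (φ ∷ φs) α ¬sf = ≈-trans {coeff (pullbackForm f τ φ) α + coeff (mixture f τ φs) α} {0ℝ + 0ℝ} {0ℝ}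
      (+-cong {coeff (pullbackForm f τ φ) α} {0ℝ} {coeff (mixture f τ φs) α} {0ℝ}
        (pullbackForm-vanish τ φ α (¬sf ∘ squareFree-push⁻ φ α)) (mixture-vanish τ φs α ¬sf))
      (pointwise {0ℝ + 0ℝ} {0ℝ} λ _ → refl)

    -- ≼ stands for ≤ or ≥.
    module _ (_≼_ : ℝ → ℝ → Set)
      (≈⇒≼ : ∀ x y → x ≈ y → x ≼ y)
      (≼-trans : ∀ x y z → x ≼ y → y ≼ z → x ≼ z)
      (+-mono-≼ : ∀ x y u v → x ≼ y → u ≼ v → (x + u) ≼ (y + v))
      (*-monoˡ-≼ : ∀ σ x y → 0ℚ ℚ.< σ → x ≼ y → (fromℚ σ * x) ≼ (fromℚ σ * y))
      (c : ℝ) (bound : ∀ β → SquareFree β → degree β ≡ d → c ≼ coeff f β)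
      (τ : ℚ) (τ>0 : 0ℚ ℚ.< τ) where

      -- Only the maps counted by `hits` contribute at `α`, each with `τ ^ d` times a squarefree
      -- coefficient of `f`; at the others `f` vanishes.
      mixture-bound : ∀ {m} (φs : Vec (Vec (Fin n₀) n) m) α → degree α ≡ d →
        ∀ s → s ≡ τ ^ℚ d ℚ.* ι (hits φs α) → (fromℚ s * c) ≼ coeff (mixture f τ φs) α
      mixture-bound []       α eq s s≡ = ≈⇒≼ (fromℚ s * c) 0ℝ (pointwise λ k →
        trans (cong (ℚ._* seq c k) (trans s≡ (ℚ.*-zeroʳ (τ ^ℚ d)))) (ℚ.*-zeroˡ (seq c k)))
      mixture-bound (φ ∷ φs) α eq s s≡ = step (squareFree? (push φ α))
        where
        X = hits φs α
        split : ∀ x p → (∀ k → s ℚ.* seq c k ≡ seq x k ℚ.+ p ℚ.* seq c k) → p ≡ (τ ^ℚ d) ℚ.* ι X →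
                x ≼ (coeff (pullbackForm f τ φ) α) → (fromℚ s * c) ≼ (coeff (pullbackForm f τ φ) α + coeff (mixture f τ φs) α)
        split x p x≡ p≡ x≼ = ≼-trans (fromℚ s * c) (x + fromℚ p * c) (coeff (pullbackForm f τ φ) α + coeff (mixture f τ φs) α)
          (≈⇒≼ (fromℚ s * c) (x + fromℚ p * c) (pointwise x≡))
          (+-mono-≼ x (coeff (pullbackForm f τ φ) α) (fromℚ p * c) (coeff (mixture f τ φs) α) x≼ (mixture-bound φs α eq p p≡))
        s≡′ : ∀ {b} → 𝟙 (push φ α) ≡ b → s ≡ (τ ^ℚ d) ℚ.* ι (b ℕ.+ X)
        s≡′ refl = s≡
        add : s ≡ (τ ^ℚ d) ℚ.* ι (suc X) → ∀ p → p ≡ (τ ^ℚ d) ℚ.* ι X → ∀ q → s ℚ.* q ≡ (τ ^ℚ d) ℚ.* q ℚ.+ p ℚ.* q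
        add s≡ p p≡ q = trans (cong (ℚ._* q) (trans s≡ (trans (ℚ.*-comm (τ ^ℚ d) (ι (suc X))) (trans (ι-suc-* X (τ ^ℚ d))
          (cong ((τ ^ℚ d) ℚ.+_) (trans (ℚ.*-comm (ι X) (τ ^ℚ d)) (sym p≡))))))) (ℚ.*-distribʳ-+ q (τ ^ℚ d) p)
        step : Dec (SquareFree (push φ α)) → (fromℚ s * c) ≼ (coeff (pullbackForm f τ φ) α + coeff (mixture f τ φs) α)
        step (yes sf) = split (fromℚ (τ ^ℚ d) * c) ((τ ^ℚ d) ℚ.* ι X) (λ k → add (s≡′ (𝟙-yes sf)) ((τ ^ℚ d) ℚ.* ι X) refl (seq c k)) refl
          (*-monoˡ-≼ (τ ^ℚ d) c (coeff f (push φ α)) (^ℚ>0 τ>0 d) (bound (push φ α) sf (trans (degree-push φ α) eq)))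
        step (no ¬sf) = split 0ℝ ((τ ^ℚ d) ℚ.* ι X) (λ k → trans (cong (ℚ._* seq c k) (s≡′ (𝟙-no ¬sf))) (sym (ℚ.+-identityˡ ((τ ^ℚ d) ℚ.* ι X ℚ.* seq c k)))) refl
          (≈⇒≼ 0ℝ (coeff (pullbackForm f τ φ) α) (≈-sym {coeff (pullbackForm f τ φ) α} {0ℝ} (pullbackForm-vanish τ φ α ¬sf)))

    mixture-lower = mixture-bound _≤_ (λ x y → ≈⇒≤ {x} {y}) (λ x y z → ≤-trans {x} {y} {z})
      (λ x y u v → +-mono-≤ {x} {y} {u} {v}) (λ σ x y → fromℚ-*-monoˡ-≤ {σ} {x} {y})

    mixture-upper = mixture-bound (flip _≤_) (λ x y → ≈⇒≤ {y} {x} ∘ ≈-sym) (λ x y z p q → ≤-trans {z} {y} {x} q p)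
      (λ x y u v → +-mono-≤ {y} {x} {v} {u}) (λ σ x y → fromℚ-*-monoˡ-≤ {σ} {y} {x})

-- Estimates for the coefficients and the rank

module Estimates where
  open RationalLemmas
  open +-*-Solver using (solve; _:=_; _:+_; _:*_; _:-_; :-_; con)
  open ℚ.≤-Reasoning
  open Delta using (At; module At)

  ratio-upper : ∀ {σ} A B X k .{{_ : ℕ.NonZero B}} → σ ℚ.* ι B ≡ ι A → A ℕ.* X ℕ.* k ℕ.≤ B ℕ.* (5 ℕ.+ k) →
    ∀ s → s ≡ σ ℚ.* ι X → s ℚ.* ι k ℚ.≤ ι 5 ℚ.+ ι k
  ratio-upper {σ} A B X k σB≡A le _ refl = *-cancelˡ (ι B) (ι>0 (ℕ.>-nonZero⁻¹ B)) (begin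
    ι B ℚ.* (σ ℚ.* ι X ℚ.* ι k) ≡⟨ solve 4 (λ b s x k → b :* (s :* x :* k) := s :* b :* x :* k) refl (ι B) σ (ι X) (ι k) ⟩
    σ ℚ.* ι B ℚ.* ι X ℚ.* ι k   ≡⟨ cong (λ t → t ℚ.* ι X ℚ.* ι k) σB≡A ⟩
    ι A ℚ.* ι X ℚ.* ι k         ≡⟨ trans (ι-* (A ℕ.* X) k) (cong (ℚ._* ι k) (ι-* A X)) ⟨
    ι (A ℕ.* X ℕ.* k)           ≤⟨ ι-mono-≤ le ⟩
    ι (B ℕ.* (5 ℕ.+ k))         ≡⟨ trans (ι-* B (5 ℕ.+ k)) (cong (ι B ℚ.*_) (ι-+ 5 k)) ⟩
    ι B ℚ.* (ι 5 ℚ.+ ι k)       ∎)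

  ratio-lower : ∀ {σ} A B X k .{{_ : ℕ.NonZero B}} → σ ℚ.* ι B ≡ ι A → B ℕ.* k ℕ.≤ A ℕ.* X ℕ.* (5 ℕ.+ k) →
    ∀ s → s ≡ σ ℚ.* ι X → ι k ℚ.≤ s ℚ.* (ι 5 ℚ.+ ι k)
  ratio-lower {σ} A B X k σB≡A le _ refl = *-cancelˡ (ι B) (ι>0 (ℕ.>-nonZero⁻¹ B)) (begin
    ι B ℚ.* ι k                             ≡⟨ ι-* B k ⟨
    ι (B ℕ.* k)                             ≤⟨ ι-mono-≤ le ⟩
    ι (A ℕ.* X ℕ.* (5 ℕ.+ k))               ≡⟨ trans (ι-* (A ℕ.* X) (5 ℕ.+ k)) (cong₂ ℚ._*_ (ι-* A X) (ι-+ 5 k)) ⟩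
    ι A ℚ.* ι X ℚ.* (ι 5 ℚ.+ ι k)           ≡⟨ cong (λ t → t ℚ.* ι X ℚ.* (ι 5 ℚ.+ ι k)) σB≡A ⟨
    σ ℚ.* ι B ℚ.* ι X ℚ.* (ι 5 ℚ.+ ι k)     ≡⟨ solve 4 (λ b s x k → b :* (s :* x :* k) := s :* b :* x :* k) refl (ι B) σ (ι X) (ι 5 ℚ.+ ι k) ⟨
    ι B ℚ.* (σ ℚ.* ι X ℚ.* (ι 5 ℚ.+ ι k))   ∎)

  module _ {s k D e₀ e : ℚ} (k>0 : 0ℚ ℚ.< k) (5≤k[D-1] : ι 5 ℚ.≤ k ℚ.* (D ℚ.- 1ℚ)) (facts : At D e₀ e) where
    open At facts

    -- That is, `1 + 5/k ≤ D`. The scaled hit count `s` therefore lies between `1 / D` and `D`,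
    -- which by `plus` and `minus` is the room between `e₀` and `e`.
    5+k≤kD : ι 5 ℚ.+ k ℚ.≤ k ℚ.* D
    5+k≤kD = begin
      ι 5 ℚ.+ k               ≤⟨ ℚ.+-monoˡ-≤ k 5≤k[D-1] ⟩
      k ℚ.* (D ℚ.- 1ℚ) ℚ.+ k  ≡⟨ solve 2 (λ k d → k :* (d :- con 1ℚ) :+ k := k :* d) refl k D ⟩
      k ℚ.* D                 ∎

    coefficient-upper : s ℚ.* k ℚ.≤ ι 5 ℚ.+ k → s ℚ.* (1ℚ ℚ.+ e₀) ℚ.≤ 1ℚ ℚ.+ e
    coefficient-upper sk≤5+k = *-cancelˡ k k>0 (begin
      k ℚ.* (s ℚ.* (1ℚ ℚ.+ e₀))   ≡⟨ solve 3 (λ k s t → k :* (s :* t) := s :* k :* t) refl k s (1ℚ ℚ.+ e₀) ⟩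
      s ℚ.* k ℚ.* (1ℚ ℚ.+ e₀)     ≤⟨ *-monoʳ (1ℚ ℚ.+ e₀) 1+e₀≥0 (ℚ.≤-trans sk≤5+k 5+k≤kD) ⟩
      k ℚ.* D ℚ.* (1ℚ ℚ.+ e₀)     ≡⟨ ℚ.*-assoc k D (1ℚ ℚ.+ e₀) ⟩
      k ℚ.* (D ℚ.* (1ℚ ℚ.+ e₀))   ≤⟨ *-monoˡ k (ℚ.<⇒≤ k>0) plus ⟩
      k ℚ.* (1ℚ ℚ.+ e)            ∎)

    coefficient-lower : 0ℚ ℚ.≤ s → k ℚ.≤ s ℚ.* (ι 5 ℚ.+ k) → 1ℚ ℚ.- e ℚ.≤ s ℚ.* (1ℚ ℚ.- e₀)
    coefficient-lower s≥0 k≤s[5+k] = *-cancelˡ k k>0 (begin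
      k ℚ.* (1ℚ ℚ.- e)                  ≤⟨ *-monoʳ (1ℚ ℚ.- e) 1-e≥0 (ℚ.≤-trans k≤s[5+k] (*-monoˡ s s≥0 5+k≤kD)) ⟩
      s ℚ.* (k ℚ.* D) ℚ.* (1ℚ ℚ.- e)    ≡⟨ solve 4 (λ s k d t → s :* (k :* d) :* t := k :* s :* (d :* t)) refl s k D (1ℚ ℚ.- e) ⟩
      k ℚ.* s ℚ.* (D ℚ.* (1ℚ ℚ.- e))    ≤⟨ *-monoˡ (k ℚ.* s) (*-nonNegative (ℚ.<⇒≤ k>0) s≥0) minus ⟩
      k ℚ.* s ℚ.* (1ℚ ℚ.- e₀)           ≡⟨ ℚ.*-assoc k s (1ℚ ℚ.- e₀) ⟩
      k ℚ.* (s ℚ.* (1ℚ ℚ.- e₀))         ∎)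

  -- The constant is `6 * 2 * 17²`: 6 from the number of maps, 2 from `log₂≤2log`, and `17²` from
  -- trading `k²` for `17² / x²`, where `x` approximates `δ - 1`.
  rank-bound : ∀ {r x S} A u L d k v R → 0ℚ ℚ.< r → r ℚ.* (ι u ℚ.* (x ℚ.* x)) ≡ 1ℚ →
    A ℕ.* u ℕ.≤ 6 ℕ.* (L ℕ.* d ℕ.* (k ℕ.* k) ℕ.* v) ℕ.* R →
    0ℚ ℚ.≤ ι k ℚ.* x → ι k ℚ.* x ℚ.≤ ι 17 → ι L ℚ.≤ ι 2 ℚ.* S →
    ι A ℚ.≤ ι 3468 ℚ.* (ι R ℚ.* ι v ℚ.* (ι d ℚ.* S) ℚ.* r)
  rank-bound {r} {x} {S} A u L d k v R r>0 r≡ Au≤ kx≥0 kx≤17 L≤2S = begin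
    ι A                                        ≡⟨ ℚ.*-identityʳ (ι A) ⟨
    ι A ℚ.* 1ℚ                                 ≡⟨ cong (ι A ℚ.*_) r≡ ⟨
    ι A ℚ.* (r ℚ.* (ι u ℚ.* (x ℚ.* x)))        ≡⟨ solve 4 (λ a r u y → a :* (r :* (u :* y)) := r :* (a :* u :* y)) refl (ι A) r (ι u) (x ℚ.* x) ⟩
    r ℚ.* (ι A ℚ.* ι u ℚ.* (x ℚ.* x))          ≡⟨ cong (λ t → r ℚ.* (t ℚ.* (x ℚ.* x))) (ι-* A u) ⟨
    r ℚ.* (ι (A ℕ.* u) ℚ.* (x ℚ.* x))          ≤⟨ *-monoˡ r r≥0 (*-monoʳ (x ℚ.* x) (square≥0 x) (ι-mono-≤ Au≤)) ⟩
    r ℚ.* (ι (6 ℕ.* (L ℕ.* d ℕ.* (k ℕ.* k) ℕ.* v) ℕ.* R) ℚ.* (x ℚ.* x))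
      ≡⟨ cong (λ t → r ℚ.* (t ℚ.* (x ℚ.* x))) ι-product ⟩
    r ℚ.* (ι 6 ℚ.* (ι L ℚ.* ι d ℚ.* (ι k ℚ.* ι k) ℚ.* ι v) ℚ.* ι R ℚ.* (x ℚ.* x))
      ≡⟨ solve 8 (λ r c l d k v R x → r :* (c :* (l :* d :* (k :* k) :* v) :* R :* (x :* x)) :=
           r :* (c :* d :* v :* R :* l :* (k :* x :* (k :* x)))) refl r (ι 6) (ι L) (ι d) (ι k) (ι v) (ι R) x ⟩
    r ℚ.* (c ℚ.* ι L ℚ.* (ι k ℚ.* x ℚ.* (ι k ℚ.* x)))
      ≤⟨ *-monoˡ r r≥0 (*-monoˡ (c ℚ.* ι L) (*-nonNegative c≥0 (ι≥0 L)) (square-mono kx≥0 kx≤17)) ⟩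
    r ℚ.* (c ℚ.* ι L ℚ.* (ι 17 ℚ.* ι 17))
      ≤⟨ *-monoˡ r r≥0 (*-monoʳ (ι 17 ℚ.* ι 17) (square≥0 (ι 17)) (*-monoˡ c c≥0 L≤2S)) ⟩
    r ℚ.* (c ℚ.* (ι 2 ℚ.* S) ℚ.* (ι 17 ℚ.* ι 17))
      ≡⟨ solve 5 (λ r d v R S → r :* (con (ι 6) :* d :* v :* R :* (con (ι 2) :* S) :* (con (ι 17) :* con (ι 17))) :=
           con (ι 3468) :* (R :* v :* (d :* S) :* r)) refl r (ι d) (ι v) (ι R) S ⟩
    ι 3468 ℚ.* (ι R ℚ.* ι v ℚ.* (ι d ℚ.* S) ℚ.* r) ∎
    where
    r≥0 = ℚ.<⇒≤ r>0
    c = ι 6 ℚ.* ι d ℚ.* ι v ℚ.* ι R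
    c≥0 = *-nonNegative (*-nonNegative (*-nonNegative (ι≥0 6) (ι≥0 d)) (ι≥0 v)) (ι≥0 R)
    square≥0 : ∀ y → 0ℚ ℚ.≤ y ℚ.* y
    square≥0 y with ℚ.≤-total 0ℚ y
    ... | inj₁ 0≤y = *-nonNegative 0≤y 0≤y
    ... | inj₂ y≤0 = subst (0ℚ ℚ.≤_) (solve 1 (λ y → (:- y) :* (:- y) := y :* y) refl y)
                       (*-nonNegative (ℚ.neg-antimono-≤ y≤0) (ℚ.neg-antimono-≤ y≤0))
    ι-product : ι (6 ℕ.* (L ℕ.* d ℕ.* (k ℕ.* k) ℕ.* v) ℕ.* R) ≡ ι 6 ℚ.* (ι L ℚ.* ι d ℚ.* (ι k ℚ.* ι k) ℚ.* ι v) ℚ.* ι R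
    ι-product = trans (ι-* (6 ℕ.* Y) R) (cong (ℚ._* ι R) (trans (ι-* 6 Y) (cong (ι 6 ℚ.*_)
      (trans (ι-* (L ℕ.* d ℕ.* (k ℕ.* k)) v) (cong (ℚ._* ι v) (trans (ι-* (L ℕ.* d) (k ℕ.* k)) (cong₂ ℚ._*_ (ι-* L d) (ι-* k k))))))))
      where Y = L ℕ.* d ℕ.* (k ℕ.* k) ℕ.* v

-- Least elements up to double negation

module Ranks where
  -- As `Q` is not assumed decidable, the least number principle is available only doubly negated;
  -- it follows by descent, with `b` bounding the recursion.
  ¬¬-least : ∀ (Q : ℕ → Set) r → Q r → ¬ ¬ (∃[ k ] k ℕ.≤ r × Least Q k)
  ¬¬-least Q r = below r r ℕ.≤-refl
    where
    below : ∀ b r → r ℕ.≤ b → Q r → ¬ ¬ (∃[ k ] k ℕ.≤ r × Least Q k)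
    below b r r≤b Qr none = none (r , ℕ.≤-refl , Qr , λ k Qk → ℕ.≮⇒≥ (smaller b r≤b k Qk))
      where
      smaller : ∀ b → r ℕ.≤ b → ∀ k → Q k → ¬ k ℕ.< r
      smaller zero    r≤0 k Qk k<r = contradiction (ℕ.≤-trans k<r r≤0) λ ()
      smaller (suc b) r≤b k Qk k<r = below b k (ℕ.≤-pred (ℕ.≤-trans k<r r≤b)) Qk
        λ (j , j≤k , least) → none (j , ℕ.≤-trans j≤k (ℕ.<⇒≤ k<r) , least)

  HasRank : ℝ → (n d : ℕ) → ℕ → Set
  HasRank ε n d r = ∃[ g ] 𝔈 ε n d g × WaringRank (complexify g) r

  -- The rank of `g` is known only under a double negation, which the bound sheds because `A ≤ r` is
  -- decidable.
  minRank-bounds : ∀ {ε n d r} (g : Form ℝ-ring n d) → 𝔈 ε n d g → SumOfPowers (complexify g) r →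
    (¬ ¬ ∃ (MinRank ε n d)) × (∀ A → MinRank ε n d A → A ℕ.≤ r)
  minRank-bounds {ε} {n} {d} {r} g g∈𝔈 g-powers =
      (λ none → ranked λ (k , _ , rank) → ¬¬-least (HasRank ε n d) k (g , g∈𝔈 , rank) λ (A , _ , least) → none (A , least))
    , λ A (_ , minimal) → decidable-stable (A ℕ.≤? r) λ A≰r → ranked λ (k , k≤r , rank) →
        A≰r (ℕ.≤-trans (minimal k (g , g∈𝔈 , rank)) k≤r)
    where
    ranked : ¬ ¬ (∃[ k ] k ℕ.≤ r × WaringRank (complexify g) k)
    ranked = ¬¬-least (SumOfPowers (complexify g)) r g-powers

  P≡P′ : ∀ {n k} → k ℕ.≤ n → n P k ≡ n P′ k
  P≡P′ {n} {k} k≤n with k ℕ.≤ᵇ n | ℕ.≤⇒≤ᵇ k≤n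
  ... | true | _ = refl

-- Membership of the mixture in 𝔈

module Mixing where
  open RationalLemmas
  open RealLemmas
  open ExponentVectors
  open Concentration using (hits; concentration)
  open Parameters
  open PowerInequalities using (approximate-root)
  open Forms
  open MixtureCoefficients
  open Estimates
  open Delta
  open Ranks

  vanish : ∀ {ε n d} (f : Form ℝ-ring n d) → 𝔈 ε n d f → ∀ β → ¬ SquareFree β → coeff f β ≈ 0ℝ
  vanish f (support , _) β ¬sf = ≈0-stable {coeff f β} λ ≉0 → ¬sf (proj₂ (Equivalence.to (support β) ≉0))

  module _ {n₀ d : ℕ} {ε₀ : ℝ} (f : Form ℝ-ring n₀ d) (f∈𝔈 : 𝔈 ε₀ n₀ d f) where

    coefficient-bounds : ∀ β → SquareFree β → degree β ≡ d → 1ℝ - ε₀ ≤ coeff f β × coeff f β ≤ 1ℝ + ε₀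
    coefficient-bounds β sf eq = proj₂ f∈𝔈 β (Equivalence.from (proj₁ f∈𝔈 β) (eq , sf))

    -- The last hypothesis says that multiplication by the scaled hit count `s` takes the
    -- coefficient range for `ε₀` into that for `ε`. Since `1 - ε` is positive, the lower bound also
    -- yields the full support.
    mixture-𝔈 : ∀ {n ε τ m} (φs : Vec (Vec (Fin n₀) n) m) → 0ℚ ℚ.< τ → ε < 1ℝ →
      (∀ α → SquareFree α → degree α ≡ d → ∀ s → s ≡ τ ^ℚ d ℚ.* ι (hits φs α) →
        (Eventually λ k → 1ℚ ℚ.- seq ε k ℚ.≤ s ℚ.* (1ℚ ℚ.- seq ε₀ k)) ×
        (Eventually λ k → s ℚ.* (1ℚ ℚ.+ seq ε₀ k) ℚ.≤ 1ℚ ℚ.+ seq ε k)) →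
      𝔈 ε n d (mixture f τ φs)
    mixture-𝔈 {n} {ε} {τ} φs τ>0 ε<1 balanced = (λ α → mk⇔ (support α) (λ (eq , sf) → nonzero α sf eq))
      , λ α ≉0 → let (eq , sf) = support α ≉0 in lower α sf eq _ refl , upper α sf eq _ refl
      where
      lower : ∀ α → SquareFree α → degree α ≡ d → ∀ s → s ≡ τ ^ℚ d ℚ.* ι (hits φs α) → 1ℝ - ε ≤ coeff (mixture f τ φs) α
      lower α sf eq s s≡ = ≤-trans {1ℝ - ε} {fromℚ s * (1ℝ - ε₀)} {coeff (mixture f τ φs) α}
        (eventually-≤ {1ℝ - ε} {fromℚ s * (1ℝ - ε₀)} (proj₁ (balanced α sf eq s s≡)))
        (mixture-lower f (vanish {ε₀} {n₀} {d} f f∈𝔈) (1ℝ - ε₀) (λ β sf eq → proj₁ (coefficient-bounds β sf eq)) τ τ>0 φs α eq s s≡)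
      upper : ∀ α → SquareFree α → degree α ≡ d → ∀ s → s ≡ τ ^ℚ d ℚ.* ι (hits φs α) → coeff (mixture f τ φs) α ≤ 1ℝ + ε
      upper α sf eq s s≡ = ≤-trans {coeff (mixture f τ φs) α} {fromℚ s * (1ℝ + ε₀)} {1ℝ + ε}
        (mixture-upper f (vanish {ε₀} {n₀} {d} f f∈𝔈) (1ℝ + ε₀) (λ β sf eq → proj₂ (coefficient-bounds β sf eq)) τ τ>0 φs α eq s s≡)
        (eventually-≤ {fromℚ s * (1ℝ + ε₀)} {1ℝ + ε} (proj₂ (balanced α sf eq s s≡)))
      nonzero : ∀ α → SquareFree α → degree α ≡ d → ¬ coeff (mixture f τ φs) α ≈ 0ℝ
      nonzero α sf eq = 0<⇒≉0 {1ℝ - ε} {coeff (mixture f τ φs) α} (x<y⇒0<y-x {ε} {1ℝ} ε<1) (lower α sf eq _ refl)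
      support : ∀ α → ¬ coeff (mixture f τ φs) α ≈ 0ℝ → degree α ≡ d × SquareFree α
      -- Degree and squarefreeness are decidable, so refuting their negation suffices.
      support α ≉0 = decidable-stable (degree α ℕ.≟ d) (λ ≢d → ≉0 (homogeneous (mixture f τ φs) α ≢d))
        , decidable-stable (squareFree? α) (λ ¬sf → ≉0 (mixture-vanish f (vanish {ε₀} {n₀} {d} f f∈𝔈) τ φs α ¬sf))

  module Approximation {n₀ d : ℕ} (1≤d : 1 ℕ.≤ d) (d≤n₀ : d ℕ.≤ n₀) {ε₀ ε x : ℝ} (f : Form ℝ-ring n₀ d) (f∈𝔈 : 𝔈 ε₀ n₀ d f)
    {Rf : ℕ} (f-powers : SumOfPowers (complexify f) Rf) (ε<1 : ε < 1ℝ)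
    (at : Eventually (λ j → At (seq x j) (seq ε₀ j) (seq ε j)))
    (c : ℕ) (5≤kx : Eventually (λ j → ι 5 ℚ.≤ ι (4 ℕ.+ c) ℚ.* (seq x j ℚ.- 1ℚ))) where

    private
      k = 4 ℕ.+ c
      u = n₀ P′ d
      v = n₀ ℕ.^ d
      instance
        n₀≢0 : ℕ.NonZero n₀
        n₀≢0 = ℕ.>-nonZero (ℕ.≤-trans 1≤d d≤n₀)
        v≢0 : ℕ.NonZero v
        v≢0 = ℕ.m^n≢0 n₀ d

    balanced : ∀ {n m} i N-1 (let N = suc N-1) → 1 ℕ.≤ i → N ℕ.^ d ℕ.* v ℕ.≤ i ℕ.^ d ℕ.* (m ℕ.* u) →
      i ℕ.^ d ℕ.* (m ℕ.* u) ℕ.* k ℕ.≤ N ℕ.^ d ℕ.* v ℕ.* suc k → ∀ (φs : Vec (Vec (Fin n₀) n) m) α →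
      hits φs α ℕ.* (v ℕ.* k) ℕ.≤ m ℕ.* u ℕ.* suc (suc k) →
      m ℕ.* u ℕ.* (3 ℕ.+ c) ℕ.≤ hits φs α ℕ.* (v ℕ.* k) ℕ.+ m ℕ.* u →
      ∀ s → s ≡ (ι i ℚ.* unit N-1) ^ℚ d ℚ.* ι (hits φs α) →
      (Eventually λ j → 1ℚ ℚ.- seq ε j ℚ.≤ s ℚ.* (1ℚ ℚ.- seq ε₀ j)) ×
      (Eventually λ j → s ℚ.* (1ℚ ℚ.+ seq ε₀ j) ℚ.≤ 1ℚ ℚ.+ seq ε j)
    balanced {n} {m} i N-1 i>0 root-lower root-upper φs α above below s s≡ =
        both (λ j facts 5≤ → coefficient-lower {s} {ι k} {seq x j} {seq ε₀ j} {seq ε j} k>0 5≤ facts s≥0 (ratio-lower {(ι i ℚ.* unit N-1) ^ℚ d} A B X k σB≡A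
          (scaled-hits-lower c v (m ℕ.* u) A B X root-lower root-upper above below) s s≡)) at 5≤kx
      , both (λ j facts 5≤ → coefficient-upper {s} {ι k} {seq x j} {seq ε₀ j} {seq ε j} k>0 5≤ facts (ratio-upper {(ι i ℚ.* unit N-1) ^ℚ d} A B X k σB≡A
          (scaled-hits-upper c v (m ℕ.* u) A B X root-lower root-upper above below) s s≡)) at 5≤kx
      where
      X = hits φs α
      A = i ℕ.^ d
      B = suc N-1 ℕ.^ d
      instance
        B≢0 : ℕ.NonZero B
        B≢0 = ℕ.m^n≢0 (suc N-1) d
      k>0 = ι>0 {k} ℕ.z<s
      σB≡A : (ι i ℚ.* unit N-1) ^ℚ d ℚ.* ι B ≡ ι A
      σB≡A = ^ℚ-fraction {b = suc N-1} (trans (ℚ.*-assoc (ι i) (unit N-1) (ι (suc N-1)))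
        (trans (cong (ι i ℚ.*_) (trans (ℚ.*-comm (unit N-1) (ι (suc N-1))) (ι*unit≡1 N-1))) (ℚ.*-identityʳ (ι i)))) d
      s≥0 : 0ℚ ℚ.≤ s
      s≥0 = subst (0ℚ ℚ.≤_) (sym s≡) (*-nonNegative (ℚ.<⇒≤ (^ℚ>0 (*>0 (ι>0 i>0) (unit>0 N-1)) d)) (ι≥0 X))

    approximant : ∀ n → 2 ℕ.≤ n → ∃[ L ] ∃[ m ] 2 ℕ.^ L ℕ.≤ n × m ℕ.* u ℕ.≤ 6 ℕ.* (L ℕ.* d ℕ.* (k ℕ.* k) ℕ.* v) ×
      (Σ[ g ∈ Form ℝ-ring n d ] 𝔈 ε n d g × SumOfPowers (complexify g) (m ℕ.* Rf))
    approximant n 2≤n = case number-of-maps n₀ d n k 1≤d d≤n₀ 2≤n (ℕ.s≤s ℕ.z≤n) of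
      λ (L , e , m , 2^L≤n , few , large , small , 1≤M) → L , m , 2^L≤n , small ,
        (case approximate-root d (m ℕ.* u) v k 1≤d 1≤M (ℕ.m^n>0 n₀ d) of
          -- The argument `3 + c` is `κ = k - 1`.
          λ (i , N-1 , i>0 , root-lower , root-upper) → case concentration n₀ n d (3 ℕ.+ c) e m few large of
            λ (φs , concentrated) → mixture f (ι i ℚ.* unit N-1) φs
              , mixture-𝔈 {n₀} {d} {ε₀} f f∈𝔈 {n} {ε} {ι i ℚ.* unit N-1} φs (*>0 (ι>0 i>0) (unit>0 N-1)) ε<1
                  (λ α sf eq → balanced {n} {m} i N-1 i>0 root-lower root-upper φs α
                    (proj₁ (concentrated α sf eq)) (proj₂ (concentrated α sf eq)))
              , mixture-sumOfPowers f (vanish {ε₀} {n₀} {d} f f∈𝔈) f-powers (ι i ℚ.* unit N-1) φs)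

-- The rank estimate for real numbers

module RankEstimate where
  open RationalLemmas
  open RealLemmas
  open Estimates

  rank-estimate : ∀ A u L d k v R n (x : ℝ) (D>0 : 0ℝ < fromℕ u * (x - 1ℝ) ²) →
    A ℕ.* u ℕ.≤ 6 ℕ.* (L ℕ.* d ℕ.* (k ℕ.* k) ℕ.* v) ℕ.* R → 2 ℕ.^ L ℕ.≤ n →
    Eventually (λ j → ι 5 ℚ.≤ ι k ℚ.* (seq x j ℚ.- 1ℚ) × ι k ℚ.* (seq x j ℚ.- 1ℚ) ℚ.≤ ι 17) →
    fromℕ A ≤ fromℕ 3468 * ((fromℕ R * fromℕ v * (fromℕ d * log n)) ÷ (fromℕ u * (x - 1ℝ) ²) [ D>0 ])
  rank-estimate A u L d k v R n x D>0 Au≤ 2^L≤n scaled =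
    eventually-≤ {fromℕ A} {fromℕ 3468 * ((fromℕ R * fromℕ v * (fromℕ d * log n)) ÷ (fromℕ u * (x - 1ℝ) ²) [ D>0 ])}
      (both (λ j (r>0 , r≡) (5≤kx , kx≤17) →
        rank-bound {seq ((fromℕ u * (x - 1ℝ) ²) ⁻¹[ D>0 ]) j} {seq x j ℚ.- 1ℚ} {seq (log n) j} A u L d k v R r>0 r≡ Au≤
          (ℚ.≤-trans (ι≥0 5) 5≤kx) kx≤17 (log₂≤2log n L 2^L≤n j))
        (reciprocal (fromℕ u * (x - 1ℝ) ²) D>0) scaled)

theorem56 :
    Σ[ C ∈ ℝ ]
    ∀ (n₀ d : ℕ) → 1 ℕ.≤ d → (d≤n₀ : d ℕ.≤ n₀) →
    ∀ (ε₀ : ℝ) (0<ε₀ : 0ℝ < ε₀) → ε₀ < 1ℝ →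
    ∀ (f : Form ℝ-ring n₀ d) → 𝔈 ε₀ n₀ d f →
    ∀ (Rf : ℕ) → WaringRank (complexify f) Rf →
    ∀ (ε : ℝ) (ε₀<ε : ε₀ < ε) (ε<1 : ε < 1ℝ) →
    ∀ (n : ℕ) → d ℕ.≤ n → 2 ℕ.≤ n →
    (¬ ¬ ∃ (MinRank ε n d)) ×
    (∀ A → MinRank ε n d A →
      fromℕ A ≤ C * ((fromℕ Rf * fromℕ (n₀ ℕ.^ d) * (fromℕ d * log n))
                     ÷ (fromℕ (n₀ P d) * (δ 0<ε₀ ε₀<ε ε<1 - 1ℝ) ²)
                     [ denominator>0 n₀ d (δ 0<ε₀ ε₀<ε ε<1) d≤n₀ (1<δ 0<ε₀ ε₀<ε ε<1) ]))
theorem56 = fromℕ 3468 , λ n₀ d 1≤d d≤n₀ ε₀ 0<ε₀ ε₀<1 f f∈𝔈 Rf (f-powers , _) ε ε₀<ε ε<1 n d≤n 2≤n →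
  case Delta.scale {δ 0<ε₀ ε₀<ε ε<1} (1<δ 0<ε₀ ε₀<ε ε<1) (map (λ _ → Delta.At.≤2) (Delta.δ-eventually 0<ε₀ ε₀<ε ε<1)) of
  λ (c , scaled) → case Mixing.Approximation.approximant 1≤d d≤n₀ {ε₀} {ε} {δ 0<ε₀ ε₀<ε ε<1} f f∈𝔈 {Rf} f-powers ε<1
      (Delta.δ-eventually 0<ε₀ ε₀<ε ε<1) c (map (λ _ → proj₁) scaled) n 2≤n of
  λ (L , m , 2^L≤n , small , g , g∈𝔈 , g-powers) →
    proj₁ (Ranks.minRank-bounds {ε} {n} {d} {m ℕ.* Rf} g g∈𝔈 g-powers)
  , λ A minRank → RankEstimate.rank-estimate A (n₀ P d) L d (4 ℕ.+ c) (n₀ ℕ.^ d) Rf n (δ 0<ε₀ ε₀<ε ε<1)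
      (denominator>0 n₀ d (δ 0<ε₀ ε₀<ε ε<1) d≤n₀ (1<δ 0<ε₀ ε₀<ε ε<1))
      (subst (λ u → A ℕ.* u ℕ.≤ 6 ℕ.* (L ℕ.* d ℕ.* ((4 ℕ.+ c) ℕ.* (4 ℕ.+ c)) ℕ.* n₀ ℕ.^ d) ℕ.* Rf) (sym (Ranks.P≡P′ d≤n₀))
        (total-forms A m (n₀ P′ d) (proj₂ (Ranks.minRank-bounds {ε} {n} {d} {m ℕ.* Rf} g g∈𝔈 g-powers) A minRank) small))
      2^L≤n scaled
  where
  total-forms : ∀ A m u {T R} → A ℕ.≤ m ℕ.* R → m ℕ.* u ℕ.≤ T → A ℕ.* u ℕ.≤ T ℕ.* R
  total-forms A m u {T} {R} A≤mR mu≤T = begin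
    A ℕ.* u           ≤⟨ ℕ.*-monoˡ-≤ u A≤mR ⟩
    m ℕ.* R ℕ.* u     ≡⟨ trans (ℕ.*-assoc m R u) (trans (cong (m ℕ.*_) (ℕ.*-comm R u)) (sym (ℕ.*-assoc m u R))) ⟩
    m ℕ.* u ℕ.* R     ≤⟨ ℕ.*-monoˡ-≤ R mu≤T ⟩
    T ℕ.* R           ∎
    where open ℕ.≤-Reasoning
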